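{- There exists $k_0$ such that for every even integer $k \geq k_0$ we have $\underset{\sim}{Q}(\Phi_{(k/2,k/2)}) = 2$, i.e. $\lim_{n\to\infty} Q(\Phi_{(k/2,k/2)}^{\boxtimes n})^{1/n} = 2$.
   Context: A $k$-graph is a tuple of finite sets $V_1,\ldots,V_k$ together with a subset $\Phi \subseteq V_1\times\cdots\times V_k$. A subset $\Psi\subseteq\Phi$ is induced if $\Psi = \Phi\cap(\Psi_1\times\cdots\times\Psi_k)$, where $\Psi_i=\{a_i : a\in\Psi\}$; it is a matching if any two distinct $a,b\in\Psi$ satisfy $a_i\neq b_i$ for all $i\in[k]$. The subrank $Q(\Phi)$ is the maximum size of an induced matching $\Psi\subseteq\Phi$. The Kronecker product of $\Phi\subseteq V_1\times\cdots\times V_k$ and $\Psi\subseteq W_1\times\cdots\times W_k$ is $\Phi\boxtimes\Psi=\{((a_1,b_1),\ldots,(a_k,b_k)) : a\in\Phi, b\in\Psi\}\subseteq (V_1\times W_1)\times\cdots\times(V_k\times W_k)$, and $\Phi^{\boxtimes n}$ is the $n$-fold power. The asymptotic subrank is $\underset{\sim}{Q}(\Phi)=\lim_{n\to\infty}Q(\Phi^{\boxtimes n})^{1/n}$ (this limit exists and equals $\sup_n Q(\Phi^{\boxtimes n})^{1/n}$). For even $k$, $\Phi_{(k/2,k/2)}\subseteq[2]^k$ (with $V_1=\cdots=V_k=\{1,2\}$) is the set of $s\in\{1,2\}^k$ having exactly $k/2$ coordinates equal to $1$ and $k/2$ coordinates equal to $2$. -}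

module Defs where

open import Data.Nat using (ℕ; zero; suc; _+_; _*_; _^_; _≤_)
open import Data.Fin using (Fin; zero; suc)
open import Data.Vec using (Vec; []; _∷_; lookup; map)
open import Data.Product using (Σ; ∃; _×_)
open import Relation.Binary.PropositionalEquality using (_≡_; _≢_)
open import Level using (0ℓ)

-- A k-graph whose k vertex sets are all the finite type V:
-- an edge is a k-tuple (a₁,…,a_k) ∈ V^k, represented as Vec V k;
-- the k-graph Φ ⊆ V^k is a predicate on such tuples.
KGraph : ℕ → Set → Set₁
KGraph k V = Vec V k → Set

-- A finite subset Ψ ⊆ Φ of size s, given as an injective enumeration
-- Ψ : Fin s → V^k (so s = |Ψ|), which is an induced matching of Φ.
record IsInducedMatching {k : ℕ} {V : Set} (Φ : KGraph k V) (s : ℕ)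
                         (Ψ : Fin s → Vec V k) : Set where
  field
    subset    : ∀ p → Φ (Ψ p)
    distinct  : ∀ p q → p ≢ q → Ψ p ≢ Ψ q
    matching  : ∀ p q → p ≢ q → ∀ i → lookup (Ψ p) i ≢ lookup (Ψ q) i
    induced   : ∀ a → Φ a → (∀ i → Σ (Fin s) λ p → lookup (Ψ p) i ≡ lookup a i)
                → Σ (Fin s) λ p → Ψ p ≡ a

SubrankAtLeast : ∀ {k V} → KGraph k V → ℕ → Set
SubrankAtLeast Φ s = Σ (Fin s → Vec _ _) λ Ψ → IsInducedMatching Φ s Ψ

SubrankAtMost : ∀ {k V} → KGraph k V → ℕ → Set
SubrankAtMost {k} {V} Φ s =
  ∀ (t : ℕ) (Ψ : Fin t → Vec V k) → IsInducedMatching Φ t Ψ → t ≤ s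

-- n-fold Kronecker power Φ^{⊠n}, with the vertex set V_i^n of part i
-- identified with Vec V n: a = (a₁,…,a_k) ∈ Φ^{⊠n} iff for every
-- coordinate j ∈ [n], (a₁[j],…,a_k[j]) ∈ Φ.
KronPow : ∀ {k V} → KGraph k V → (n : ℕ) → KGraph k (Vec V n)
KronPow Φ n a = ∀ (j : Fin n) → Φ (map (λ v → lookup v j) a)

-- number of coordinates equal to the first element "1" (encoded as zero : Fin 2)
countOnes : ∀ {k} → Vec (Fin 2) k → ℕ
countOnes []             = 0
countOnes (zero  ∷ s)    = suc (countOnes s)
countOnes (suc _ ∷ s)    = countOnes s

-- Φ_{(h,h)} ⊆ [2]^{2h}: tuples with exactly h ones (hence exactly h twos).
-- Here k = h + h; the element 1 of [2] is zero : Fin 2, 2 is suc zero.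
PhiBal : (h : ℕ) → KGraph (h + h) (Fin 2)
PhiBal h s = countOnes s ≡ h

{-# OPTIONS --safe #-}
module Submission where

-- Upper bound: the first rows of an induced matching are distinct, so its size is at most 2^n.
--
-- Lower bound, for every h ≥ 2 (Coppersmith–Winograd hashing).  Let k = 2h.  Let E be the set of k × n arrays in
-- which every balanced column occurs equally often; it has C^n elements up to a polynomial factor, C = |Φ|.  Hash the
-- rows by r random linear maps to ℤ/N, N odd.  Two arrays that share a row i and have equal hashes differ by an array
-- whose columns lie in a subgroup W of {w ∈ (ℤ/N)^k : w_i = 0}; this has probability |W|^(-r), while the number of
-- arrays that differ from a given member of E by columns in W is δ(W)^(n/C), where δ(W) = ∏_x |Φ ∩ (x + W)|.
--
-- The point is that |W|^r ≥ δ(W)^(n/C) for all such W as soon as this holds for W = {w_i = 0, ∑ w = 0}.  Indeed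
-- log δ(W) is C times the entropy of a uniform x ∈ Φ conditioned on x mod W, so it is supermodular in W, while
-- log |W| is modular.  Hence the subgroups minimising |W|^r / δ(W)^(n/C) are closed under sums, and the largest
-- minimiser is invariant under the permutations of the rows other than i.  An invariant W either contains no nonzero
-- difference of letters, so that δ(W) = 1, or contains all e_a - e_b with a, b ≠ i.
--
-- So N^(r(k-2)) may be taken close to (C/2)^n, and then half of E is isolated: no other array shares both a row and all
-- hashes.  Fixing the differences of the row hashes by pigeonhole leaves about 2^n isolated arrays, and restricting
-- the remaining hash to a translate of a Behrend sphere makes them an induced matching: the row hashes of any array
-- have constant sum, which forces the hashes of arrays glued from rows of the matching to coincide.

open import Defs
open import Algebra.Bundles using (AbelianGroup)
import Algebra.Properties.AbelianGroup as AbelianGroupProperties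
import Algebra.Properties.CommutativeSemigroup as CommutativeSemigroupProperties
open import Algebra.Structures using (IsAbelianGroup)
open import Data.Bool using (Bool; true; false; T; _∧_; _∨_)
open import Data.Bool.Properties using (T?; T-∧)
open import Data.Fin using (Fin; zero; suc; toℕ; inject≤)
open import Data.Fin.Permutation.Components using (transpose)
import Data.Fin.Properties as Fin
open import Data.List using (List; []; _∷_; _++_; map; length; concatMap)
open import Data.List.Membership.Propositional using (_∈_; find; lose)
open import Data.List.Membership.Propositional.Properties using (∈-concatMap⁺)
open import Data.List.Properties using (length-map)
open import Data.List.Relation.Unary.Any using (here; there; any?)
open import Data.Nat using (ℕ; zero; suc; _+_; _*_; _∸_; _^_; _≤_; _<_; z≤n; s≤s; _!; NonZero; >-nonZero)
open import Data.Nat.DivMod using (_mod_; _%_; _/_; m%n<n; m<n⇒m%n≡m; %-distribˡ-+; n%n≡0; [m+kn]%n≡m%n; m≡m%n+[m/n]*n; m*n/n≡m; m/n*n≤m; /-monoˡ-≤)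
open import Data.Nat.Divisibility using (_∣_; ∣-trans; m∣m*n; m≤n⇒m!∣n!)
open import Data.Nat.Properties renaming (_≟_ to _≟ℕ_)
open import Data.Nat.Tactic.RingSolver using (solve-∀)
open import Data.Product using (Σ; ∃; _×_; _,_; proj₁; proj₂)
open import Data.Sum using (_⊎_; inj₁; inj₂; reduce)
open import Data.Unit using (⊤; tt)
open import Data.Vec using (Vec; []; _∷_; lookup; tabulate)
import Data.Vec as Vec
import Data.Vec.Properties as Vec
open import Function using (_∘_; id; case_of_)
open import Function.Bundles using (Equivalence)
open import Level using (0ℓ)
open import Relation.Binary.PropositionalEquality using (_≡_; _≢_; refl; sym; trans; cong; cong₂; subst; isEquivalence; module ≡-Reasoning)
open import Relation.Nullary using (¬_; Dec; yes; no; contradiction)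
open import Relation.Nullary.Decidable using (_×-dec_; _→-dec_; map′; ¬?; does; ⌊_⌋; toWitness; fromWitness; dec-true; dec-false)

-- The modulus N stays fixed while the number r of hash maps grows linearly in n. With N and k
-- fixed, the subgroups W of (ℤ/N)^k are bounded in number, so the union bound over all W costs a
-- constant, which a constant number of additional maps repays. The price is paid in Behrend's step:
-- the sphere lies in (ℤ/N)^r, and its digits must stay below q = N/(k+1) so that k-1 of them add up
-- without wrapping around; this loses a factor (k+1)^r. As r is O(n / log N), taking N to be a high
-- power of k+1 turns the loss into an exponential in n with base as close to 1 as desired. The
-- number k+1 is odd, hence so is N, and division by 2 in ℤ/N is what isolates a single e_a - e_b
-- from a letter difference. Since N is a proper power, the hash differences fill subgroups rather
-- than subspaces. The argument is carried out in ℕ: entropies appear as products of class sizes,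
-- ratios are compared by cross-multiplication, and each inequality between logarithms becomes one
-- between powers.

private variable
  A B K : Set
  P Q R : Set

-- Finite sums and products

∑ ∏ : List A → (A → ℕ) → ℕ
∑ [] f = 0
∑ (x ∷ xs) f = f x + ∑ xs f
∏ [] f = 1
∏ (x ∷ xs) f = f x * ∏ xs f

𝟙 : Dec P → ℕ
𝟙 (yes _) = 1
𝟙 (no _) = 0

𝟙-yes : (d : Dec P) → P → 𝟙 d ≡ 1
𝟙-yes (yes _) p = refl
𝟙-yes (no ¬p) p = contradiction p ¬p

𝟙-no : (d : Dec P) → ¬ P → 𝟙 d ≡ 0
𝟙-no (yes p) ¬p = contradiction p ¬p
𝟙-no (no _) _ = refl

𝟙≤1 : (d : Dec P) → 𝟙 d ≤ 1
𝟙≤1 (yes _) = ≤-refl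
𝟙≤1 (no _) = z≤n

𝟙-mono : (d : Dec P) (e : Dec Q) → (P → Q) → 𝟙 d ≤ 𝟙 e
𝟙-mono (yes p) e f = ≤-reflexive (sym (𝟙-yes e (f p)))
𝟙-mono (no _) e f = z≤n

𝟙-cong : (d : Dec P) (e : Dec Q) → (P → Q) → (Q → P) → 𝟙 d ≡ 𝟙 e
𝟙-cong d e f g = ≤-antisym (𝟙-mono d e f) (𝟙-mono e d g)

𝟙-× : (d : Dec P) (e : Dec Q) (f : Dec R) → (R → P × Q) → (P → Q → R) → 𝟙 f ≡ 𝟙 d * 𝟙 e
𝟙-× (yes p) (yes q) f to from = 𝟙-yes f (from p q)
𝟙-× (yes p) (no ¬q) f to from = 𝟙-no f (¬q ∘ proj₂ ∘ to)
𝟙-× (no ¬p) e f to from = 𝟙-no f (¬p ∘ proj₁ ∘ to)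

∑-mono∈ : (xs : List A) {f g : A → ℕ} → (∀ x → x ∈ xs → f x ≤ g x) → ∑ xs f ≤ ∑ xs g
∑-mono∈ [] h = z≤n
∑-mono∈ (x ∷ xs) h = +-mono-≤ (h x (here refl)) (∑-mono∈ xs (λ y → h y ∘ there))

∑-mono : (xs : List A) {f g : A → ℕ} → (∀ x → f x ≤ g x) → ∑ xs f ≤ ∑ xs g
∑-mono xs h = ∑-mono∈ xs (λ x _ → h x)

∑-cong : (xs : List A) {f g : A → ℕ} → (∀ x → f x ≡ g x) → ∑ xs f ≡ ∑ xs g
∑-cong [] h = refl
∑-cong (x ∷ xs) h = cong₂ _+_ (h x) (∑-cong xs h)

∑-zero : (xs : List A) {f : A → ℕ} → (∀ x → f x ≡ 0) → ∑ xs f ≡ 0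
∑-zero [] h = refl
∑-zero (x ∷ xs) h = cong₂ _+_ (h x) (∑-zero xs h)

∑-+ : (xs : List A) (f g : A → ℕ) → ∑ xs (λ x → f x + g x) ≡ ∑ xs f + ∑ xs g
∑-+ [] f g = refl
∑-+ (x ∷ xs) f g rewrite ∑-+ xs f g = lemma (f x) (g x) (∑ xs f) (∑ xs g)
  where
  lemma : ∀ a b c d → a + b + (c + d) ≡ a + c + (b + d)
  lemma = solve-∀

∑-*ˡ : (xs : List A) (c : ℕ) (f : A → ℕ) → ∑ xs (λ x → c * f x) ≡ c * ∑ xs f
∑-*ˡ [] c f = sym (*-zeroʳ c)
∑-*ˡ (x ∷ xs) c f rewrite ∑-*ˡ xs c f = sym (*-distribˡ-+ c (f x) (∑ xs f))

∑-*ʳ : (xs : List A) (c : ℕ) (f : A → ℕ) → ∑ xs (λ x → f x * c) ≡ ∑ xs f * c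
∑-*ʳ xs c f = begin
  ∑ xs (λ x → f x * c) ≡⟨ ∑-cong xs (λ x → *-comm (f x) c) ⟩
  ∑ xs (λ x → c * f x) ≡⟨ ∑-*ˡ xs c f ⟩
  c * ∑ xs f ≡⟨ *-comm c _ ⟩
  ∑ xs f * c ∎
  where open ≡-Reasoning

∑-const : (xs : List A) (c : ℕ) → ∑ xs (λ _ → c) ≡ length xs * c
∑-const [] c = refl
∑-const (x ∷ xs) c = cong (c +_) (∑-const xs c)

∑-swap : (xs : List A) (ys : List B) (f : A → B → ℕ) →
  ∑ xs (λ x → ∑ ys (f x)) ≡ ∑ ys (λ y → ∑ xs (λ x → f x y))
∑-swap [] ys f = sym (∑-zero ys (λ _ → refl))
∑-swap (x ∷ xs) ys f rewrite ∑-swap xs ys f = sym (∑-+ ys (f x) (λ y → ∑ xs (λ x → f x y)))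

∑-++ : (xs ys : List A) (f : A → ℕ) → ∑ (xs ++ ys) f ≡ ∑ xs f + ∑ ys f
∑-++ [] ys f = refl
∑-++ (x ∷ xs) ys f rewrite ∑-++ xs ys f = sym (+-assoc (f x) (∑ xs f) (∑ ys f))

∑-map : (g : A → B) (xs : List A) (f : B → ℕ) → ∑ (map g xs) f ≡ ∑ xs (f ∘ g)
∑-map g [] f = refl
∑-map g (x ∷ xs) f = cong (f (g x) +_) (∑-map g xs f)

∑-concatMap : (g : A → List B) (xs : List A) (f : B → ℕ) →
  ∑ (concatMap g xs) f ≡ ∑ xs (λ x → ∑ (g x) f)
∑-concatMap g [] f = refl
∑-concatMap g (x ∷ xs) f = trans (∑-++ (g x) (concatMap g xs) f) (cong (∑ (g x) f +_) (∑-concatMap g xs f))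

∑-term : (xs : List A) (f : A → ℕ) {x : A} → x ∈ xs → f x ≤ ∑ xs f
∑-term (x ∷ xs) f (here refl) = m≤m+n (f x) _
∑-term (y ∷ xs) f (there i) = ≤-trans (∑-term xs f i) (m≤n+m _ (f y))

-- Slack in one term would show in the totals. This turns an equality of sizes into an equality of
-- sets, and a vanishing sum of squares into equal terms.
∑-tight : (xs : List A) {f g : A → ℕ} → (∀ x → f x ≤ g x) → ∑ xs g ≤ ∑ xs f → ∀ {x} → x ∈ xs → g x ≤ f x
∑-tight (x ∷ xs) {f} {g} f≤g le (here refl) =
  +-cancelʳ-≤ (∑ xs f) (g x) (f x) (≤-trans (+-monoʳ-≤ (g x) (∑-mono xs f≤g)) le)
∑-tight (y ∷ xs) {f} {g} f≤g le (there i) =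
  ∑-tight xs f≤g (+-cancelˡ-≤ (f y) _ _ (≤-trans (+-monoˡ-≤ (∑ xs g) (f≤g y)) le)) i

∏-cong : (xs : List A) {f g : A → ℕ} → (∀ x → f x ≡ g x) → ∏ xs f ≡ ∏ xs g
∏-cong [] h = refl
∏-cong (x ∷ xs) h = cong₂ _*_ (h x) (∏-cong xs h)

∏-mono : (xs : List A) {f g : A → ℕ} → (∀ x → f x ≤ g x) → ∏ xs f ≤ ∏ xs g
∏-mono [] h = ≤-refl
∏-mono (x ∷ xs) h = *-mono-≤ (h x) (∏-mono xs h)

∏-* : (xs : List A) (f g : A → ℕ) → ∏ xs (λ x → f x * g x) ≡ ∏ xs f * ∏ xs g
∏-* [] f g = refl
∏-* (x ∷ xs) f g rewrite ∏-* xs f g = lemma (f x) (g x) (∏ xs f) (∏ xs g)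
  where
  lemma : ∀ a b c d → a * b * (c * d) ≡ a * c * (b * d)
  lemma = solve-∀

∏-const : (xs : List A) (c : ℕ) → ∏ xs (λ _ → c) ≡ c ^ length xs
∏-const [] c = refl
∏-const (x ∷ xs) c = cong (c *_) (∏-const xs c)

∏-pos : (xs : List A) (f : A → ℕ) → (∀ x → 1 ≤ f x) → 1 ≤ ∏ xs f
∏-pos [] f h = ≤-refl
∏-pos (x ∷ xs) f h = *-mono-≤ (h x) (∏-pos xs f h)

∏-^ : (xs : List A) (f : A → ℕ) (m : ℕ) → ∏ xs (λ x → f x ^ m) ≡ ∏ xs f ^ m
∏-^ xs f zero = trans (∏-const xs 1) (^-zeroˡ (length xs))
∏-^ xs f (suc m) = trans (∏-* xs f (λ x → f x ^ m)) (cong (∏ xs f *_) (∏-^ xs f m))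

∏-swap : (xs : List A) (ys : List B) (f : A → B → ℕ) →
  ∏ xs (λ x → ∏ ys (f x)) ≡ ∏ ys (λ y → ∏ xs (λ x → f x y))
∏-swap [] ys f = sym (trans (∏-const ys 1) (^-zeroˡ (length ys)))
∏-swap (x ∷ xs) ys f rewrite ∏-swap xs ys f = sym (∏-* ys (f x) (λ y → ∏ xs (λ x → f x y)))

∏-^∑ : (xs : List A) (c : ℕ) (e : A → ℕ) → ∏ xs (λ x → c ^ e x) ≡ c ^ ∑ xs e
∏-^∑ [] c e = refl
∏-^∑ (x ∷ xs) c e rewrite ∏-^∑ xs c e = sym (^-distribˡ-+-* c (e x) (∑ xs e))

minimum : (_≼_ : A → A → Set) → (∀ x y → x ≼ y ⊎ y ≼ x) → (∀ {x y z} → x ≼ y → y ≼ z → x ≼ z) →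
  (x₀ : A) (xs : List A) → ∃ λ x → (x ∈ x₀ ∷ xs) × (∀ y → y ∈ x₀ ∷ xs → x ≼ y)
minimum _≼_ total tr = go
  where
  reflexive : ∀ x → x ≼ x
  reflexive x = reduce (total x x)
  go : ∀ x₀ xs → ∃ λ x → (x ∈ x₀ ∷ xs) × (∀ y → y ∈ x₀ ∷ xs → x ≼ y)
  go x₀ [] = x₀ , here refl , λ { y (here refl) → reflexive y }
  go x₀ (x₁ ∷ xs) with go x₁ xs
  ... | x , x∈ , x-min with total x₀ x
  ... | inj₁ p = x₀ , here refl , λ { y (here refl) → reflexive y ; y (there i) → tr p (x-min y i) }
  ... | inj₂ p = x , there x∈ , λ { y (here refl) → p ; y (there i) → x-min y i }

-- The default `x₀` takes the place of a nonemptiness hypothesis: for an empty list both sides are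
-- 0.
average-≥ : (x₀ : A) (xs : List A) (f : A → ℕ) → ∃ λ x → ∑ xs f ≤ length xs * f x
average-≥ x₀ xs f with minimum (λ x y → f y ≤ f x) (λ x y → ≤-total (f y) (f x)) (λ p q → ≤-trans q p) x₀ xs
... | x , _ , max = x , ≤-trans (∑-mono∈ xs (λ y i → max y (there i))) (≤-reflexive (∑-const xs (f x)))

average-≤ : (x₀ : A) (xs : List A) (f : A → ℕ) → ∃ λ x → length xs * f x ≤ ∑ xs f
average-≤ x₀ xs f with minimum (λ x y → f x ≤ f y) (λ x y → ≤-total (f x) (f y)) ≤-trans x₀ xs
... | x , _ , min = x , ≤-trans (≤-reflexive (sym (∑-const xs (f x)))) (∑-mono∈ xs (λ y i → min y (there i)))

-- Finite types

-- Finiteness is a counting statement instead of a bijection with some `Fin n`: `once` is the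
-- Kronecker delta identity, so that cardinality arguments become interchanges of sums.
record Finite (A : Set) : Set where
  field
    elems : List A
    _≟_ : (x y : A) → Dec (x ≡ y)
    once  : ∀ z → ∑ elems (λ y → 𝟙 (y ≟ z)) ≡ 1

  card : ℕ
  card = length elems

  complete : ∀ z → z ∈ elems
  complete z = go elems (≤-reflexive (sym (once z)))
    where
    go : ∀ xs → 1 ≤ ∑ xs (λ y → 𝟙 (y ≟ z)) → z ∈ xs
    go (x ∷ xs) le with x ≟ z
    ... | yes refl = here refl
    ... | no _ = there (go xs le)

  pick : ∀ z (f : A → ℕ) → ∑ elems (λ y → 𝟙 (y ≟ z) * f y) ≡ f z
  pick z f = begin
    ∑ elems (λ y → 𝟙 (y ≟ z) * f y) ≡⟨ ∑-cong elems step ⟩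
    ∑ elems (λ y → 𝟙 (y ≟ z) * f z) ≡⟨ ∑-*ʳ elems (f z) _ ⟩
    ∑ elems (λ y → 𝟙 (y ≟ z)) * f z ≡⟨ cong (_* f z) (once z) ⟩
    1 * f z ≡⟨ *-identityˡ (f z) ⟩
    f z ∎
    where
    open ≡-Reasoning
    step : ∀ y → 𝟙 (y ≟ z) * f y ≡ 𝟙 (y ≟ z) * f z
    step y with y ≟ z
    ... | yes refl = refl
    ... | no _ = refl

  ∏-pick : ∀ z (f : A → ℕ) → ∏ elems (λ y → f y ^ 𝟙 (y ≟ z)) ≡ f z
  ∏-pick z f = begin
    ∏ elems (λ y → f y ^ 𝟙 (y ≟ z)) ≡⟨ ∏-cong elems step ⟩
    ∏ elems (λ y → f z ^ 𝟙 (y ≟ z)) ≡⟨ ∏-^∑ elems (f z) _ ⟩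
    f z ^ ∑ elems (λ y → 𝟙 (y ≟ z)) ≡⟨ cong (f z ^_) (once z) ⟩
    f z ^ 1 ≡⟨ ^-identityʳ (f z) ⟩
    f z ∎
    where
    open ≡-Reasoning
    step : ∀ y → f y ^ 𝟙 (y ≟ z) ≡ f z ^ 𝟙 (y ≟ z)
    step y with y ≟ z
    ... | yes refl = refl
    ... | no _ = refl

  search : {P : A → Set} → (∀ x → Dec (P x)) → Dec (∃ P)
  search P? = map′ (λ a → let x , _ , p = find a in x , p) (λ (x , p) → lose (complete x) p) (any? P? elems)

  forAll : {P : A → Set} → (∀ x → Dec (P x)) → Dec (∀ x → P x)
  forAll {P} P? with search (λ x → ¬? (P? x))
  ... | yes (x , ¬p) = no (λ f → ¬p (f x))
  ... | no ¬ex = yes λ x → stable x (P? x)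
    where
    stable : ∀ x → Dec (P x) → P x
    stable x (yes p) = p
    stable x (no ¬p) = contradiction (x , ¬p) ¬ex

  atMostOnce : {P : A → Set} (P? : ∀ x → Dec (P x)) {Q : Set} (q : Dec Q) →
    (∀ x y → P x → P y → x ≡ y) → (∀ x → P x → Q) → ∑ elems (λ x → 𝟙 (P? x)) ≤ 𝟙 q
  atMostOnce P? q unique P⇒Q with search P?
  ... | yes (x , p) = begin
    ∑ elems (λ y → 𝟙 (P? y)) ≤⟨ ∑-mono elems (λ y → 𝟙-mono (P? y) (y ≟ x) (λ p′ → unique y x p′ p)) ⟩
    ∑ elems (λ y → 𝟙 (y ≟ x)) ≡⟨ once x ⟩
    1 ≡⟨ 𝟙-yes q (P⇒Q x p) ⟨
    𝟙 q ∎
    where open ≤-Reasoning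
  ... | no ¬ex = ≤-trans (≤-reflexive (∑-zero elems (λ x → 𝟙-no (P? x) (λ p → ¬ex (x , p))))) z≤n

open Finite using (elems; card; once; pick; ∏-pick; search; forAll; atMostOnce; complete)

∑ᶠ ∏ᶠ : Finite A → (A → ℕ) → ℕ
∑ᶠ F = ∑ (elems F)
∏ᶠ F = ∏ (elems F)

# : (F : Finite A) {P : A → Set} → (∀ x → Dec (P x)) → ℕ
# F P? = ∑ᶠ F (λ x → 𝟙 (P? x))

#-injection : (FA : Finite A) (FB : Finite B) {P : A → Set} {Q : B → Set}
  (P? : ∀ x → Dec (P x)) (Q? : ∀ x → Dec (Q x)) (f : A → B) → (∀ a → P a → Q (f a)) →
  (∀ a a′ → P a → P a′ → f a ≡ f a′ → a ≡ a′) → # FA P? ≤ # FB Q?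
#-injection FA FB P? Q? f P⇒Q inj = begin
  ∑ᶠ FA (λ a → 𝟙 (P? a))
    ≡⟨ ∑-cong (elems FA) (λ a → sym (pick FB (f a) (λ _ → 𝟙 (P? a)))) ⟩
  ∑ᶠ FA (λ a → ∑ᶠ FB (λ b → 𝟙 (b ≟ f a) * 𝟙 (P? a)))
    ≡⟨ ∑-swap (elems FA) (elems FB) _ ⟩
  ∑ᶠ FB (λ b → ∑ᶠ FA (λ a → 𝟙 (b ≟ f a) * 𝟙 (P? a)))
    ≡⟨ ∑-cong (elems FB) (λ b → ∑-cong (elems FA) (λ a → sym (𝟙-× (b ≟ f a) (P? a) ((b ≟ f a) ×-dec P? a) id _,_))) ⟩
  ∑ᶠ FB (λ b → # FA (λ a → (b ≟ f a) ×-dec P? a))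
    ≤⟨ ∑-mono (elems FB) (λ b → atMostOnce FA (λ a → (b ≟ f a) ×-dec P? a) (Q? b)
         (λ { x y (refl , p) (e , p′) → inj x y p p′ e }) (λ { x (refl , p) → P⇒Q x p })) ⟩
  ∑ᶠ FB (λ b → 𝟙 (Q? b)) ∎
  where
  open ≤-Reasoning
  open Finite FB using (_≟_)

∑-fibres : (FK : Finite K) (xs : List A) (key : A → K) (f : A → ℕ) →
  ∑ xs f ≡ ∑ᶠ FK (λ κ → ∑ xs (λ x → 𝟙 (Finite._≟_ FK κ (key x)) * f x))
∑-fibres FK xs key f = trans (∑-cong xs (λ x → sym (pick FK (key x) (λ _ → f x)))) (∑-swap xs (elems FK) _)

-- The symmetries in play are all involutions: transpositions of rows and complementation of
-- letters.
module _ (F : Finite A) (σ : A → A) (invol : ∀ x → σ (σ x) ≡ x) where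
  open Finite F using (_≟_)

  private
    #-preimage : ∀ y → # F (λ x → y ≟ σ x) ≡ 1
    #-preimage y = trans (∑-cong (elems F) (λ x →
      𝟙-cong (y ≟ σ x) (x ≟ σ y) (λ { refl → sym (invol x) }) (λ { refl → sym (invol y) }))) (once F (σ y))

  ∏-involution : (f : A → ℕ) → ∏ᶠ F (f ∘ σ) ≡ ∏ᶠ F f
  ∏-involution f = begin
    ∏ᶠ F (f ∘ σ)
      ≡⟨ ∏-cong (elems F) (λ x → sym (∏-pick F (σ x) f)) ⟩
    ∏ᶠ F (λ x → ∏ᶠ F (λ y → f y ^ 𝟙 (y ≟ σ x)))
      ≡⟨ ∏-swap (elems F) (elems F) _ ⟩
    ∏ᶠ F (λ y → ∏ᶠ F (λ x → f y ^ 𝟙 (y ≟ σ x)))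
      ≡⟨ ∏-cong (elems F) (λ y → trans (∏-^∑ (elems F) (f y) _)
           (trans (cong (f y ^_) (#-preimage y)) (^-identityʳ (f y)))) ⟩
    ∏ᶠ F f ∎
    where open ≡-Reasoning

  ∑-involution : (f : A → ℕ) → ∑ᶠ F (f ∘ σ) ≡ ∑ᶠ F f
  ∑-involution f = begin
    ∑ᶠ F (f ∘ σ)
      ≡⟨ ∑-cong (elems F) (λ x → sym (pick F (σ x) f)) ⟩
    ∑ᶠ F (λ x → ∑ᶠ F (λ y → 𝟙 (y ≟ σ x) * f y))
      ≡⟨ ∑-swap (elems F) (elems F) _ ⟩
    ∑ᶠ F (λ y → ∑ᶠ F (λ x → 𝟙 (y ≟ σ x) * f y))
      ≡⟨ ∑-cong (elems F) (λ y → ∑-*ʳ (elems F) (f y) _) ⟩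
    ∑ᶠ F (λ y → # F (λ x → y ≟ σ x) * f y)
      ≡⟨ ∑-cong (elems F) (λ y → trans (cong (_* f y) (#-preimage y)) (*-identityˡ (f y))) ⟩
    ∑ᶠ F f ∎
    where open ≡-Reasoning

finElems : ∀ n → List (Fin n)
finElems zero = []
finElems (suc n) = zero ∷ map suc (finElems n)

fins : ∀ n → Finite (Fin n)
fins n = record { elems = finElems n ; _≟_ = Fin._≟_ ; once = one n }
  where
  one : ∀ n (z : Fin n) → ∑ (finElems n) (λ y → 𝟙 (y Fin.≟ z)) ≡ 1
  one (suc n) zero = cong suc (trans (∑-map suc (finElems n) _) (∑-zero (finElems n) (λ _ → refl)))
  one (suc n) (suc z) = trans (∑-map suc (finElems n) _)
    (trans (∑-cong (finElems n) (λ y → 𝟙-cong (suc y Fin.≟ suc z) (y Fin.≟ z) Fin.suc-injective (cong suc))) (one n z))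

card-fin : ∀ n → card (fins n) ≡ n
card-fin zero = refl
card-fin (suc n) = cong suc (trans (length-map suc (finElems n)) (card-fin n))

∑-suc : ∀ n (f : Fin (suc n) → ℕ) → ∑ᶠ (fins (suc n)) f ≡ f zero + ∑ᶠ (fins n) (f ∘ suc)
∑-suc n f = cong (f zero +_) (∑-map suc (elems (fins n)) f)

pairs : Finite A → Finite B → Finite (A × B)
pairs FA FB = record
  { elems = concatMap (λ a → map (a ,_) (elems FB)) (elems FA)
  ; _≟_ = λ { (a , b) (c , d) → map′ (λ { (refl , refl) → refl }) (λ { refl → refl , refl }) ((a A.≟ c) ×-dec (b B.≟ d)) }
  ; once = λ { (a , b) → begin
      ∑ (concatMap (λ a → map (a ,_) (elems FB)) (elems FA)) _
        ≡⟨ ∑-concatMap _ (elems FA) _ ⟩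
      ∑ᶠ FA (λ x → ∑ (map (x ,_) (elems FB)) _)
        ≡⟨ ∑-cong (elems FA) (λ x → trans (∑-map (x ,_) (elems FB) _)
             (trans (∑-cong (elems FB) (λ y → 𝟙-× (x A.≟ a) (y B.≟ b) _ (λ { refl → refl , refl }) (λ { refl refl → refl })))
                    (∑-*ˡ (elems FB) (𝟙 (x A.≟ a)) _))) ⟩
      ∑ᶠ FA (λ x → 𝟙 (x A.≟ a) * ∑ᶠ FB (λ y → 𝟙 (y B.≟ b)))
        ≡⟨ pick FA a _ ⟩
      ∑ᶠ FB (λ y → 𝟙 (y B.≟ b)) ≡⟨ once FB b ⟩
      1 ∎ } }
  where
  open ≡-Reasoning
  module A = Finite FA
  module B = Finite FB

∑-pair : (FA : Finite A) (FB : Finite B) (f : A × B → ℕ) →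
  ∑ᶠ (pairs FA FB) f ≡ ∑ᶠ FA (λ a → ∑ᶠ FB (λ b → f (a , b)))
∑-pair FA FB f = trans (∑-concatMap _ (elems FA) f) (∑-cong (elems FA) (λ a → ∑-map (a ,_) (elems FB) f))

vecElems : List A → ∀ n → List (Vec A n)
vecElems as zero = [] ∷ []
vecElems as (suc n) = concatMap (λ a → map (a ∷_) (vecElems as n)) as

∑-vecElems : (as : List A) → ∀ n (f : Vec A (suc n) → ℕ) →
  ∑ (vecElems as (suc n)) f ≡ ∑ as (λ a → ∑ (vecElems as n) (λ v → f (a ∷ v)))
∑-vecElems as n f = trans (∑-concatMap _ as f) (∑-cong as (λ a → ∑-map (a ∷_) (vecElems as n) f))

vecs : Finite A → ∀ n → Finite (Vec A n)
vecs FA n = record { elems = vecElems (elems FA) n ; _≟_ = dec ; once = one n }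
  where
  open Finite FA using (_≟_)
  dec : ∀ {n} (u v : Vec _ n) → Dec (u ≡ v)
  dec = Vec.≡-dec _≟_
  one : ∀ n z → ∑ (vecElems (elems FA) n) (λ y → 𝟙 (dec y z)) ≡ 1
  one zero [] = refl
  one (suc n) (z ∷ zs) = trans (∑-vecElems (elems FA) n _)
    (trans (∑-cong (elems FA) (λ a → trans (∑-cong (vecElems (elems FA) n) (λ v →
               𝟙-× (a ≟ z) (dec v zs) (dec (a ∷ v) (z ∷ zs)) (λ { refl → refl , refl }) (λ { refl refl → refl })))
             (∑-*ˡ (vecElems (elems FA) n) (𝟙 (a ≟ z)) _)))
    (trans (pick FA z _) (one n zs)))

∑-vec : (FA : Finite A) → ∀ n (f : Vec A (suc n) → ℕ) →
  ∑ᶠ (vecs FA (suc n)) f ≡ ∑ᶠ FA (λ a → ∑ᶠ (vecs FA n) (λ v → f (a ∷ v)))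
∑-vec FA = ∑-vecElems (elems FA)

card-∑ : (F : Finite A) → card F ≡ ∑ᶠ F (λ _ → 1)
card-∑ F = trans (sym (*-identityʳ _)) (sym (∑-const (elems F) 1))

card-vec : (FA : Finite A) → ∀ n → card (vecs FA n) ≡ card FA ^ n
card-vec FA zero = refl
card-vec FA (suc n) = begin
  card (vecs FA (suc n)) ≡⟨ card-∑ (vecs FA (suc n)) ⟩
  ∑ᶠ (vecs FA (suc n)) (λ _ → 1) ≡⟨ ∑-vec FA n _ ⟩
  ∑ᶠ FA (λ _ → ∑ᶠ (vecs FA n) (λ _ → 1)) ≡⟨ ∑-const (elems FA) _ ⟩
  card FA * ∑ᶠ (vecs FA n) (λ _ → 1) ≡⟨ cong (card FA *_) (sym (card-∑ (vecs FA n))) ⟩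
  card FA * card (vecs FA n) ≡⟨ cong (card FA *_) (card-vec FA n) ⟩
  card FA ^ suc n ∎
  where open ≡-Reasoning

-- The arithmetic–geometric mean inequality

*-cancelˡ-≤⁺ : ∀ c {a b} → 1 ≤ c → c * a ≤ c * b → a ≤ b
*-cancelˡ-≤⁺ (suc c) _ = *-cancelˡ-≤ (suc c)

*-cancelʳ-≤⁺ : ∀ c {a b} → 1 ≤ c → a * c ≤ b * c → a ≤ b
*-cancelʳ-≤⁺ (suc c) _ = *-cancelʳ-≤ _ _ (suc c)

^-distribʳ-* : ∀ m a b → (a * b) ^ m ≡ a ^ m * b ^ m
^-distribʳ-* zero a b = refl
^-distribʳ-* (suc m) a b rewrite ^-distribʳ-* m a b = lemma a b (a ^ m) (b ^ m)
  where
  lemma : ∀ a b c d → a * b * (c * d) ≡ a * c * (b * d)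
  lemma = solve-∀

1≤^ : ∀ {a} n → 1 ≤ a → 1 ≤ a ^ n
1≤^ {suc a} n _ = m^n>0 (suc a) n

rearrangement : ∀ {a b x y} → a ≤ b → x ≤ y → x * b + a * y ≤ a * x + b * y
rearrangement {a} {b} {x} {y} a≤b x≤y with m≤n⇒∃[o]m+o≡n a≤b
... | d , refl = begin
  x * (a + d) + a * y ≡⟨ e₁ a d x y ⟩
  a * x + a * y + d * x ≤⟨ +-monoʳ-≤ (a * x + a * y) (*-monoʳ-≤ d x≤y) ⟩
  a * x + a * y + d * y ≡⟨ e₂ a d x y ⟩
  a * x + (a + d) * y ∎
  where
  open ≤-Reasoning
  e₁ : ∀ a d x y → x * (a + d) + a * y ≡ a * x + a * y + d * x
  e₁ = solve-∀
  e₂ : ∀ a d x y → a * x + a * y + d * y ≡ a * x + (a + d) * y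
  e₂ = solve-∀

rearrangement-^ : ∀ a b n → a ^ n * b + a * b ^ n ≤ a * a ^ n + b * b ^ n
rearrangement-^ a b n with ≤-total a b
... | inj₁ a≤b = rearrangement a≤b (^-monoˡ-≤ n a≤b)
... | inj₂ b≤a = begin
  a ^ n * b + a * b ^ n ≡⟨ cong₂ _+_ (*-comm (a ^ n) b) (*-comm a (b ^ n)) ⟩
  b * a ^ n + b ^ n * a ≡⟨ +-comm (b * a ^ n) _ ⟩
  b ^ n * a + b * a ^ n ≤⟨ rearrangement b≤a (^-monoˡ-≤ n b≤a) ⟩
  b * b ^ n + a * a ^ n ≡⟨ +-comm (b * b ^ n) _ ⟩
  a * a ^ n + b * b ^ n ∎
  where open ≤-Reasoning

-- AM-GM for n copies of a^(n+1) and one b^(n+1). The induction multiplies by a and trades the mixed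
-- terms by `rearrangement-^`.
young : ∀ n a b → suc n * (a ^ n * b) ≤ n * a ^ suc n + b ^ suc n
young zero a b = ≤-reflexive (e b)
  where
  e : ∀ b → 1 * (1 * b) ≡ 0 + b * 1
  e = solve-∀
young (suc n) a b = begin
  suc (suc n) * (a ^ suc n * b)
    ≡⟨ e₁ n a b (a ^ n) ⟩
  a * (suc n * (a ^ n * b)) + a ^ suc n * b
    ≤⟨ +-monoˡ-≤ (a ^ suc n * b) (*-monoʳ-≤ a (young n a b)) ⟩
  a * (n * a ^ suc n + b ^ suc n) + a ^ suc n * b
    ≡⟨ e₂ n a b (a ^ suc n) (b ^ suc n) ⟩
  n * (a * a ^ suc n) + (a ^ suc n * b + a * b ^ suc n)
    ≤⟨ +-monoʳ-≤ (n * (a * a ^ suc n)) (rearrangement-^ a b (suc n)) ⟩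
  n * (a * a ^ suc n) + (a * a ^ suc n + b * b ^ suc n)
    ≡⟨ e₃ n (a * a ^ suc n) (b * b ^ suc n) ⟩
  suc n * a ^ suc (suc n) + b ^ suc (suc n) ∎
  where
  open ≤-Reasoning
  e₁ : ∀ n a b x → suc (suc n) * (a * x * b) ≡ a * (suc n * (x * b)) + a * x * b
  e₁ = solve-∀
  e₂ : ∀ n a b x y → a * (n * x + y) + x * b ≡ n * (a * x) + (x * b + a * y)
  e₂ = solve-∀
  e₃ : ∀ n x y → n * x + (x + y) ≡ suc n * x + y
  e₃ = solve-∀

-- Young's inequality compares a with the mean μ; the term n a^(n+1) occurs on both sides and
-- cancels.
mean-step : ∀ n a y μ → n * a + y ≡ suc n * μ → a ^ n * y ≤ μ ^ suc n
mean-step n a y μ eq = +-cancelˡ-≤ (n * a ^ suc n) _ _ (begin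
  n * a ^ suc n + a ^ n * y ≡⟨ e₁ n a (a ^ n) y ⟩
  a ^ n * (n * a + y) ≡⟨ cong (a ^ n *_) eq ⟩
  a ^ n * (suc n * μ) ≡⟨ e₂ (suc n) (a ^ n) μ ⟩
  suc n * (a ^ n * μ) ≤⟨ young n a μ ⟩
  n * a ^ suc n + μ ^ suc n ∎)
  where
  open ≤-Reasoning
  e₁ : ∀ n a x y → n * (a * x) + x * y ≡ x * (n * a + y)
  e₁ = solve-∀
  e₂ : ∀ m x y → x * (m * y) ≡ m * (x * y)
  e₂ = solve-∀

1≤n^n : ∀ n → 1 ≤ n ^ n
1≤n^n zero = ≤-refl
1≤n^n (suc n) = 1≤^ (suc n) (s≤s z≤n)

am-gm : (xs : List A) (f : A → ℕ) → length xs ^ length xs * ∏ xs f ≤ ∑ xs f ^ length xs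
am-gm [] f = ≤-refl
am-gm (x ∷ []) f = ≤-reflexive (e (f x))
  where
  e : ∀ y → 1 * 1 * (y * 1) ≡ (y + 0) * 1
  e = solve-∀
-- With n the length of the tail, all entries are scaled by n(n+1): the tail then has mean (n+1)S
-- and the whole list mean n(y+S), both integers. The tail is nonempty, so the scaling factor can be
-- cancelled.
am-gm (x ∷ xs@(_ ∷ _)) f = *-cancelˡ-≤⁺ (n ^ suc n) (1≤^ {n} (suc n) (s≤s z≤n)) (begin
  n ^ suc n * (suc n ^ suc n * (y * ∏ xs f))
    ≡⟨ e₁ n (n ^ n) (suc n ^ n) y (∏ xs f) (suc n) ⟩
  suc n ^ n * (n ^ n * ∏ xs f) * (n * suc n * y)
    ≤⟨ *-monoˡ-≤ (n * suc n * y) (*-monoʳ-≤ (suc n ^ n) (am-gm xs f)) ⟩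
  suc n ^ n * S ^ n * (n * suc n * y)
    ≡⟨ cong (_* (n * suc n * y)) (sym (^-distribʳ-* n (suc n) S)) ⟩
  (suc n * S) ^ n * (n * suc n * y)
    ≤⟨ mean-step n (suc n * S) (n * suc n * y) (n * (y + S)) (e₂ n (suc n) S y) ⟩
  (n * (y + S)) ^ suc n
    ≡⟨ ^-distribʳ-* (suc n) n (y + S) ⟩
  n ^ suc n * (y + S) ^ suc n ∎)
  where
  open ≤-Reasoning
  n = length xs
  S = ∑ xs f
  y = f x
  e₁ : ∀ n nn sn y p m → n * nn * (m * sn * (y * p)) ≡ sn * (nn * p) * (n * m * y)
  e₁ = solve-∀
  e₂ : ∀ n m S y → n * (m * S) + n * m * y ≡ m * (n * (y + S))
  e₂ = solve-∀

-- The hypotheses say that u / v has average at most 1; Q clears the denominators.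
gibbs : (xs : List A) (u v q : A → ℕ) (Q : ℕ) → 1 ≤ Q → (∀ x → v x * q x ≡ Q) →
  ∑ xs (λ x → u x * q x) ≤ length xs * Q → ∏ xs u ≤ ∏ xs v
gibbs xs u v q Q Q>0 vq≡Q le = *-cancelʳ-≤⁺ (∏ xs q) (∏-pos xs q q>0)
  (*-cancelˡ-≤⁺ (ℓ ^ ℓ) (1≤n^n ℓ) (begin
  ℓ ^ ℓ * (∏ xs u * ∏ xs q) ≡⟨ cong (ℓ ^ ℓ *_) (sym (∏-* xs u q)) ⟩
  ℓ ^ ℓ * ∏ xs (λ x → u x * q x) ≤⟨ am-gm xs _ ⟩
  ∑ xs (λ x → u x * q x) ^ ℓ ≤⟨ ^-monoˡ-≤ ℓ le ⟩
  (ℓ * Q) ^ ℓ ≡⟨ ^-distribʳ-* ℓ ℓ Q ⟩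
  ℓ ^ ℓ * Q ^ ℓ ≡⟨ cong (ℓ ^ ℓ *_) (sym (∏-const xs Q)) ⟩
  ℓ ^ ℓ * ∏ xs (λ _ → Q) ≡⟨ cong (ℓ ^ ℓ *_) (∏-cong xs (λ x → sym (vq≡Q x))) ⟩
  ℓ ^ ℓ * ∏ xs (λ x → v x * q x) ≡⟨ cong (ℓ ^ ℓ *_) (∏-* xs v q) ⟩
  ℓ ^ ℓ * (∏ xs v * ∏ xs q) ∎))
  where
  open ≤-Reasoning
  ℓ = length xs
  q>0 : ∀ x → 1 ≤ q x
  q>0 x = n≢0⇒n>0 (λ q≡0 → <⇒≢ Q>0 (sym (trans (sym (vq≡Q x)) (trans (cong (v x *_) q≡0) (*-zeroʳ (v x))))))

-- Supermodularity of the product of class sizes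

record DecEquivalence (X : Set) : Set₁ where
  infix 4 _~_
  field
    _~_ : X → X → Set
    _~?_ : ∀ x y → Dec (x ~ y)
    ~-refl : ∀ {x} → x ~ x
    ~-sym  : ∀ {x y} → x ~ y → y ~ x
    ~-trans : ∀ {x y z} → x ~ y → y ~ z → x ~ z

open DecEquivalence

_⊓_ : {X : Set} → DecEquivalence X → DecEquivalence X → DecEquivalence X
E ⊓ F = record
  { _~_ = λ x y → _~_ E x y × _~_ F x y
  ; _~?_ = λ x y → _~?_ E x y ×-dec _~?_ F x y
  ; ~-refl = ~-refl E , ~-refl F
  ; ~-sym = λ (p , q) → ~-sym E p , ~-sym F q
  ; ~-trans = λ (p , q) (p′ , q′) → ~-trans E p p′ , ~-trans F q q′ }

module Classes {X : Set} (FX : Finite X) where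

  classSize : DecEquivalence X → X → ℕ
  classSize E x = # FX (_~?_ E x)

  classProduct : DecEquivalence X → ℕ
  classProduct E = ∏ᶠ FX (classSize E)

  classSize>0 : ∀ E x → 1 ≤ classSize E x
  classSize>0 E x = ≤-trans (≤-reflexive (sym (𝟙-yes (_~?_ E x x) (~-refl E))))
    (∑-term (elems FX) (λ y → 𝟙 (_~?_ E x y)) (complete FX x))

  classProduct>0 : ∀ E → 1 ≤ classProduct E
  classProduct>0 E = ∏-pos (elems FX) _ (classSize>0 E)

  classSize-cong : ∀ E {x y} → _~_ E x y → classSize E x ≡ classSize E y
  classSize-cong E {x} {y} x~y = ∑-cong (elems FX) (λ z →
    𝟙-cong (_~?_ E x z) (_~?_ E y z) (~-trans E (~-sym E x~y)) (~-trans E x~y))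

  private
    -- A common multiple of all class sizes, so that `cofactor E x` can stand for 1 /
    -- `classSize E x` up to the factor D.
    D : ℕ
    D = card FX !

    D>0 : 1 ≤ D
    D>0 = 1≤n! (card FX)

    classSize∣D : ∀ E x → classSize E x ∣ D
    classSize∣D E x = ∣-trans (self (classSize E x) (classSize>0 E x)) (m≤n⇒m!∣n! (begin
      classSize E x ≤⟨ ∑-mono (elems FX) (λ y → 𝟙≤1 (_~?_ E x y)) ⟩
      ∑ᶠ FX (λ _ → 1) ≡⟨ card-∑ FX ⟨
      card FX ∎))
      where
      open ≤-Reasoning
      self : ∀ c → 1 ≤ c → c ∣ c !
      self (suc c) _ = m∣m*n (c !)

    cofactor : DecEquivalence X → X → ℕ
    cofactor E x = _∣_.quotient (classSize∣D E x)

    size*cofactor : ∀ E x → classSize E x * cofactor E x ≡ D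
    size*cofactor E x = trans (*-comm (classSize E x) _) (sym (_∣_.equality (classSize∣D E x)))

    cofactor-cong : ∀ E {x y} → _~_ E x y → cofactor E x ≡ cofactor E y
    cofactor-cong E {x} {y} x~y =
      *-cancelˡ-≡ _ _ (classSize E x) {{>-nonZero (classSize>0 E x)}} (begin
      classSize E x * cofactor E x ≡⟨ size*cofactor E x ⟩
      D ≡⟨ size*cofactor E y ⟨
      classSize E y * cofactor E y ≡⟨ cong (_* cofactor E y) (classSize-cong E x~y) ⟨
      classSize E x * cofactor E y ∎)
      where open ≡-Reasoning

  module _ (E₁ E₂ E₊ : DecEquivalence X)
    (₁⇒₊ : ∀ {x y} → _~_ E₁ x y → _~_ E₊ x y) (₂⇒₊ : ∀ {x y} → _~_ E₂ x y → _~_ E₊ x y) where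

    private
      E∩ = E₁ ⊓ E₂
      q : X → ℕ
      q x = cofactor E∩ x * cofactor E₊ x

      -- The x related to y by `E₁` and to z by `E₂` are either absent or form a single class of
      -- `E∩`, over which the weights 1 / `classSize E∩` add up to 1. In the latter case y and z are
      -- related by `E₊`.
      inner : ∀ y z → ∑ᶠ FX (λ x → 𝟙 (_~?_ E₁ x y) * 𝟙 (_~?_ E₂ x z) * q x) ≤ 𝟙 (_~?_ E₊ y z) * (D * cofactor E₊ y)
      inner y z with search FX (λ x → _~?_ E₁ x y ×-dec _~?_ E₂ x z)
      ... | no ¬ex = ≤-trans (≤-reflexive (∑-zero (elems FX) zeroTerm)) z≤n
        where
        zeroTerm : ∀ x → 𝟙 (_~?_ E₁ x y) * 𝟙 (_~?_ E₂ x z) * q x ≡ 0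
        zeroTerm x rewrite sym (𝟙-× (_~?_ E₁ x y) (_~?_ E₂ x z) (_~?_ E₁ x y ×-dec _~?_ E₂ x z) id _,_)
            | 𝟙-no (_~?_ E₁ x y ×-dec _~?_ E₂ x z) (λ p → ¬ex (x , p)) = refl
      ... | yes (x₀ , x₀~y , x₀~z) = begin
        ∑ᶠ FX (λ x → 𝟙 (_~?_ E₁ x y) * 𝟙 (_~?_ E₂ x z) * q x)
          ≤⟨ ∑-mono (elems FX) term ⟩
        ∑ᶠ FX (λ x → 𝟙 (_~?_ E∩ x₀ x) * (cofactor E∩ x₀ * cofactor E₊ y))
          ≡⟨ ∑-*ʳ (elems FX) _ _ ⟩
        classSize E∩ x₀ * (cofactor E∩ x₀ * cofactor E₊ y)
          ≡⟨ *-assoc (classSize E∩ x₀) _ _ ⟨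
        classSize E∩ x₀ * cofactor E∩ x₀ * cofactor E₊ y
          ≡⟨ cong (_* cofactor E₊ y) (size*cofactor E∩ x₀) ⟩
        D * cofactor E₊ y
          ≡⟨ *-identityˡ _ ⟨
        1 * (D * cofactor E₊ y)
          ≡⟨ cong (_* (D * cofactor E₊ y)) (𝟙-yes (_~?_ E₊ y z) (~-trans E₊ (~-sym E₊ (₁⇒₊ x₀~y)) (₂⇒₊ x₀~z))) ⟨
        𝟙 (_~?_ E₊ y z) * (D * cofactor E₊ y) ∎
        where
        open ≤-Reasoning
        term : ∀ x → 𝟙 (_~?_ E₁ x y) * 𝟙 (_~?_ E₂ x z) * q x ≤ 𝟙 (_~?_ E∩ x₀ x) * (cofactor E∩ x₀ * cofactor E₊ y)
        term x with _~?_ E₁ x y | _~?_ E₂ x z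
        ... | no _ | _ = z≤n
        ... | yes _ | no _ = z≤n
        ... | yes p | yes p′ = ≤-reflexive (cong₂ _*_
              (sym (𝟙-yes (_~?_ E∩ x₀ x) x₀~x)) (cong₂ _*_ (sym (cofactor-cong E∩ x₀~x)) (cofactor-cong E₊ (₁⇒₊ p))))
          where
          x₀~x : _~_ E∩ x₀ x
          x₀~x = ~-trans E₁ x₀~y (~-sym E₁ p) , ~-trans E₂ x₀~z (~-sym E₂ p′)

      expand : ∀ x → classSize E₁ x * classSize E₂ x * q x ≡
        ∑ᶠ FX (λ y → ∑ᶠ FX (λ z → 𝟙 (_~?_ E₁ x y) * 𝟙 (_~?_ E₂ x z) * q x))
      expand x = sym (begin
        ∑ᶠ FX (λ y → ∑ᶠ FX (λ z → 𝟙 (_~?_ E₁ x y) * 𝟙 (_~?_ E₂ x z) * q x))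
          ≡⟨ ∑-cong (elems FX) (λ y → trans (∑-*ʳ (elems FX) (q x) _) (cong (_* q x) (∑-*ˡ (elems FX) (𝟙 (_~?_ E₁ x y)) _))) ⟩
        ∑ᶠ FX (λ y → 𝟙 (_~?_ E₁ x y) * classSize E₂ x * q x)
          ≡⟨ ∑-*ʳ (elems FX) (q x) _ ⟩
        ∑ᶠ FX (λ y → 𝟙 (_~?_ E₁ x y) * classSize E₂ x) * q x
          ≡⟨ cong (_* q x) (∑-*ʳ (elems FX) (classSize E₂ x) _) ⟩
        classSize E₁ x * classSize E₂ x * q x ∎)
        where open ≡-Reasoning

    -- Shannon's inequality without logarithms. By `gibbs` it suffices that the ratio of the two
    -- integrands has average at most 1 over x. Writing the numerator as a number of pairs (y, z)
    -- and summing over x first, `inner` leaves for each y the sum of 1 / `classSize E₊ y` over the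
    -- class of y, which is 1.
    classProduct-supermodular : classProduct E₁ * classProduct E₂ ≤ classProduct E∩ * classProduct E₊
    classProduct-supermodular = begin
      classProduct E₁ * classProduct E₂
        ≡⟨ ∏-* (elems FX) _ _ ⟨
      ∏ᶠ FX (λ x → classSize E₁ x * classSize E₂ x)
        ≤⟨ gibbs (elems FX) _ (λ x → classSize E∩ x * classSize E₊ x) q (D * D) (*-mono-≤ D>0 D>0) clear average ⟩
      ∏ᶠ FX (λ x → classSize E∩ x * classSize E₊ x)
        ≡⟨ ∏-* (elems FX) _ _ ⟩
      classProduct E∩ * classProduct E₊ ∎
      where
      open ≤-Reasoning
      shuffle : ∀ a b c d → a * b * (c * d) ≡ a * c * (b * d)
      shuffle = solve-∀
      clear : ∀ x → classSize E∩ x * classSize E₊ x * q x ≡ D * D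
      clear x = trans (shuffle (classSize E∩ x) (classSize E₊ x) (cofactor E∩ x) (cofactor E₊ x))
        (cong₂ _*_ (size*cofactor E∩ x) (size*cofactor E₊ x))
      rotate : ∀ a b c → a * (b * c) ≡ a * c * b
      rotate = solve-∀
      average : ∑ᶠ FX (λ x → classSize E₁ x * classSize E₂ x * q x) ≤ card FX * (D * D)
      average = begin
        ∑ᶠ FX (λ x → classSize E₁ x * classSize E₂ x * q x)
          ≡⟨ ∑-cong (elems FX) expand ⟩
        ∑ᶠ FX (λ x → ∑ᶠ FX (λ y → ∑ᶠ FX (λ z → 𝟙 (_~?_ E₁ x y) * 𝟙 (_~?_ E₂ x z) * q x)))
          ≡⟨ ∑-swap (elems FX) (elems FX) _ ⟩
        ∑ᶠ FX (λ y → ∑ᶠ FX (λ x → ∑ᶠ FX (λ z → 𝟙 (_~?_ E₁ x y) * 𝟙 (_~?_ E₂ x z) * q x)))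
          ≡⟨ ∑-cong (elems FX) (λ y → ∑-swap (elems FX) (elems FX) _) ⟩
        ∑ᶠ FX (λ y → ∑ᶠ FX (λ z → ∑ᶠ FX (λ x → 𝟙 (_~?_ E₁ x y) * 𝟙 (_~?_ E₂ x z) * q x)))
          ≤⟨ ∑-mono (elems FX) (λ y → ∑-mono (elems FX) (inner y)) ⟩
        ∑ᶠ FX (λ y → ∑ᶠ FX (λ z → 𝟙 (_~?_ E₊ y z) * (D * cofactor E₊ y)))
          ≡⟨ ∑-cong (elems FX) (λ y → trans (∑-*ʳ (elems FX) _ _) (trans (rotate (classSize E₊ y) D (cofactor E₊ y))
               (cong (_* D) (size*cofactor E₊ y)))) ⟩
        ∑ᶠ FX (λ y → D * D)
          ≡⟨ ∑-const (elems FX) (D * D) ⟩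
        card FX * (D * D) ∎

-- Subgroups of a finite abelian group

#-pair : (FA : Finite A) (FB : Finite B) {P : A → Set} {Q : B → Set} (P? : ∀ x → Dec (P x)) (Q? : ∀ x → Dec (Q x)) →
  # (pairs FA FB) (λ (a , b) → P? a ×-dec Q? b) ≡ # FA P? * # FB Q?
#-pair FA FB P? Q? = begin
  # (pairs FA FB) (λ (a , b) → P? a ×-dec Q? b)
    ≡⟨ ∑-pair FA FB _ ⟩
  ∑ᶠ FA (λ a → ∑ᶠ FB (λ b → 𝟙 (P? a ×-dec Q? b)))
    ≡⟨ ∑-cong (elems FA) (λ a → trans (∑-cong (elems FB) (λ b → 𝟙-× (P? a) (Q? b) (P? a ×-dec Q? b) id _,_))
         (∑-*ˡ (elems FB) (𝟙 (P? a)) _)) ⟩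
  ∑ᶠ FA (λ a → 𝟙 (P? a) * # FB Q?)
    ≡⟨ ∑-*ʳ (elems FA) (# FB Q?) _ ⟩
  # FA P? * # FB Q? ∎
  where open ≡-Reasoning

subsets : Finite A → List A → List (A → Bool)
subsets F [] = (λ _ → false) ∷ []
subsets F (x ∷ xs) = concatMap (λ p → p ∷ (λ y → does (Finite._≟_ F y x) ∨ p y) ∷ []) (subsets F xs)

-- Predicates are functions, and without extensionality the enumeration can meet `q` only up to
-- pointwise equivalence on `xs`.
subsets-complete : (F : Finite A) (q : A → Bool) (xs : List A) → ∃ λ p → p ∈ subsets F xs ×
  (∀ y → T (p y) → T (q y)) × (∀ y → y ∈ xs → T (q y) → T (p y))
subsets-complete F q [] = (λ _ → false) , here refl , (λ _ ()) , λ _ ()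
subsets-complete F q (x ∷ xs) with subsets-complete F q xs | T? (q x)
... | p , p∈ , p⇒q , q⇒p | no ¬qx = p , ∈-concatMap⁺ _ (lose p∈ (here refl)) , p⇒q , λ
  { y (here refl) qx → contradiction qx ¬qx ; y (there i) qy → q⇒p y i qy }
... | p , p∈ , p⇒q , q⇒p | yes qx = p′ , ∈-concatMap⁺ _ (lose p∈ (there (here refl))) , to , from
  where
  open Finite F using (_≟_)
  p′ = λ y → does (y ≟ x) ∨ p y
  to : ∀ y → T (p′ y) → T (q y)
  to y t with y ≟ x
  ... | yes refl = qx
  ... | no _ = p⇒q y t
  from : ∀ y → y ∈ x ∷ xs → T (q y) → T (p′ y)
  from y i qy with y ≟ x
  from y i qy | yes _ = _
  from y (here y≡x) qy | no y≢x = contradiction y≡x y≢x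
  from y (there i) qy | no y≢x = q⇒p y i qy

bundle : {_⊕_ : A → A → A} {𝟘 : A} {⊖_ : A → A} → IsAbelianGroup _≡_ _⊕_ 𝟘 ⊖_ → AbelianGroup 0ℓ 0ℓ
bundle ab = record { isAbelianGroup = ab }

module Subgroups {G : Set} (FG : Finite G) {_⊕_ : G → G → G} {𝟘 : G} {⊖_ : G → G}
  (isAbelianGroup : IsAbelianGroup _≡_ _⊕_ 𝟘 ⊖_) where

  open IsAbelianGroup isAbelianGroup using (assoc; comm; identityˡ; identityʳ; inverseˡ; inverseʳ)
  open Finite FG using (_≟_)

  open AbelianGroupProperties (bundle isAbelianGroup) using (⁻¹-∙-comm; ∙-cancelˡ)
  open CommutativeSemigroupProperties (AbelianGroup.commutativeSemigroup (bundle isAbelianGroup)) using (interchange)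

  IsSubgroup : (G → Bool) → Set
  IsSubgroup p = T (p 𝟘) × (∀ a b → T (p a) → T (p b) → T (p (a ⊕ b))) × (∀ a → T (p a) → T (p (⊖ a)))

  isSubgroup? : ∀ p → Dec (IsSubgroup p)
  isSubgroup? p = T? (p 𝟘)
    ×-dec forAll FG (λ a → forAll FG (λ b → T? (p a) →-dec (T? (p b) →-dec T? (p (a ⊕ b)))))
    ×-dec forAll FG (λ a → T? (p a) →-dec T? (p (⊖ a)))

  size : (G → Bool) → ℕ
  size p = # FG (λ g → T? (p g))

  size>0 : ∀ {p} → IsSubgroup p → 1 ≤ size p
  size>0 {p} (z , _) = ≤-trans (≤-reflexive (sym (𝟙-yes (T? (p 𝟘)) z))) (∑-term (elems FG) (λ g → 𝟙 (T? (p g))) (complete FG 𝟘))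

  summand? : (p q : G → Bool) (g : G) → Dec (∃ λ a → T (p a) × T (q (g ⊕ (⊖ a))))
  summand? p q g = search FG (λ a → T? (p a) ×-dec T? (q (g ⊕ (⊖ a))))

  meet join : (G → Bool) → (G → Bool) → G → Bool
  meet p q g = p g ∧ q g
  join p q g = ⌊ summand? p q g ⌋

  meet⁻ : ∀ p q {g} → T (meet p q g) → T (p g) × T (q g)
  meet⁻ p q {g} t = Equivalence.to (T-∧ {p g}) t

  meet⁺ : ∀ p q {g} → T (p g) → T (q g) → T (meet p q g)
  meet⁺ p q {g} s t = Equivalence.from (T-∧ {p g}) (s , t)

  join⁻ : ∀ p q {g} → T (join p q g) → ∃ λ a → T (p a) × T (q (g ⊕ (⊖ a)))
  join⁻ p q {g} = toWitness {a? = summand? p q g}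

  join⁺ : ∀ p q {g} a → T (p a) → T (q (g ⊕ (⊖ a))) → T (join p q g)
  join⁺ p q {g} a s t = fromWitness {a? = summand? p q g} (a , s , t)

  split : ∀ g a → a ⊕ (g ⊕ (⊖ a)) ≡ g
  split g a = begin
    a ⊕ (g ⊕ (⊖ a)) ≡⟨ comm a _ ⟩
    (g ⊕ (⊖ a)) ⊕ a ≡⟨ assoc g (⊖ a) a ⟩
    g ⊕ ((⊖ a) ⊕ a) ≡⟨ cong (g ⊕_) (inverseˡ a) ⟩
    g ⊕ 𝟘 ≡⟨ identityʳ g ⟩
    g ∎
    where open ≡-Reasoning

  meet-isSubgroup : ∀ {p q} → IsSubgroup p → IsSubgroup q → IsSubgroup (meet p q)
  meet-isSubgroup {p} {q} (p0 , p+ , p-) (q0 , q+ , q-) = meet⁺ p q p0 q0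
    , (λ a b s t → let sp , sq = meet⁻ p q s ; tp , tq = meet⁻ p q t in meet⁺ p q (p+ a b sp tp) (q+ a b sq tq))
    , λ a s → let sp , sq = meet⁻ p q s in meet⁺ p q (p- a sp) (q- a sq)

  join-isSubgroup : ∀ {p q} → IsSubgroup p → IsSubgroup q → IsSubgroup (join p q)
  join-isSubgroup {p} {q} (p0 , p+ , p-) (q0 , q+ , q-) =
      join⁺ p q 𝟘 p0 (subst (T ∘ q) (sym (inverseʳ 𝟘)) q0)
    , (λ a b s t → let c , pc , qc = join⁻ p q s ; d , pd , qd = join⁻ p q t in
         join⁺ p q (c ⊕ d) (p+ c d pc pd) (subst (T ∘ q) (add a b c d) (q+ _ _ qc qd)))
    , λ a s → let c , pc , qc = join⁻ p q s in
         join⁺ p q (⊖ c) (p- c pc) (subst (T ∘ q) (sym (⁻¹-∙-comm a (⊖ c))) (q- _ qc))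
    where
    add : ∀ a b c d → (a ⊕ (⊖ c)) ⊕ (b ⊕ (⊖ d)) ≡ (a ⊕ b) ⊕ (⊖ (c ⊕ d))
    add a b c d = trans (interchange a (⊖ c) b (⊖ d)) (cong ((a ⊕ b) ⊕_) (⁻¹-∙-comm c d))

  ⊆-joinˡ : ∀ p q → IsSubgroup q → ∀ g → T (p g) → T (join p q g)
  ⊆-joinˡ p q (q0 , _) g pg = join⁺ p q g pg (subst (T ∘ q) (sym (inverseʳ g)) q0)

  ⊆-joinʳ : ∀ p q → IsSubgroup p → ∀ g → T (q g) → T (join p q g)
  ⊆-joinʳ p q (p0 , _) g qg = join⁺ p q 𝟘 p0 (subst (T ∘ q) (sym (trans (cong (g ⊕_) ⊖𝟘) (identityʳ g))) qg)
    where
    ⊖𝟘 : ⊖ 𝟘 ≡ 𝟘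
    ⊖𝟘 = trans (sym (identityʳ (⊖ 𝟘))) (inverseˡ 𝟘)

  join-⊆ : ∀ {p q r} → IsSubgroup r → (∀ g → T (p g) → T (r g)) → (∀ g → T (q g) → T (r g)) → ∀ g → T (join p q g) → T (r g)
  join-⊆ {p} {q} {r} (_ , r+ , _) p⊆r q⊆r g t = let a , pa , qa = join⁻ p q t in
    subst (T ∘ r) (split g a) (r+ a _ (p⊆r a pa) (q⊆r _ qa))

  -- Fix a decomposition g = a + b for each g of the sum. The map (g, u) ↦ (a + u, b - u) is
  -- injective: adding the two components returns g, hence a, and then u.
  size-submodular : ∀ {p q} → IsSubgroup p → IsSubgroup q → size (join p q) * size (meet p q) ≤ size p * size q
  size-submodular {p} {q} (p0 , p+ , p-) (q0 , q+ , q-) = begin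
    size (join p q) * size (meet p q)
      ≡⟨ #-pair FG FG (λ g → T? (join p q g)) (λ g → T? (meet p q g)) ⟨
    # (pairs FG FG) (λ (g , u) → T? (join p q g) ×-dec T? (meet p q u))
      ≤⟨ #-injection (pairs FG FG) (pairs FG FG)
           (λ (g , u) → T? (join p q g) ×-dec T? (meet p q u)) (λ (a , b) → T? (p a) ×-dec T? (q b)) f f-valid f-injective ⟩
    # (pairs FG FG) (λ (a , b) → T? (p a) ×-dec T? (q b))
      ≡⟨ #-pair FG FG (λ g → T? (p g)) (λ g → T? (q g)) ⟩
    size p * size q ∎
    where
    open ≤-Reasoning
    choose : ∀ g → Dec (∃ λ a → T (p a) × T (q (g ⊕ (⊖ a)))) → G
    choose g (yes (a , _)) = a
    choose g (no _) = 𝟘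
    choose-valid : ∀ g (d : Dec (∃ λ a → T (p a) × T (q (g ⊕ (⊖ a))))) → T ⌊ d ⌋ →
      T (p (choose g d)) × T (q (g ⊕ (⊖ choose g d)))
    choose-valid g (yes (_ , w)) _ = w
    part : G → G
    part g = choose g (summand? p q g)
    part-valid : ∀ g → T (join p q g) → T (p (part g)) × T (q (g ⊕ (⊖ part g)))
    part-valid g = choose-valid g (summand? p q g)
    f : G × G → G × G
    f (g , u) = part g ⊕ u , (g ⊕ (⊖ part g)) ⊕ (⊖ u)
    f-valid : ∀ gu → T (join p q (proj₁ gu)) × T (meet p q (proj₂ gu)) → T (p (proj₁ (f gu))) × T (q (proj₂ (f gu)))
    f-valid (g , u) (s , t) = let pa , qa = part-valid g s ; pu , qu = meet⁻ p q t in
      p+ _ _ pa pu , q+ _ _ qa (q- _ qu)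
    total : ∀ g u → proj₁ (f (g , u)) ⊕ proj₂ (f (g , u)) ≡ g
    total g u = trans (interchange (part g) u _ (⊖ u))
      (trans (cong₂ _⊕_ (split g (part g)) (inverseʳ u)) (identityʳ g))
    f-injective : ∀ x y → _ → _ → f x ≡ f y → x ≡ y
    f-injective (g , u) (g′ , u′) _ _ e with trans (sym (total g u)) (trans (cong (λ (a , b) → a ⊕ b) e) (total g′ u′))
    ... | refl = cong (g ,_) (∙-cancelˡ (part g) u u′ (cong proj₁ e))

-- Semistability

-- The function size p ^ r / degrees p ^ m is submodular and invariant under the symmetries, so its largest minimiser
-- below V is an invariant subgroup.
module Semistability {G : Set} (FG : Finite G) {_⊕_ : G → G → G} {𝟘 : G} {⊖_ : G → G}
  (isAbelianGroup : IsAbelianGroup _≡_ _⊕_ 𝟘 ⊖_)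
  {X Z : Set} (FX : Finite X) (FZ : Finite Z) (diff : X → X → Z → G)
  (diff-refl : ∀ x z → diff x x z ≡ 𝟘)
  (diff-sym : ∀ x y z → diff y x z ≡ ⊖ diff x y z)
  (diff-trans : ∀ x y w z → diff x w z ≡ diff x y z ⊕ diff y w z)
  where

  open Subgroups FG isAbelianGroup public
  open Classes FX

  -- The product of these class sizes is δ(p). The difference is required for every scalar `z` at
  -- once because a hash multiplies each column by an arbitrary scalar.
  degree : (G → Bool) → X → ℕ
  degree p x = # FX (λ y → forAll FZ (λ z → T? (p (diff x y z))))

  degrees : (G → Bool) → ℕ
  degrees p = ∏ᶠ FX (degree p)

  congruence : ∀ {p} → IsSubgroup p → DecEquivalence X
  congruence {p} (p0 , p+ , p-) = record
    { _~_ = λ x y → ∀ z → T (p (diff x y z))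
    ; _~?_ = λ x y → forAll FZ (λ z → T? (p (diff x y z)))
    ; ~-refl = λ {x} z → subst (T ∘ p) (sym (diff-refl x z)) p0
    ; ~-sym = λ {x} {y} x~y z → subst (T ∘ p) (sym (diff-sym x y z)) (p- _ (x~y z))
    ; ~-trans = λ {x} {y} {w} x~y y~w z → subst (T ∘ p) (sym (diff-trans x y w z)) (p+ _ _ (x~y z) (y~w z)) }

  degrees>0 : ∀ {p} → IsSubgroup p → 1 ≤ degrees p
  degrees>0 s = classProduct>0 (congruence s)

  degree-mono : ∀ {p q} → (∀ g → T (p g) → T (q g)) → ∀ x → degree p x ≤ degree q x
  degree-mono p⊆q x = ∑-mono (elems FX) (λ y → 𝟙-mono (forAll FZ _) (forAll FZ _) (λ h z → p⊆q _ (h z)))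

  degrees-mono : ∀ {p q} → (∀ g → T (p g) → T (q g)) → degrees p ≤ degrees q
  degrees-mono p⊆q = ∏-mono (elems FX) (degree-mono p⊆q)

  size-mono : ∀ {p q} → (∀ g → T (p g) → T (q g)) → size p ≤ size q
  size-mono {p} {q} p⊆q = ∑-mono (elems FG) (λ g → 𝟙-mono (T? (p g)) (T? (q g)) (p⊆q g))

  degrees-supermodular : ∀ {p q} → IsSubgroup p → IsSubgroup q →
    degrees p * degrees q ≤ degrees (meet p q) * degrees (join p q)
  degrees-supermodular {p} {q} sp sq = ≤-trans
    (classProduct-supermodular (congruence sp) (congruence sq) (congruence (join-isSubgroup sp sq))
      (λ h z → ⊆-joinˡ p q sq _ (h z)) (λ h z → ⊆-joinʳ p q sp _ (h z)))
    (*-monoˡ-≤ (degrees (join p q)) (∏-mono (elems FX) (λ x → ∑-mono (elems FX) (λ y →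
      𝟙-mono _ (forAll FZ _) (λ (s , t) z → meet⁺ p q (s z) (t z))))))

  module _ {V : G → Bool} (V-subgroup : IsSubgroup V) (m r : ℕ)
    {I : Set} (σG : I → G → G) (σX : I → X → X)
    (σG-involutive : ∀ ι g → σG ι (σG ι g) ≡ g) (σX-involutive : ∀ ι x → σX ι (σX ι x) ≡ x)
    (σG-𝟘 : ∀ ι → σG ι 𝟘 ≡ 𝟘) (σG-⊕ : ∀ ι a b → σG ι (a ⊕ b) ≡ σG ι a ⊕ σG ι b) (σG-⊖ : ∀ ι a → σG ι (⊖ a) ≡ ⊖ σG ι a)
    (σ-diff : ∀ ι x y z → σG ι (diff x y z) ≡ diff (σX ι x) (σX ι y) z)
    (σG-V : ∀ ι g → T (V g) → T (V (σG ι g)))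
    (invariant-case : ∀ p → IsSubgroup p → (∀ g → T (p g) → T (V g)) →
      (∀ ι g → T (p g) → T (p (σG ι g))) → degrees p ^ m ≤ size p ^ r)
    where

    private
      Candidate : (G → Bool) → Set
      Candidate p = IsSubgroup p × (∀ g → T (p g) → T (V g))

      -- `≼` compares the ratios size^r / degrees^m by cross-multiplication. `⊑` breaks ties in
      -- favour of the larger subgroup, so that its least element is the largest minimiser.
      _≼_ _⊑_ : ∃ Candidate → ∃ Candidate → Set
      (p , _) ≼ (q , _) = size p ^ r * degrees q ^ m ≤ size q ^ r * degrees p ^ m
      c ⊑ d = c ≼ d × (d ≼ c → size (proj₁ d) ≤ size (proj₁ c))

      s>0 : (c : ∃ Candidate) → 1 ≤ size (proj₁ c) ^ r
      s>0 (p , sp , _) = 1≤^ r (size>0 {p} sp)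

      d>0 : (c : ∃ Candidate) → 1 ≤ degrees (proj₁ c) ^ m
      d>0 (p , sp , _) = 1≤^ m (degrees>0 sp)

      ≼-trans : ∀ {a b c} → a ≼ b → b ≼ c → a ≼ c
      ≼-trans {a} {b} {c} a≼b b≼c = *-cancelʳ-≤⁺ (sb * db) (*-mono-≤ (s>0 b) (d>0 b)) (begin
        (sa * dc) * (sb * db) ≡⟨ e₁ sa dc sb db ⟩
        (sa * db) * (sb * dc) ≤⟨ *-mono-≤ a≼b b≼c ⟩
        (sb * da) * (sc * db) ≡⟨ e₂ sb da sc db ⟩
        (sc * da) * (sb * db) ∎)
        where
        open ≤-Reasoning
        sa = size (proj₁ a) ^ r
        sb = size (proj₁ b) ^ r
        sc = size (proj₁ c) ^ r
        da = degrees (proj₁ a) ^ m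
        db = degrees (proj₁ b) ^ m
        dc = degrees (proj₁ c) ^ m
        e₁ : ∀ a b c d → (a * b) * (c * d) ≡ (a * d) * (c * b)
        e₁ = solve-∀
        e₂ : ∀ a b c d → (a * b) * (c * d) ≡ (c * b) * (a * d)
        e₂ = solve-∀

      ⊑-trans : ∀ {a b c} → a ⊑ b → b ⊑ c → a ⊑ c
      ⊑-trans {a} {b} {c} (a≼b , ab) (b≼c , bc) = ≼-trans {a} {b} {c} a≼b b≼c ,
        λ c≼a → ≤-trans (bc (≼-trans {c} {a} {b} c≼a a≼b)) (ab (≼-trans {b} {c} {a} b≼c c≼a))

      ⊑-total : ∀ a b → a ⊑ b ⊎ b ⊑ a
      ⊑-total a b with (size (proj₁ a) ^ r * degrees (proj₁ b) ^ m) ≤? (size (proj₁ b) ^ r * degrees (proj₁ a) ^ m)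
                     | (size (proj₁ b) ^ r * degrees (proj₁ a) ^ m) ≤? (size (proj₁ a) ^ r * degrees (proj₁ b) ^ m)
      ... | yes a≼b | no b⋠a = inj₁ (a≼b , λ b≼a → contradiction b≼a b⋠a)
      ... | no a⋠b | yes b≼a = inj₂ (b≼a , λ a≼b → contradiction a≼b a⋠b)
      ... | no a⋠b | no b⋠a = contradiction (<⇒≤ (≰⇒> a⋠b)) b⋠a
      ... | yes a≼b | yes b≼a with ≤-total (size (proj₁ a)) (size (proj₁ b))
      ... | inj₁ le = inj₂ (b≼a , λ _ → le)
      ... | inj₂ le = inj₁ (a≼b , λ _ → le)

      candidate? : ∀ p → Dec (Candidate p)
      candidate? p = isSubgroup? p ×-dec forAll FG (λ g → T? (p g) →-dec T? (V g))

      collect : List (G → Bool) → List (∃ Candidate)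
      collect [] = []
      collect (p ∷ ps) with candidate? p
      ... | yes c = (p , c) ∷ collect ps
      ... | no _ = collect ps

      collect-complete : ∀ {p} ps → p ∈ ps → Candidate p → ∃ λ c → (p , c) ∈ collect ps
      collect-complete (p ∷ ps) i c with candidate? p
      collect-complete (p ∷ ps) (here refl) c | yes c′ = c′ , here refl
      collect-complete (p ∷ ps) (there i) c | yes c′ = let c″ , j = collect-complete ps i c in c″ , there j
      collect-complete (p ∷ ps) (here refl) c | no ¬c = contradiction c ¬c
      collect-complete (p ∷ ps) (there i) c | no ¬c = collect-complete ps i c

      V-candidate : ∃ Candidate
      V-candidate = V , V-subgroup , λ _ → id

      minimiser : ∃ λ c → ∀ d → c ⊑ d
      minimiser with minimum _⊑_ ⊑-total (λ {a} {b} {c} → ⊑-trans {a} {b} {c}) V-candidate (collect (subsets FG (elems FG)))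
      ... | c , _ , c-min = c , below
        where
        -- An arbitrary candidate is compared through its listed copy, which has the same elements
        -- and hence the same size and degrees.
        below : ∀ d → c ⊑ d
        below (q , sq@(q0 , q+ , q-) , q⊆V) with subsets-complete FG q (elems FG)
        ... | p , p∈ , p⇒q , q⇒p = ⊑-trans {c} {p , proj₁ found} {q , sq , q⊆V} (c-min _ (there (proj₂ found)))
            ( *-mono-≤ (^-monoˡ-≤ r (size-mono p⇒q)) (^-monoˡ-≤ m (degrees-mono q⊆p)) , λ _ → size-mono q⊆p)
          where
          q⊆p : ∀ g → T (q g) → T (p g)
          q⊆p g = q⇒p g (complete FG g)
          found = collect-complete (subsets FG (elems FG)) p∈
            ((q⊆p _ q0 , (λ a b s t → q⊆p _ (q+ a b (p⇒q a s) (p⇒q b t))) , λ a s → q⊆p _ (q- a (p⇒q a s))) ,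
             λ g → q⊆V g ∘ p⇒q g)

      W : G → Bool
      W = proj₁ (proj₁ minimiser)
      W-subgroup : IsSubgroup W
      W-subgroup = proj₁ (proj₂ (proj₁ minimiser))
      W⊆V : ∀ g → T (W g) → T (V g)
      W⊆V = proj₂ (proj₂ (proj₁ minimiser))

      module _ (ι : I) where
        σW : G → Bool
        σW = W ∘ σG ι

        σW-subgroup : IsSubgroup σW
        σW-subgroup with W-subgroup
        ... | W0 , W+ , W- = subst (T ∘ W) (sym (σG-𝟘 ι)) W0
          , (λ a b s t → subst (T ∘ W) (sym (σG-⊕ ι a b)) (W+ _ _ s t))
          , λ a s → subst (T ∘ W) (sym (σG-⊖ ι a)) (W- _ s)

        σW⊆V : ∀ g → T (σW g) → T (V g)
        σW⊆V g t = subst (T ∘ V) (σG-involutive ι g) (σG-V ι _ (W⊆V _ t))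

        size-σW : size σW ≡ size W
        size-σW = ∑-involution FG (σG ι) (σG-involutive ι) (λ g → 𝟙 (T? (W g)))

        degrees-σW : degrees σW ≡ degrees W
        degrees-σW = trans (∏-cong (elems FX) step) (∏-involution FX (σX ι) (σX-involutive ι) (degree W))
          where
          step : ∀ x → degree σW x ≡ degree W (σX ι x)
          step x = trans (∑-cong (elems FX) (λ y → 𝟙-cong (forAll FZ (λ z → T? (σW (diff x y z)))) (forAll FZ (λ z → T? (W (diff (σX ι x) (σX ι y) z))))
              (λ h z → subst (T ∘ W) (σ-diff ι x y z) (h z)) (λ h z → subst (T ∘ W) (sym (σ-diff ι x y z)) (h z))))
            (∑-involution FX (σX ι) (σX-involutive ι) (λ y → 𝟙 (forAll FZ (λ z → T? (W (diff (σX ι x) y z))))))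

        J∙ M∙ : ∃ Candidate
        J∙ = join W σW , join-isSubgroup W-subgroup σW-subgroup , join-⊆ V-subgroup W⊆V σW⊆V
        M∙ = meet W σW , meet-isSubgroup W-subgroup σW-subgroup , λ g t → W⊆V g (proj₁ (meet⁻ W σW t))

        -- Write f for the ratio. Submodularity and symmetry give f(J) f(M) ≤ f(W) f(σW) = f(W)²,
        -- and f(W) ≤ f(M) by minimality; hence f(J) ≤ f(W).
        J≼W : J∙ ≼ proj₁ minimiser
        J≼W = *-cancelʳ-≤⁺ (s * d∩) (*-mono-≤ (s>0 (proj₁ minimiser)) (d>0 M∙)) (begin
          s₊ * d * (s * d∩) ≤⟨ *-monoʳ-≤ (s₊ * d) (proj₁ (proj₂ minimiser M∙)) ⟩
          s₊ * d * (s∩ * d) ≡⟨ e₁ s₊ d s∩ ⟩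
          s₊ * s∩ * (d * d) ≤⟨ *-mono-≤ sizes degs ⟩
          s * s * (d∩ * d₊) ≡⟨ e₂ s d∩ d₊ ⟩
          s * d₊ * (s * d∩) ∎)
          where
          open ≤-Reasoning
          s = size W ^ r
          d = degrees W ^ m
          s₊ = size (join W σW) ^ r
          d₊ = degrees (join W σW) ^ m
          s∩ = size (meet W σW) ^ r
          d∩ = degrees (meet W σW) ^ m
          e₁ : ∀ s d t → s * d * (t * d) ≡ s * t * (d * d)
          e₁ = solve-∀
          e₂ : ∀ s d t → s * s * (d * t) ≡ s * t * (s * d)
          e₂ = solve-∀
          sizes : s₊ * s∩ ≤ s * s
          sizes = begin
            s₊ * s∩ ≡⟨ ^-distribʳ-* r (size (join W σW)) _ ⟨
            (size (join W σW) * size (meet W σW)) ^ r ≤⟨ ^-monoˡ-≤ r (size-submodular W-subgroup σW-subgroup) ⟩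
            (size W * size σW) ^ r ≡⟨ cong (λ t → (size W * t) ^ r) size-σW ⟩
            (size W * size W) ^ r ≡⟨ ^-distribʳ-* r (size W) _ ⟩
            s * s ∎
          degs : d * d ≤ d∩ * d₊
          degs = begin
            d * d ≡⟨ ^-distribʳ-* m (degrees W) _ ⟨
            (degrees W * degrees W) ^ m ≡⟨ cong (λ t → (degrees W * t) ^ m) degrees-σW ⟨
            (degrees W * degrees σW) ^ m ≤⟨ ^-monoˡ-≤ m (degrees-supermodular W-subgroup σW-subgroup) ⟩
            (degrees (meet W σW) * degrees (join W σW)) ^ m ≡⟨ ^-distribʳ-* m (degrees (meet W σW)) _ ⟩
            d∩ * d₊ ∎

        -- The join is again a minimiser, so the tie-break bounds its size by that of `W`. It
        -- contains `W`, hence equals it, and it contains `σW`.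
        σW⊆W : ∀ g → T (σW g) → T (W g)
        σW⊆W g t = 𝟙⁻ (T? (W g)) (≤-trans (≤-reflexive (sym (𝟙-yes (T? (join W σW g)) (⊆-joinʳ W σW W-subgroup g t))))
          (∑-tight (elems FG) (λ x → 𝟙-mono (T? (W x)) (T? (join W σW x)) (⊆-joinˡ W σW σW-subgroup x))
            (proj₂ (proj₂ minimiser J∙) J≼W) (complete FG g)))
          where
          𝟙⁻ : ∀ {P : Set} (d : Dec P) → 1 ≤ 𝟙 d → P
          𝟙⁻ (yes p) _ = p

      W-invariant : ∀ ι g → T (W g) → T (W (σG ι g))
      W-invariant ι g t = σW⊆W ι (σG ι g) (subst (T ∘ W) (sym (σG-involutive ι g)) t)

    -- In terms of the ratio f: f(p) ≥ f(W) by minimality, and f(W) ≥ 1 because `W` is invariant.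
    semistable : ∀ p → IsSubgroup p → (∀ g → T (p g) → T (V g)) → degrees p ^ m ≤ size p ^ r
    semistable p sp p⊆V = *-cancelˡ-≤⁺ (degrees W ^ m) (1≤^ m (degrees>0 W-subgroup)) (begin
      degrees W ^ m * degrees p ^ m ≤⟨ *-monoˡ-≤ (degrees p ^ m) (invariant-case W W-subgroup W⊆V W-invariant) ⟩
      size W ^ r * degrees p ^ m ≤⟨ proj₁ (proj₂ minimiser (p , sp , p⊆V)) ⟩
      size p ^ r * degrees W ^ m ≡⟨ *-comm (size p ^ r) _ ⟩
      degrees W ^ m * size p ^ r ∎)
      where open ≤-Reasoning

-- Balanced letters

vec-ext : ∀ {n} {u v : Vec A n} → (∀ i → lookup u i ≡ lookup v i) → u ≡ v
vec-ext {u = u} {v} eq = trans (sym (Vec.tabulate∘lookup u)) (trans (Vec.tabulate-cong eq) (Vec.tabulate∘lookup v))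

transpose-at₁ : ∀ {n} (a b : Fin n) → transpose a b a ≡ b
transpose-at₁ a b rewrite dec-true (a Fin.≟ a) refl = refl

transpose-at₂ : ∀ {n} (a b : Fin n) → transpose a b b ≡ a
transpose-at₂ a b with b Fin.≟ a
... | yes refl = refl
... | no _ rewrite dec-true (b Fin.≟ b) refl = refl

transpose-elsewhere : ∀ {n} (a b : Fin n) {c} → c ≢ a → c ≢ b → transpose a b c ≡ c
transpose-elsewhere a b {c} c≢a c≢b rewrite dec-false (c Fin.≟ a) c≢a | dec-false (c Fin.≟ b) c≢b = refl

data Position {n} (a b c : Fin n) : Set where
  first  : c ≡ a → Position a b c
  second : c ≢ a → c ≡ b → Position a b c
  other  : c ≢ a → c ≢ b → Position a b c

position : ∀ {n} (a b c : Fin n) → Position a b c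
position a b c with c Fin.≟ a | c Fin.≟ b
... | yes p | _ = first p
... | no ¬p | yes q = second ¬p q
... | no ¬p | no ¬q = other ¬p ¬q

transpose-involutive : ∀ {n} (a b c : Fin n) → transpose a b (transpose a b c) ≡ c
transpose-involutive a b c with position a b c
... | first refl = trans (cong (transpose c b) (transpose-at₁ c b)) (transpose-at₂ c b)
... | second _ refl = trans (cong (transpose a c) (transpose-at₂ a c)) (transpose-at₁ a c)
... | other p q = trans (cong (transpose a b) (transpose-elsewhere a b p q)) (transpose-elsewhere a b p q)

swap : ∀ {n} → Fin n → Fin n → Vec A n → Vec A n
swap a b v = tabulate (λ i → lookup v (transpose a b i))

lookup-swap : ∀ {n} (a b : Fin n) (v : Vec A n) i → lookup (swap a b v) i ≡ lookup v (transpose a b i)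
lookup-swap a b v i = Vec.lookup∘tabulate _ i

swap-involutive : ∀ {n} (a b : Fin n) (v : Vec A n) → swap a b (swap a b v) ≡ v
swap-involutive a b v = vec-ext (λ i → trans (lookup-swap a b (swap a b v) i)
  (trans (lookup-swap a b v _) (cong (lookup v) (transpose-involutive a b i))))

countOnes-∑ : ∀ {n} (v : Vec (Fin 2) n) → countOnes v ≡ # (fins n) (λ i → lookup v i Fin.≟ zero)
countOnes-∑ [] = refl
countOnes-∑ {suc n} (zero ∷ v) = trans (cong suc (countOnes-∑ v)) (sym (∑-suc n (λ i → 𝟙 (lookup (zero ∷ v) i Fin.≟ zero))))
countOnes-∑ {suc n} (suc b ∷ v) = trans (countOnes-∑ v) (sym (∑-suc n (λ i → 𝟙 (lookup (suc b ∷ v) i Fin.≟ zero))))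

countOnes-swap : ∀ {n} (a b : Fin n) (v : Vec (Fin 2) n) → countOnes (swap a b v) ≡ countOnes v
countOnes-swap {n} a b v = begin
  countOnes (swap a b v)
    ≡⟨ countOnes-∑ (swap a b v) ⟩
  # (fins n) (λ i → lookup (swap a b v) i Fin.≟ zero)
    ≡⟨ ∑-cong (finElems n) (λ i → cong (λ t → 𝟙 (t Fin.≟ zero)) (lookup-swap a b v i)) ⟩
  # (fins n) (λ i → lookup v (transpose a b i) Fin.≟ zero)
    ≡⟨ ∑-involution (fins n) (transpose a b) (transpose-involutive a b) (λ i → 𝟙 (lookup v i Fin.≟ zero)) ⟩
  # (fins n) (λ i → lookup v i Fin.≟ zero)
    ≡⟨ countOnes-∑ v ⟨
  countOnes v ∎
  where open ≡-Reasoning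

flip : Fin 2 → Fin 2
flip zero = suc zero
flip (suc zero) = zero

flip-involutive : ∀ b → flip (flip b) ≡ b
flip-involutive zero = refl
flip-involutive (suc zero) = refl

countOnes-flip : ∀ {n} (v : Vec (Fin 2) n) → countOnes (Vec.map flip v) + countOnes v ≡ n
countOnes-flip [] = refl
countOnes-flip (zero ∷ v) = trans (+-suc _ _) (cong suc (countOnes-flip v))
countOnes-flip (suc zero ∷ v) = cong suc (countOnes-flip v)

-- Otherwise every zero of `u` is a zero of `v`, and equal numbers of zeros make the two words
-- coincide.
discrepancy : ∀ {n} (u v : Vec (Fin 2) n) → countOnes u ≡ countOnes v → u ≢ v →
  ∃ λ a → lookup u a ≡ zero × lookup v a ≡ suc zero
discrepancy {n} u v eq u≢v with search (fins n) (λ a → (lookup u a Fin.≟ zero) ×-dec (lookup v a Fin.≟ suc zero))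
... | yes found = found
... | no none = contradiction (vec-ext agree) u≢v
  where
  le : ∀ a → 𝟙 (lookup u a Fin.≟ zero) ≤ 𝟙 (lookup v a Fin.≟ zero)
  le a with lookup u a in p | lookup v a in q
  ... | zero | zero = ≤-refl
  ... | zero | suc zero = contradiction (a , p , q) none
  ... | suc zero | _ = z≤n
  ge : ∀ a → 𝟙 (lookup v a Fin.≟ zero) ≤ 𝟙 (lookup u a Fin.≟ zero)
  ge a = ∑-tight (finElems n) le (≤-reflexive (trans (sym (countOnes-∑ v)) (trans (sym eq) (countOnes-∑ u))))
    (complete (fins n) a)
  agree : ∀ a → lookup u a ≡ lookup v a
  agree a with lookup u a | lookup v a | le a | ge a
  ... | zero | zero | _ | _ = refl
  ... | suc zero | suc zero | _ | _ = refl
  ... | zero | suc zero | () | _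
  ... | suc zero | zero | _ | ()

subtype : (F : Finite A) {P : A → Set} (P? : ∀ a → Dec (P a)) → (∀ {a} (p q : P a) → p ≡ q) → Finite (Σ A P)
subtype {A} F {P} P? irrelevant = record { elems = concatMap (λ a → witness (P? a)) (elems F) ; _≟_ = _≟ₛ_ ; once = one }
  where
  open Finite F using (_≟_)
  witness : ∀ {a} → Dec (P a) → List (Σ A P)
  witness (yes p) = (_ , p) ∷ []
  witness (no _) = []
  _≟ₛ_ : (x y : Σ A P) → Dec (x ≡ y)
  (a , p) ≟ₛ (b , q) = map′ (λ { refl → cong (a ,_) (irrelevant p q) }) (cong proj₁) (a ≟ b)
  term : ∀ {b} (q : P b) a (d : Dec (P a)) → ∑ (witness d) (λ y → 𝟙 (y ≟ₛ (b , q))) ≡ 𝟙 (a ≟ b)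
  term q a (yes p) = trans (+-identityʳ _) (𝟙-cong ((a , p) ≟ₛ (_ , q)) (a ≟ _) (cong proj₁) (λ { refl → cong (a ,_) (irrelevant p q) }))
  term {b} q a (no ¬p) = sym (𝟙-no (a ≟ b) (λ { refl → ¬p q }))
  one : ∀ z → ∑ (concatMap (λ a → witness (P? a)) (elems F)) (λ y → 𝟙 (y ≟ₛ z)) ≡ 1
  one (b , q) = trans (∑-concatMap _ (elems F) _) (trans (∑-cong (elems F) (λ a → term q a (P? a))) (once F b))

module Letters (h : ℕ) where

  Letter : Set
  Letter = Σ (Vec (Fin 2) (h + h)) (PhiBal h)

  letters : Finite Letter
  letters = subtype (vecs (fins 2) (h + h)) (λ v → countOnes v ≟ℕ h) ≡-irrelevant

  bit : Letter → Fin (h + h) → Fin 2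
  bit (v , _) i = lookup v i

  letter-ext : ∀ {x y : Letter} → proj₁ x ≡ proj₁ y → x ≡ y
  letter-ext {v , p} {.v , q} refl = cong (v ,_) (≡-irrelevant p q)

  swapLetter : Fin (h + h) → Fin (h + h) → Letter → Letter
  swapLetter a b (v , p) = swap a b v , trans (countOnes-swap a b v) p

  swapLetter-involutive : ∀ a b x → swapLetter a b (swapLetter a b x) ≡ x
  swapLetter-involutive a b (v , p) = letter-ext (swap-involutive a b v)

  flipLetter : Letter → Letter
  flipLetter (v , p) = Vec.map flip v , +-cancelʳ-≡ h _ h (trans (cong (countOnes (Vec.map flip v) +_) (sym p)) (countOnes-flip v))

  flipLetter-involutive : ∀ x → flipLetter (flipLetter x) ≡ x
  flipLetter-involutive (v , p) = letter-ext (trans (sym (Vec.map-∘ flip flip v)) (trans (Vec.map-cong flip-involutive v) (Vec.map-id v)))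

  #bit : Fin (h + h) → Fin 2 → ℕ
  #bit i c = # letters (λ y → bit y i Fin.≟ c)

  -- Complementation keeps a letter balanced and exchanges the two values at row i.
  card-letters : ∀ i c → card letters ≡ 2 * #bit i c
  card-letters i c = begin
    card letters
      ≡⟨ card-∑ letters ⟩
    ∑ᶠ letters (λ _ → 1)
      ≡⟨ ∑-cong (elems letters) (λ y → split (bit y i) c) ⟩
    ∑ᶠ letters (λ y → 𝟙 (bit y i Fin.≟ c) + 𝟙 (flip (bit y i) Fin.≟ c))
      ≡⟨ ∑-+ (elems letters) _ _ ⟩
    #bit i c + ∑ᶠ letters (λ y → 𝟙 (flip (bit y i) Fin.≟ c))
      ≡⟨ cong (#bit i c +_) (∑-cong (elems letters) (λ y → cong (λ t → 𝟙 (t Fin.≟ c)) (sym (Vec.lookup-map i flip (proj₁ y))))) ⟩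
    #bit i c + ∑ᶠ letters (λ y → 𝟙 (bit (flipLetter y) i Fin.≟ c))
      ≡⟨ cong (#bit i c +_) (∑-involution letters flipLetter flipLetter-involutive (λ y → 𝟙 (bit y i Fin.≟ c))) ⟩
    #bit i c + #bit i c
      ≡⟨ cong (#bit i c +_) (sym (+-identityʳ _)) ⟩
    2 * #bit i c ∎
    where
    open ≡-Reasoning
    split : ∀ b c → 1 ≡ 𝟙 (b Fin.≟ c) + 𝟙 (flip b Fin.≟ c)
    split zero zero = refl
    split zero (suc zero) = refl
    split (suc zero) zero = refl
    split (suc zero) (suc zero) = refl

-- Vectors over a finite abelian group

vec-isAbelianGroup : {_⊕_ : A → A → A} {𝟘 : A} {⊖_ : A → A} → IsAbelianGroup _≡_ _⊕_ 𝟘 ⊖_ → ∀ n →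
  IsAbelianGroup _≡_ (Vec.zipWith {n = n} _⊕_) (Vec.replicate n 𝟘) (Vec.map ⊖_)
vec-isAbelianGroup {_⊕_ = _⊕_} {𝟘} {⊖_} ab n = record
  { isGroup = record
    { isMonoid = record
      { isSemigroup = record
        { isMagma = record { isEquivalence = isEquivalence ; ∙-cong = cong₂ _ }
        ; assoc = Vec.zipWith-assoc assoc }
      ; identity = Vec.zipWith-identityˡ identityˡ , Vec.zipWith-identityʳ identityʳ }
    ; inverse = Vec.zipWith-inverseˡ inverseˡ , Vec.zipWith-inverseʳ inverseʳ
    ; ⁻¹-cong = cong _ }
  ; comm = Vec.zipWith-comm comm }
  where open IsAbelianGroup ab using (assoc; comm; identityˡ; identityʳ; inverseˡ; inverseʳ)

-- Subgroups invariant under row permutations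

-- `Z` stands for ℤ/N: `half` expresses that N is odd, and the nonzero element `one` serves to
-- detect that two letters differ in a row.
module RowSpace {Z : Set} (FZ : Finite Z) {_⊕_ : Z → Z → Z} {𝟘 : Z} {⊖_ : Z → Z}
  (isAbelianGroup : IsAbelianGroup _≡_ _⊕_ 𝟘 ⊖_)
  (half : Z → Z) (half-double : ∀ z → half z ⊕ half z ≡ z) (one : Z) (one≢𝟘 : one ≢ 𝟘) (h : ℕ) where

  open Letters h
  private
    k = h + h
    module Z = IsAbelianGroup isAbelianGroup
    open AbelianGroupProperties (bundle isAbelianGroup) using () renaming (⁻¹-∙-comm to ⊖-⊕; ⁻¹-involutive to ⊖-involutive; ε⁻¹≈ε to ⊖𝟘)

  G : Set
  G = Vec Z k

  vectors : Finite G
  vectors = vecs FZ k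

  _⊞_ : G → G → G
  _⊞_ = Vec.zipWith _⊕_
  𝟎 : G
  𝟎 = Vec.replicate k 𝟘
  ⊟_ : G → G
  ⊟_ = Vec.map ⊖_

  group-isAbelianGroup : IsAbelianGroup _≡_ _⊞_ 𝟎 ⊟_
  group-isAbelianGroup = vec-isAbelianGroup isAbelianGroup k

  private
    module G = IsAbelianGroup group-isAbelianGroup
    module GP = AbelianGroupProperties (bundle group-isAbelianGroup)

  lookup-⊞ : ∀ a b i → lookup (a ⊞ b) i ≡ lookup a i ⊕ lookup b i
  lookup-⊞ a b i = Vec.lookup-zipWith _⊕_ i a b

  lookup-⊟ : ∀ a i → lookup (⊟ a) i ≡ ⊖ lookup a i
  lookup-⊟ a i = Vec.lookup-map i ⊖_ a

  lookup-𝟎 : ∀ i → lookup 𝟎 i ≡ 𝟘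
  lookup-𝟎 i = Vec.lookup-replicate i 𝟘

  -- A letter is read as a 0/1 vector, with `zero : Fin 2` counting as 1. A column scaled by z thus
  -- has entry sum h z, whichever the letter.
  act : Fin 2 → Z → Z
  act zero z = z
  act (suc _) z = 𝟘

  column : Letter → Z → G
  column x z = Vec.map (λ b → act b z) (proj₁ x)

  lookup-column : ∀ x z i → lookup (column x z) i ≡ act (bit x i) z
  lookup-column x z i = Vec.lookup-map i _ (proj₁ x)

  diff : Letter → Letter → Z → G
  diff x y z = column x z ⊞ (⊟ column y z)

  lookup-diff : ∀ x y z i → lookup (diff x y z) i ≡ act (bit x i) z ⊕ (⊖ act (bit y i) z)
  lookup-diff x y z i = trans (lookup-⊞ (column x z) (⊟ column y z) i)
    (cong₂ _⊕_ (lookup-column x z i) (trans (lookup-⊟ (column y z) i) (cong ⊖_ (lookup-column y z i))))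

  diff-sym : ∀ x y z → diff y x z ≡ ⊟ diff x y z
  diff-sym x y z = begin
    b ⊞ (⊟ a) ≡⟨ G.comm b (⊟ a) ⟩
    (⊟ a) ⊞ b ≡⟨ cong ((⊟ a) ⊞_) (GP.⁻¹-involutive b) ⟨
    (⊟ a) ⊞ (⊟ (⊟ b)) ≡⟨ GP.⁻¹-∙-comm a (⊟ b) ⟩
    ⊟ (a ⊞ (⊟ b)) ∎
    where
    open ≡-Reasoning
    a = column x z
    b = column y z

  diff-trans : ∀ x y w z → diff x w z ≡ diff x y z ⊞ diff y w z
  diff-trans x y w z = sym (begin
    (a ⊞ (⊟ b)) ⊞ (b ⊞ (⊟ c)) ≡⟨ G.assoc a (⊟ b) _ ⟩
    a ⊞ ((⊟ b) ⊞ (b ⊞ (⊟ c))) ≡⟨ cong (a ⊞_) (G.assoc (⊟ b) b (⊟ c)) ⟨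
    a ⊞ (((⊟ b) ⊞ b) ⊞ (⊟ c)) ≡⟨ cong (λ t → a ⊞ (t ⊞ (⊟ c))) (G.inverseˡ b) ⟩
    a ⊞ (𝟎 ⊞ (⊟ c)) ≡⟨ cong (a ⊞_) (G.identityˡ (⊟ c)) ⟩
    a ⊞ (⊟ c) ∎)
    where
    open ≡-Reasoning
    a = column x z
    b = column y z
    c = column w z

  open Semistability vectors group-isAbelianGroup letters FZ diff
    (λ x z → G.inverseʳ (column x z)) diff-sym diff-trans public

  module _ (i : Fin k) where

    vanishing : G → Bool
    vanishing g = ⌊ Finite._≟_ FZ (lookup g i) 𝟘 ⌋

    vanishing⁻ : ∀ g → T (vanishing g) → lookup g i ≡ 𝟘
    vanishing⁻ g = toWitness {a? = Finite._≟_ FZ (lookup g i) 𝟘}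

    vanishing⁺ : ∀ g → lookup g i ≡ 𝟘 → T (vanishing g)
    vanishing⁺ g = fromWitness {a? = Finite._≟_ FZ (lookup g i) 𝟘}

    vanishing-isSubgroup : IsSubgroup vanishing
    vanishing-isSubgroup = vanishing⁺ 𝟎 (lookup-𝟎 i)
      , (λ a b s t → vanishing⁺ (a ⊞ b) (trans (lookup-⊞ a b i) (trans (cong₂ _⊕_ (vanishing⁻ a s) (vanishing⁻ b t)) (Z.identityˡ 𝟘))))
      , λ a s → vanishing⁺ (⊟ a) (trans (lookup-⊟ a i) (trans (cong ⊖_ (vanishing⁻ a s)) ⊖𝟘))

    private
      distinguish : ∀ b c → act b one ⊕ (⊖ act c one) ≡ 𝟘 → b ≡ c
      distinguish zero zero _ = refl
      distinguish (suc zero) (suc zero) _ = refl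
      distinguish zero (suc zero) e = contradiction (trans (sym (trans (cong (one ⊕_) ⊖𝟘) (Z.identityʳ one))) e) one≢𝟘
      distinguish (suc zero) zero e = contradiction
        (trans (sym (⊖-involutive one)) (trans (cong ⊖_ (trans (sym (Z.identityˡ (⊖ one))) e)) ⊖𝟘)) one≢𝟘

    vanishing-bit : (p : G → Bool) → (∀ g → T (p g) → T (vanishing g)) → ∀ x y → (∀ z → T (p (diff x y z))) → bit x i ≡ bit y i
    vanishing-bit p p⊆ x y x~y = distinguish (bit x i) (bit y i)
      (trans (sym (lookup-diff x y one i)) (vanishing⁻ (diff x y one) (p⊆ _ (x~y one))))

    -- Letters congruent modulo `p` share their bit in row i, and exactly half of the letters have a
    -- given bit there.
    degrees-vanishing : (p : G → Bool) → (∀ g → T (p g) → T (vanishing g)) → ∀ {C′} → card letters ≡ 2 * C′ →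
      degrees p ≤ C′ ^ card letters
    degrees-vanishing p p⊆ {C′} card≡ = begin
      degrees p ≤⟨ ∏-mono (elems letters) (λ x → ∑-mono (elems letters) (λ y →
          𝟙-mono (forAll FZ (λ z → T? (p (diff x y z)))) (bit y i Fin.≟ bit x i) (λ e → sym (vanishing-bit p p⊆ x y e)))) ⟩
      ∏ᶠ letters (λ x → #bit i (bit x i)) ≡⟨ ∏-cong (elems letters) (λ x →
          *-cancelˡ-≡ _ C′ 2 (trans (sym (card-letters i (bit x i))) card≡)) ⟩
      ∏ᶠ letters (λ _ → C′) ≡⟨ ∏-const (elems letters) C′ ⟩
      C′ ^ card letters ∎
      where open ≤-Reasoning

    private
      rootEntry : ∀ {a b c : Fin k} → Z → Position a b c → Z
      rootEntry w (first _) = w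
      rootEntry w (second _ _) = ⊖ w
      rootEntry w (other _ _) = 𝟘

    -- The vector w (e_a - e_b).
    root : Fin k → Fin k → Z → G
    root a b w = tabulate (λ c → rootEntry w (position a b c))

    root₁ : ∀ a b w → lookup (root a b w) a ≡ w
    root₁ a b w = trans (Vec.lookup∘tabulate _ a) (lemma (position a b a))
      where
      lemma : (q : Position a b a) → rootEntry w q ≡ w
      lemma (first _) = refl
      lemma (second a≢a _) = contradiction refl a≢a
      lemma (other a≢a _) = contradiction refl a≢a

    root₂ : ∀ a b w → a ≢ b → lookup (root a b w) b ≡ ⊖ w
    root₂ a b w a≢b = trans (Vec.lookup∘tabulate _ b) (lemma (position a b b))
      where
      lemma : (q : Position a b b) → rootEntry w q ≡ ⊖ w
      lemma (first b≡a) = contradiction (sym b≡a) a≢b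
      lemma (second _ _) = refl
      lemma (other _ b≢b) = contradiction refl b≢b

    root₃ : ∀ a b w {c} → c ≢ a → c ≢ b → lookup (root a b w) c ≡ 𝟘
    root₃ a b w {c} c≢a c≢b = trans (Vec.lookup∘tabulate _ c) (lemma (position a b c))
      where
      lemma : (q : Position a b c) → rootEntry w q ≡ 𝟘
      lemma (first c≡a) = contradiction c≡a c≢a
      lemma (second _ c≡b) = contradiction c≡b c≢b
      lemma (other _ _) = refl

    module Invariant (p : G → Bool) (sp : IsSubgroup p) (p⊆ : ∀ g → T (p g) → T (vanishing g))
      (invariant : ∀ a b → a ≢ i → b ≢ i → ∀ g → T (p g) → T (p (swap a b g))) where

      private
        p0 = proj₁ sp
        p+ = proj₁ (proj₂ sp)
        p- = proj₂ (proj₂ sp)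

      module _ (x y : Letter) (x≢y : x ≢ y) (x~y : ∀ z → T (p (diff x y z))) where
        private
          weights : countOnes (proj₁ x) ≡ countOnes (proj₁ y)
          weights = trans (proj₂ x) (sym (proj₂ y))
          forth = discrepancy (proj₁ x) (proj₁ y) weights (x≢y ∘ letter-ext)
          back = discrepancy (proj₁ y) (proj₁ x) (sym weights) (x≢y ∘ sym ∘ letter-ext)
          a b : Fin k
          a = proj₁ forth
          b = proj₁ back
          xa : bit x a ≡ zero
          xa = proj₁ (proj₂ forth)
          ya : bit y a ≡ suc zero
          ya = proj₂ (proj₂ forth)
          yb : bit y b ≡ zero
          yb = proj₁ (proj₂ back)
          xb : bit x b ≡ suc zero
          xb = proj₂ (proj₂ back)

          0≢1 : ¬ (_≡_ {A = Fin 2} zero (suc zero))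
          0≢1 ()

          a≢i : a ≢ i
          a≢i e = 0≢1 (trans (sym xa) (trans (trans (cong (bit x) e) (trans (vanishing-bit p p⊆ x y x~y) (cong (bit y) (sym e)))) ya))

          b≢i : b ≢ i
          b≢i e = 0≢1 (trans (sym yb) (trans (trans (cong (bit y) e) (trans (sym (vanishing-bit p p⊆ x y x~y)) (cong (bit x) (sym e)))) xb))

          a≢b : a ≢ b
          a≢b e = 0≢1 (trans (sym xa) (trans (cong (bit x) e) xb))

          diff-a : ∀ z → lookup (diff x y z) a ≡ z
          diff-a z = trans (lookup-diff x y z a) (trans (cong₂ (λ s t → act s z ⊕ (⊖ act t z)) xa ya)
            (trans (cong (z ⊕_) ⊖𝟘) (Z.identityʳ z)))

          diff-b : ∀ z → lookup (diff x y z) b ≡ ⊖ z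
          diff-b z = trans (lookup-diff x y z b) (trans (cong₂ (λ s t → act s z ⊕ (⊖ act t z)) xb yb) (Z.identityˡ (⊖ z)))

          -- The difference d has entries z at a and -z at b, so subtracting its image under the
          -- transposition of a and b cancels all other entries and leaves 2z (e_a - e_b). Taking z
          -- = w/2 uses that N is odd.
          root-ab : ∀ w → T (p (root a b w))
          root-ab w = subst (T ∘ p) (vec-ext entries) (p+ d _ (x~y z) (p- _ (invariant a b a≢i b≢i d (x~y z))))
            where
            z = half w
            d = diff x y z
            entry : ∀ c → lookup (d ⊞ (⊟ swap a b d)) c ≡ lookup d c ⊕ (⊖ lookup d (transpose a b c))
            entry c = trans (lookup-⊞ d _ c) (cong (lookup d c ⊕_) (trans (lookup-⊟ (swap a b d) c) (cong ⊖_ (lookup-swap a b d c))))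
            entries : ∀ c → lookup (d ⊞ (⊟ swap a b d)) c ≡ lookup (root a b w) c
            entries c with position a b c
            ... | first refl = begin
              lookup (d ⊞ (⊟ swap a b d)) a ≡⟨ entry a ⟩
              lookup d a ⊕ (⊖ lookup d (transpose a b a)) ≡⟨ cong₂ (λ s t → s ⊕ (⊖ lookup d t)) (diff-a z) (transpose-at₁ a b) ⟩
              z ⊕ (⊖ lookup d b) ≡⟨ cong (λ t → z ⊕ (⊖ t)) (diff-b z) ⟩
              z ⊕ (⊖ (⊖ z)) ≡⟨ cong (z ⊕_) (⊖-involutive z) ⟩
              z ⊕ z ≡⟨ half-double w ⟩
              w ≡⟨ root₁ a b w ⟨
              lookup (root a b w) a ∎
              where open ≡-Reasoning
            ... | second _ refl = begin
              lookup (d ⊞ (⊟ swap a b d)) b ≡⟨ entry b ⟩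
              lookup d b ⊕ (⊖ lookup d (transpose a b b)) ≡⟨ cong₂ (λ s t → s ⊕ (⊖ lookup d t)) (diff-b z) (transpose-at₂ a b) ⟩
              (⊖ z) ⊕ (⊖ lookup d a) ≡⟨ cong (λ t → (⊖ z) ⊕ (⊖ t)) (diff-a z) ⟩
              (⊖ z) ⊕ (⊖ z) ≡⟨ ⊖-⊕ z z ⟩
              ⊖ (z ⊕ z) ≡⟨ cong ⊖_ (half-double w) ⟩
              ⊖ w ≡⟨ root₂ a b w a≢b ⟨
              lookup (root a b w) b ∎
              where open ≡-Reasoning
            ... | other c≢a c≢b = begin
              lookup (d ⊞ (⊟ swap a b d)) c ≡⟨ entry c ⟩
              lookup d c ⊕ (⊖ lookup d (transpose a b c)) ≡⟨ cong (λ t → lookup d c ⊕ (⊖ lookup d t)) (transpose-elsewhere a b c≢a c≢b) ⟩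
              lookup d c ⊕ (⊖ lookup d c) ≡⟨ Z.inverseʳ _ ⟩
              𝟘 ≡⟨ root₃ a b w c≢a c≢b ⟨
              lookup (root a b w) c ∎
              where open ≡-Reasoning

          -- Invariance under the transposition of a and c moves the first index of the root from a
          -- to c.
          root-cb : ∀ c → c ≢ i → c ≢ b → ∀ w → T (p (root c b w))
          root-cb c c≢i c≢b w with c Fin.≟ a
          ... | yes refl = root-ab w
          ... | no c≢a = subst (T ∘ p) (vec-ext entries) (invariant a c a≢i c≢i _ (root-ab w))
            where
            entries : ∀ e → lookup (swap a c (root a b w)) e ≡ lookup (root c b w) e
            entries e = trans (lookup-swap a c (root a b w) e) (lemma (position a c e))
              where
              lemma : Position a c e → lookup (root a b w) (transpose a c e) ≡ lookup (root c b w) e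
              lemma (first refl) = trans (cong (lookup (root a b w)) (transpose-at₁ a c))
                (trans (root₃ a b w c≢a c≢b) (sym (root₃ c b w (c≢a ∘ sym) a≢b)))
              lemma (second _ refl) = trans (cong (lookup (root a b w)) (transpose-at₂ a c)) (trans (root₁ a b w) (sym (root₁ c b w)))
              lemma (other e≢a e≢c) with e Fin.≟ b
              ... | yes refl = trans (cong (lookup (root a b w)) (transpose-elsewhere a c e≢a e≢c))
                    (trans (root₂ a b w a≢b) (sym (root₂ c b w c≢b)))
              ... | no e≢b = trans (cong (lookup (root a b w)) (transpose-elsewhere a c e≢a e≢c))
                    (trans (root₃ a b w e≢a e≢b) (sym (root₃ c b w e≢c e≢b)))

          -- Each coordinate c other than b is corrected by a root at (c, b), and the error
          -- accumulates at b alone. `cs` lists the coordinates where `g` may still be nonzero.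
          complete-at-b : (cs : List (Fin k)) (g : G) → lookup g i ≡ 𝟘 → (∀ c → c ≢ b → ¬ (c ∈ cs) → lookup g c ≡ 𝟘) →
            ∃ λ g′ → T (p g′) × (∀ c → c ≢ b → lookup g′ c ≡ lookup g c)
          complete-at-b [] g gi supp = 𝟎 , p0 , λ c c≢b → trans (lookup-𝟎 c) (sym (supp c c≢b (λ ())))
          complete-at-b (c ∷ cs) g gi supp with c Fin.≟ b | c Fin.≟ i
          ... | yes refl | _ = complete-at-b cs g gi (λ d d≢b d∉ → supp d d≢b (λ { (here e) → d≢b e ; (there j) → d∉ j }))
          ... | no _ | yes refl = complete-at-b cs g gi (λ d d≢b d∉ → dec d d≢b d∉ (d Fin.≟ c))
            where
            dec : ∀ d → d ≢ b → ¬ (d ∈ cs) → Dec (d ≡ c) → lookup g d ≡ 𝟘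
            dec d d≢b d∉ (yes refl) = gi
            dec d d≢b d∉ (no d≢c) = supp d d≢b (λ { (here e) → d≢c e ; (there j) → d∉ j })
          ... | no c≢b | no c≢i with complete-at-b cs (g Vec.[ c ]≔ 𝟘) (trans (Vec.lookup∘update′ (c≢i ∘ sym) g 𝟘) gi)
              (λ d d≢b d∉ → dec d d≢b d∉ (d Fin.≟ c))
            where
            dec : ∀ d → d ≢ b → ¬ (d ∈ cs) → Dec (d ≡ c) → lookup (g Vec.[ c ]≔ 𝟘) d ≡ 𝟘
            dec d d≢b d∉ (yes refl) = Vec.lookup∘update c g 𝟘
            dec d d≢b d∉ (no d≢c) = trans (Vec.lookup∘update′ d≢c g 𝟘) (supp d d≢b (λ { (here e) → d≢c e ; (there j) → d∉ j }))
          ... | g′ , pg′ , agree = g′ ⊞ root c b w , p+ _ _ pg′ (root-cb c c≢i c≢b w) ,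
                λ d d≢b → trans (lookup-⊞ g′ _ d) (trans (cong (_⊕ lookup (root c b w) d) (agree d d≢b)) (entry d d≢b (d Fin.≟ c)))
            where
            w = lookup g c
            entry : ∀ d → d ≢ b → Dec (d ≡ c) → lookup (g Vec.[ c ]≔ 𝟘) d ⊕ lookup (root c b w) d ≡ lookup g d
            entry d d≢b (yes refl) = trans (cong₂ _⊕_ (Vec.lookup∘update c g 𝟘) (root₁ c b w)) (Z.identityˡ w)
            entry d d≢b (no d≢c) = trans (cong₂ _⊕_ (Vec.lookup∘update′ d≢c g 𝟘) (root₃ c b w d≢c d≢b)) (Z.identityʳ _)

          lift : (g : G) → ∃ λ g′ → T (p g′) × (∀ c → c ≢ b → lookup g′ c ≡ lookup (g Vec.[ i ]≔ 𝟘) c)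
          lift g = complete-at-b (finElems k) (g Vec.[ i ]≔ 𝟘) (Vec.lookup∘update i g 𝟘)
            (λ c _ c∉ → contradiction (complete (fins k) c) c∉)

          -- A vector is determined by its lift to `p` and its entries in the two rows i and b which
          -- the lift does not control. Hence `p` has at least N^(k-2) elements.
          encode : G → G × Z × Z
          encode g = proj₁ (lift g) , lookup g i , lookup g b

          encode-injective : ∀ g g′ → ⊤ → ⊤ → encode g ≡ encode g′ → g ≡ g′
          encode-injective g g′ _ _ e = vec-ext entries
            where
            entries : ∀ c → lookup g c ≡ lookup g′ c
            entries c with position i b c
            ... | first refl = cong (proj₁ ∘ proj₂) e
            ... | second _ refl = cong (proj₂ ∘ proj₂) e
            ... | other c≢i c≢b = begin
              lookup g c ≡⟨ Vec.lookup∘update′ c≢i g 𝟘 ⟨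
              lookup (g Vec.[ i ]≔ 𝟘) c ≡⟨ proj₂ (proj₂ (lift g)) c c≢b ⟨
              lookup (proj₁ (lift g)) c ≡⟨ cong (λ t → lookup (proj₁ t) c) e ⟩
              lookup (proj₁ (lift g′)) c ≡⟨ proj₂ (proj₂ (lift g′)) c c≢b ⟩
              lookup (g′ Vec.[ i ]≔ 𝟘) c ≡⟨ Vec.lookup∘update′ c≢i g′ 𝟘 ⟩
              lookup g′ c ∎
              where open ≡-Reasoning

        size-large : card FZ ^ k ≤ size p * (card FZ * card FZ)
        size-large = begin
          card FZ ^ k ≡⟨ card-vec FZ k ⟨
          card vectors ≡⟨ #-all vectors ⟨
          # vectors (λ _ → yes tt) ≤⟨ #-injection vectors triples (λ _ → yes tt) (λ (g , z) → T? (p g) ×-dec (yes tt ×-dec yes tt)) encode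
              (λ g _ → proj₁ (proj₂ (lift g)) , tt , tt) encode-injective ⟩
          # triples (λ (g , z) → T? (p g) ×-dec (yes tt ×-dec yes tt))
              ≡⟨ #-pair vectors (pairs FZ FZ) (λ g → T? (p g)) (λ _ → yes tt ×-dec yes tt) ⟩
          size p * # (pairs FZ FZ) (λ _ → yes tt ×-dec yes tt)
              ≡⟨ cong (size p *_) (trans (#-pair FZ FZ (λ _ → yes tt) (λ _ → yes tt)) (cong₂ _*_ (#-all FZ) (#-all FZ))) ⟩
          size p * (card FZ * card FZ) ∎
          where
          open ≤-Reasoning
          triples = pairs vectors (pairs FZ FZ)
          #-all : {A : Set} (F : Finite A) → # F (λ _ → yes tt) ≡ card F
          #-all F = sym (card-∑ F)

    module _ (m r C′ k′ : ℕ) (card≡ : card letters ≡ 2 * C′) (k≡ : k ≡ 2 + k′)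
      (bound : (C′ ^ card letters) ^ m ≤ (card FZ ^ k′) ^ r) where
      private
        Rows : Set
        Rows = Σ (Fin k × Fin k) (λ (a , b) → a ≢ i × b ≢ i)

        swap-⊞ : ∀ a b u v → swap a b (u ⊞ v) ≡ swap a b u ⊞ swap a b v
        swap-⊞ a b u v = vec-ext (λ c → trans (lookup-swap a b (u ⊞ v) c) (trans (lookup-⊞ u v _)
          (sym (trans (lookup-⊞ (swap a b u) (swap a b v) c) (cong₂ _⊕_ (lookup-swap a b u c) (lookup-swap a b v c))))))

        swap-⊟ : ∀ a b u → swap a b (⊟ u) ≡ ⊟ swap a b u
        swap-⊟ a b u = vec-ext (λ c → trans (lookup-swap a b (⊟ u) c) (trans (lookup-⊟ u _)
          (sym (trans (lookup-⊟ (swap a b u) c) (cong ⊖_ (lookup-swap a b u c))))))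

        swap-column : ∀ a b x z → swap a b (column x z) ≡ column (swapLetter a b x) z
        swap-column a b x z = vec-ext (λ c → trans (lookup-swap a b (column x z) c) (trans (lookup-column x z _)
          (sym (trans (lookup-column (swapLetter a b x) z c) (cong (λ t → act t z) (lookup-swap a b (proj₁ x) c))))))

        -- If `p` identifies no two letters, all degrees are 1. Otherwise `p` has at least N^(k-2)
        -- elements while its classes contain at most half of the letters, and `bound` is the
        -- required inequality in that case.
        invariant-case : ∀ p → IsSubgroup p → (∀ g → T (p g) → T (vanishing g)) →
          (∀ (ι : Rows) g → T (p g) → T (p (swap (proj₁ (proj₁ ι)) (proj₂ (proj₁ ι)) g))) → degrees p ^ m ≤ size p ^ r
        invariant-case p sp p⊆ inv with search letters (λ x → search letters (λ y →
            ¬? (Finite._≟_ letters x y) ×-dec forAll FZ (λ z → T? (p (diff x y z)))))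
        ... | no none = begin
          degrees p ^ m ≤⟨ ^-monoˡ-≤ m (∏-mono (elems letters) (λ x → begin
            degree p x ≤⟨ ∑-mono (elems letters) (λ y → 𝟙-mono (forAll FZ (λ z → T? (p (diff x y z)))) (Finite._≟_ letters y x) (trivial x y)) ⟩
            # letters (λ y → Finite._≟_ letters y x) ≡⟨ once letters x ⟩
            1 ∎)) ⟩
          ∏ᶠ letters (λ _ → 1) ^ m ≡⟨ cong (_^ m) (trans (∏-const (elems letters) 1) (^-zeroˡ (card letters))) ⟩
          1 ^ m ≡⟨ ^-zeroˡ m ⟩
          1 ≤⟨ 1≤^ r (size>0 {p} sp) ⟩
          size p ^ r ∎
          where
          open ≤-Reasoning
          trivial : ∀ x y → (∀ z → T (p (diff x y z))) → y ≡ x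
          trivial x y x~y with Finite._≟_ letters x y
          ... | yes e = sym e
          ... | no x≢y = contradiction (x , y , x≢y , x~y) none
        ... | yes (x , y , x≢y , x~y) = begin
          degrees p ^ m ≤⟨ ^-monoˡ-≤ m (degrees-vanishing p p⊆ card≡) ⟩
          (C′ ^ card letters) ^ m ≤⟨ bound ⟩
          (card FZ ^ k′) ^ r ≤⟨ ^-monoˡ-≤ r (*-cancelʳ-≤⁺ (card FZ * card FZ) (*-mono-≤ N>0 N>0) (begin
            card FZ ^ k′ * (card FZ * card FZ) ≡⟨ shuffle (card FZ ^ k′) (card FZ) ⟩
            card FZ ^ (2 + k′) ≡⟨ cong (card FZ ^_) k≡ ⟨
            card FZ ^ k ≤⟨ Invariant.size-large p sp p⊆ (λ a b a≢i b≢i → inv ((a , b) , a≢i , b≢i)) x y x≢y x~y ⟩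
            size p * (card FZ * card FZ) ∎)) ⟩
          size p ^ r ∎
          where
          open ≤-Reasoning
          N>0 : 1 ≤ card FZ
          N>0 = ≤-trans (∑-term (elems FZ) (λ _ → 1) (complete FZ one)) (≤-reflexive (sym (card-∑ FZ)))
          shuffle : ∀ a b → a * (b * b) ≡ b * (b * a)
          shuffle = solve-∀

      row-semistable : ∀ p → IsSubgroup p → (∀ g → T (p g) → T (vanishing g)) → degrees p ^ m ≤ size p ^ r
      row-semistable = semistable vanishing-isSubgroup m r {I = Rows}
        (λ ((a , b) , _) → swap a b) (λ ((a , b) , _) → swapLetter a b)
        (λ ((a , b) , _) → swap-involutive a b) (λ ((a , b) , _) → swapLetter-involutive a b)
        (λ ((a , b) , _) → vec-ext (λ c → trans (lookup-swap a b 𝟎 c) (trans (lookup-𝟎 _) (sym (lookup-𝟎 c)))))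
        (λ ((a , b) , _) → swap-⊞ a b) (λ ((a , b) , _) → swap-⊟ a b)
        (λ ((a , b) , _) x y z → trans (swap-⊞ a b (column x z) (⊟ column y z))
           (cong₂ _⊞_ (swap-column a b x z) (trans (swap-⊟ a b (column y z)) (cong ⊟_ (swap-column a b y z)))))
        (λ ((a , b) , a≢i , b≢i) g t → vanishing⁺ (swap a b g) (trans (lookup-swap a b g i)
           (trans (cong (lookup g) (transpose-elsewhere a b (a≢i ∘ sym) (b≢i ∘ sym))) (vanishing⁻ g t))))
        invariant-case

-- Words with prescribed letter frequencies

module Words {X : Set} (FX : Finite X) where
  open Finite FX using (_≟_)

  words : ∀ n → Finite (Vec X n)
  words = vecs FX

  occ : ∀ {n} → X → Vec X n → ℕ
  occ y [] = 0
  occ y (x ∷ w) = 𝟙 (y ≟ x) + occ y w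

  HasType : ∀ {n} → (X → ℕ) → Vec X n → Set
  HasType t w = ∀ x → occ x w ≡ t x

  hasType? : ∀ {n} (t : X → ℕ) (w : Vec X n) → Dec (HasType t w)
  hasType? t w = forAll FX (λ x → occ x w ≟ℕ t x)

  private
    decrease : (X → ℕ) → X → X → ℕ
    decrease t x y = t y ∸ 𝟙 (y ≟ x)

    𝟙≤t : (t : X → ℕ) (x : X) → 1 ≤ t x → ∀ y → 𝟙 (y ≟ x) ≤ t y
    𝟙≤t t x tx y with y ≟ x
    ... | yes refl = tx
    ... | no _ = z≤n

    decrease-+ : (t : X → ℕ) (x : X) → 1 ≤ t x → ∀ y → 𝟙 (y ≟ x) + decrease t x y ≡ t y
    decrease-+ t x tx y = m+[n∸m]≡n (𝟙≤t t x tx y)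

    decrease-∑ : (t : X → ℕ) (x : X) → 1 ≤ t x → 1 + ∑ᶠ FX (decrease t x) ≡ ∑ᶠ FX t
    decrease-∑ t x tx = trans (cong (_+ ∑ᶠ FX (decrease t x)) (sym (once FX x)))
      (trans (sym (∑-+ (elems FX) _ _)) (∑-cong (elems FX) (decrease-+ t x tx)))

    decrease-∏ : (t : X → ℕ) (x : X) → 1 ≤ t x → ∏ᶠ FX (λ y → t y !) ≡ t x * ∏ᶠ FX (λ y → decrease t x y !)
    decrease-∏ t x tx = begin
      ∏ᶠ FX (λ y → t y !)
        ≡⟨ ∏-cong (elems FX) step ⟩
      ∏ᶠ FX (λ y → t y ^ 𝟙 (y ≟ x) * decrease t x y !)
        ≡⟨ ∏-* (elems FX) _ _ ⟩
      ∏ᶠ FX (λ y → t y ^ 𝟙 (y ≟ x)) * ∏ᶠ FX (λ y → decrease t x y !)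
        ≡⟨ cong (_* ∏ᶠ FX (λ y → decrease t x y !)) (∏-pick FX x t) ⟩
      t x * ∏ᶠ FX (λ y → decrease t x y !) ∎
      where
      open ≡-Reasoning
      factorial : ∀ n → 1 ≤ n → n ! ≡ n ^ 1 * (n ∸ 1) !
      factorial (suc n) _ = cong (_* n !) (sym (^-identityʳ (suc n)))
      step : ∀ y → t y ! ≡ t y ^ 𝟙 (y ≟ x) * decrease t x y !
      step y with y ≟ x
      ... | yes refl = factorial (t y) tx
      ... | no _ = sym (+-identityʳ _)

  -- The multinomial coefficient with denominators cleared. Removing a first letter x lowers `t x`
  -- by one and divides the product of factorials by `t x`.
  words-of-type : ∀ n t → ∑ᶠ FX t ≡ n → # (words n) (hasType? t) * ∏ᶠ FX (λ x → t x !) ≡ n !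
  words-of-type zero t eq = begin
    (𝟙 (hasType? t []) + 0) * ∏ᶠ FX (λ x → t x !) ≡⟨ cong₂ _*_ (cong (_+ 0) (𝟙-yes (hasType? t []) (λ x → sym (t≡0 x))))
        (∏-cong (elems FX) (λ x → cong _! (t≡0 x))) ⟩
    1 * ∏ᶠ FX (λ x → 1) ≡⟨ *-identityˡ _ ⟩
    ∏ᶠ FX (λ x → 1) ≡⟨ ∏-const (elems FX) 1 ⟩
    1 ^ card FX ≡⟨ ^-zeroˡ (card FX) ⟩
    1 ∎
    where
    open ≡-Reasoning
    t≡0 : ∀ x → t x ≡ 0
    t≡0 x = n≤0⇒n≡0 (≤-trans (∑-term (elems FX) t (complete FX x)) (≤-reflexive eq))
  words-of-type (suc n) t eq = begin
    # (words (suc n)) (hasType? t) * Π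
      ≡⟨ cong (_* Π) (∑-vec FX n _) ⟩
    ∑ᶠ FX (λ x → # (words n) (λ w → hasType? t (x ∷ w))) * Π
      ≡⟨ ∑-*ʳ (elems FX) Π _ ⟨
    ∑ᶠ FX (λ x → # (words n) (λ w → hasType? t (x ∷ w)) * Π)
      ≡⟨ ∑-cong (elems FX) byFirst ⟩
    ∑ᶠ FX (λ x → t x * n !)
      ≡⟨ ∑-*ʳ (elems FX) (n !) t ⟩
    ∑ᶠ FX t * n !
      ≡⟨ cong (_* n !) eq ⟩
    suc n ! ∎
    where
    open ≡-Reasoning
    Π = ∏ᶠ FX (λ x → t x !)
    positive : ∀ x → Dec (1 ≤ t x) → # (words n) (λ w → hasType? t (x ∷ w)) * Π ≡ t x * n !
    positive x (no t≱1) = begin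
      # (words n) (λ w → hasType? t (x ∷ w)) * Π ≡⟨ cong (_* Π) (∑-zero (elems (words n)) (λ w → 𝟙-no (hasType? t (x ∷ w)) (absurd w))) ⟩
      0 ≡⟨ cong (_* n !) (n<1⇒n≡0 (≰⇒> t≱1)) ⟨
      t x * n ! ∎
      where
      absurd : ∀ w → ¬ HasType t (x ∷ w)
      absurd w ht = t≱1 (≤-trans (≤-reflexive (sym (𝟙-yes (x ≟ x) refl))) (≤-trans (m≤m+n _ (occ x w)) (≤-reflexive (ht x))))
    positive x (yes tx) = begin
      # (words n) (λ w → hasType? t (x ∷ w)) * Π
        ≡⟨ cong₂ _*_ (∑-cong (elems (words n)) (λ w → 𝟙-cong (hasType? t (x ∷ w)) (hasType? (decrease t x) w)
             (λ ht y → +-cancelˡ-≡ (𝟙 (y ≟ x)) _ _ (trans (ht y) (sym (decrease-+ t x tx y))))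
             (λ ht y → trans (cong (𝟙 (y ≟ x) +_) (ht y)) (decrease-+ t x tx y))))
           (decrease-∏ t x tx) ⟩
      # (words n) (hasType? (decrease t x)) * (t x * ∏ᶠ FX (λ y → decrease t x y !))
        ≡⟨ rotate (# (words n) (hasType? (decrease t x))) (t x) _ ⟩
      t x * (# (words n) (hasType? (decrease t x)) * ∏ᶠ FX (λ y → decrease t x y !))
        ≡⟨ cong (t x *_) (words-of-type n (decrease t x) (suc-injective (trans (decrease-∑ t x tx) eq))) ⟩
      t x * n ! ∎
      where
      rotate : ∀ a b c → a * (b * c) ≡ b * (a * c)
      rotate = solve-∀
    byFirst : ∀ x → # (words n) (λ w → hasType? t (x ∷ w)) * Π ≡ t x * n !
    byFirst x = positive x (1 ≤? t x)

  Uniform : ∀ {n} → ℕ → Vec X n → Set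
  Uniform m = HasType (λ _ → m)

  uniform? : ∀ {n} m (w : Vec X n) → Dec (Uniform m w)
  uniform? m = hasType? (λ _ → m)

  wordProduct : ∀ {n} → (X → ℕ) → Vec X n → ℕ
  wordProduct g [] = 1
  wordProduct g (x ∷ w) = g x * wordProduct g w

  wordProduct-occ : ∀ {n} g (w : Vec X n) → wordProduct g w ≡ ∏ᶠ FX (λ x → g x ^ occ x w)
  wordProduct-occ g [] = sym (trans (∏-const (elems FX) 1) (^-zeroˡ (card FX)))
  wordProduct-occ g (x ∷ w) = begin
    g x * wordProduct g w
      ≡⟨ cong₂ _*_ (sym (∏-pick FX x g)) (wordProduct-occ g w) ⟩
    ∏ᶠ FX (λ y → g y ^ 𝟙 (y ≟ x)) * ∏ᶠ FX (λ y → g y ^ occ y w)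
      ≡⟨ ∏-* (elems FX) _ _ ⟨
    ∏ᶠ FX (λ y → g y ^ 𝟙 (y ≟ x) * g y ^ occ y w)
      ≡⟨ ∏-cong (elems FX) (λ y → ^-distribˡ-+-* (g y) (𝟙 (y ≟ x)) (occ y w)) ⟨
    ∏ᶠ FX (λ y → g y ^ occ y (x ∷ w)) ∎
    where open ≡-Reasoning

  wordProduct-uniform : ∀ {n m} g (w : Vec X n) → Uniform m w → wordProduct g w ≡ ∏ᶠ FX g ^ m
  wordProduct-uniform {m = m} g w u = trans (wordProduct-occ g w)
    (trans (∏-cong (elems FX) (λ x → cong (g x ^_) (u x))) (∏-^ (elems FX) g m))

  module _ {_~_ : X → X → Set} (_~?_ : ∀ x y → Dec (x ~ y)) where

    Related : ∀ {n} → Vec X n → Vec X n → Set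
    Related w w′ = ∀ j → lookup w j ~ lookup w′ j

    related? : ∀ {n} (w w′ : Vec X n) → Dec (Related w w′)
    related? {n} w w′ = forAll (fins n) (λ j → lookup w j ~? lookup w′ j)

    #-related : ∀ {n} (w : Vec X n) → # (words n) (related? w) ≡ wordProduct (λ x → # FX (x ~?_)) w
    #-related [] = refl
    #-related {suc n} (x ∷ w) = begin
      # (words (suc n)) (related? (x ∷ w))
        ≡⟨ ∑-vec FX n _ ⟩
      ∑ᶠ FX (λ y → # (words n) (λ w′ → related? (x ∷ w) (y ∷ w′)))
        ≡⟨ ∑-cong (elems FX) (λ y → trans (∑-cong (elems (words n)) (λ w′ →
             𝟙-× (x ~? y) (related? w w′) (related? (x ∷ w) (y ∷ w′)) (λ r → r zero , r ∘ suc)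
               (λ { p r zero → p ; p r (suc j) → r j })))
             (∑-*ˡ (elems (words n)) (𝟙 (x ~? y)) _)) ⟩
      ∑ᶠ FX (λ y → 𝟙 (x ~? y) * # (words n) (related? w))
        ≡⟨ ∑-*ʳ (elems FX) (# (words n) (related? w)) _ ⟩
      # FX (x ~?_) * # (words n) (related? w)
        ≡⟨ cong (# FX (x ~?_) *_) (#-related w) ⟩
      # FX (x ~?_) * wordProduct (λ x → # FX (x ~?_)) w ∎
      where open ≡-Reasoning

  private
    C = card FX

    [a+c]!≥ : ∀ a c → a ! * suc a ^ c ≤ (c + a) !
    [a+c]!≥ a zero = ≤-reflexive (*-identityʳ (a !))
    [a+c]!≥ a (suc c) = begin
      a ! * (suc a * suc a ^ c) ≡⟨ rotate (a !) (suc a) (suc a ^ c) ⟩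
      suc a * (a ! * suc a ^ c) ≤⟨ *-mono-≤ (s≤s (m≤n+m a c)) ([a+c]!≥ a c) ⟩
      suc (c + a) * (c + a) ! ∎
      where
      open ≤-Reasoning
      rotate : ∀ a b c → a * (b * c) ≡ b * (a * c)
      rotate = solve-∀

    -- A polynomially lossy substitute for Stirling's formula. Passing from m to m+1 multiplies the
    -- left side by ((m+1)C)^C, while the C new factors of the factorial absorb the old polynomial
    -- factor.
    stirling : ∀ m → C ^ (m * C) * (m !) ^ C ≤ (m * C) ! * suc (m * C) ^ C
    stirling zero = ≤-refl
    stirling (suc m) = begin
      C ^ (C + m * C) * (suc m * m !) ^ C
        ≡⟨ cong₂ _*_ (^-distribˡ-+-* C C (m * C)) (^-distribʳ-* C (suc m) (m !)) ⟩
      C ^ C * C ^ (m * C) * (suc m ^ C * (m !) ^ C)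
        ≡⟨ e₁ (C ^ C) (C ^ (m * C)) (suc m ^ C) ((m !) ^ C) ⟩
      suc m ^ C * C ^ C * (C ^ (m * C) * (m !) ^ C)
        ≡⟨ cong (_* (C ^ (m * C) * (m !) ^ C)) (^-distribʳ-* C (suc m) C) ⟨
      (suc m * C) ^ C * (C ^ (m * C) * (m !) ^ C)
        ≤⟨ *-mono-≤ (^-monoˡ-≤ C (n≤1+n (suc m * C))) (stirling m) ⟩
      suc (suc m * C) ^ C * ((m * C) ! * suc (m * C) ^ C)
        ≤⟨ *-monoʳ-≤ (suc (suc m * C) ^ C) ([a+c]!≥ (m * C) C) ⟩
      suc (suc m * C) ^ C * (suc m * C) !
        ≡⟨ *-comm (suc (suc m * C) ^ C) _ ⟩
      (suc m * C) ! * suc (suc m * C) ^ C ∎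
      where
      open ≤-Reasoning
      e₁ : ∀ a b c d → a * b * (c * d) ≡ c * a * (b * d)
      e₁ = solve-∀

  #-uniform : ∀ m → C ^ (m * C) ≤ # (words (m * C)) (uniform? m) * suc (m * C) ^ C
  #-uniform m = *-cancelʳ-≤⁺ ((m !) ^ C) (1≤^ C (1≤n! m)) (begin
    C ^ (m * C) * (m !) ^ C ≤⟨ stirling m ⟩
    (m * C) ! * suc (m * C) ^ C ≡⟨ cong (_* suc (m * C) ^ C) (words-of-type (m * C) (λ _ → m) (trans (∑-const (elems FX) m) (*-comm C m))) ⟨
    U * ∏ᶠ FX (λ _ → m !) * suc (m * C) ^ C ≡⟨ cong (λ t → U * t * suc (m * C) ^ C) (∏-const (elems FX) (m !)) ⟩
    U * (m !) ^ C * suc (m * C) ^ C ≡⟨ rotate U ((m !) ^ C) _ ⟩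
    U * suc (m * C) ^ C * (m !) ^ C ∎)
    where
    open ≤-Reasoning
    U = # (words (m * C)) (uniform? m)
    rotate : ∀ a b c → a * b * c ≡ a * c * b
    rotate = solve-∀

-- Random linear hashing

#-two : (F : Finite A) {P : A → Set} (P? : ∀ x → Dec (P x)) {a b : A} → a ≢ b → P a → P b → 2 ≤ # F P?
#-two F {P} P? {a} {b} a≢b pa pb = begin
  2 ≡⟨ cong₂ _+_ (once F a) (once F b) ⟨
  # F (λ x → x ≟ a) + # F (λ x → x ≟ b) ≡⟨ ∑-+ (elems F) _ _ ⟨
  ∑ᶠ F (λ x → 𝟙 (x ≟ a) + 𝟙 (x ≟ b)) ≤⟨ ∑-mono (elems F) step ⟩
  # F P? ∎
  where
  open ≤-Reasoning
  open Finite F using (_≟_)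
  step : ∀ x → 𝟙 (x ≟ a) + 𝟙 (x ≟ b) ≤ 𝟙 (P? x)
  step x with x ≟ a | x ≟ b
  ... | yes refl | yes refl = contradiction refl a≢b
  ... | yes refl | no _ = ≤-reflexive (sym (𝟙-yes (P? x) pa))
  ... | no _ | yes refl = ≤-reflexive (sym (𝟙-yes (P? x) pb))
  ... | no _ | no _ = z≤n

#-union : (xs : List A) {P : A → Set} (P? : ∀ x → Dec (P x)) → ∀ {x} → x ∈ xs → P x → 1 ≤ ∑ xs (λ x → 𝟙 (P? x))
#-union xs P? {x} i p = ≤-trans (≤-reflexive (sym (𝟙-yes (P? x) p))) (∑-term xs (λ x → 𝟙 (P? x)) i)

module Hashing {Z : Set} (FZ : Finite Z) {_⊕_ : Z → Z → Z} {𝟘 : Z} {⊖_ : Z → Z}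
  (isAbelianGroup : IsAbelianGroup _≡_ _⊕_ 𝟘 ⊖_)
  (half : Z → Z) (half-double : ∀ z → half z ⊕ half z ≡ z) (one : Z) (one≢𝟘 : one ≢ 𝟘) (h : ℕ) where

  open Letters h public
  open RowSpace FZ isAbelianGroup half half-double one one≢𝟘 h public
  open Words letters public
  private
    k = h + h
    N = card FZ
    module Z = IsAbelianGroup isAbelianGroup
    module G = IsAbelianGroup group-isAbelianGroup
    open AbelianGroupProperties (bundle isAbelianGroup) using () renaming (ε⁻¹≈ε to ⊖𝟘)
    module GP = AbelianGroupProperties (bundle group-isAbelianGroup)
    open CommutativeSemigroupProperties (AbelianGroup.commutativeSemigroup (bundle group-isAbelianGroup)) using (interchange)
    open Finite vectors using () renaming (_≟_ to _≟G_)

  functionals : ∀ n → Finite (Vec Z n)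
  functionals = vecs FZ

  -- Entry i is the functional with coefficients `ℓ` evaluated on row i: all rows are hashed by the
  -- same functional.
  hash : ∀ {n} → Vec Letter n → Vec Z n → G
  hash [] [] = 𝟎
  hash (x ∷ w) (z ∷ ℓ) = column x z ⊞ hash w ℓ

  private
    _⊕ᵥ_ : ∀ {n} → Vec Z n → Vec Z n → Vec Z n
    _⊕ᵥ_ = Vec.zipWith _⊕_

    act-⊕ : ∀ b z z′ → act b (z ⊕ z′) ≡ act b z ⊕ act b z′
    act-⊕ zero z z′ = refl
    act-⊕ (suc _) z z′ = sym (Z.identityˡ 𝟘)

    act-⊖ : ∀ b z → act b (⊖ z) ≡ ⊖ act b z
    act-⊖ zero z = refl
    act-⊖ (suc _) z = sym ⊖𝟘

    act-𝟘 : ∀ b → act b 𝟘 ≡ 𝟘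
    act-𝟘 zero = refl
    act-𝟘 (suc _) = refl

    column-⊕ : ∀ x z z′ → column x (z ⊕ z′) ≡ column x z ⊞ column x z′
    column-⊕ x z z′ = vec-ext (λ i → trans (lookup-column x (z ⊕ z′) i) (trans (act-⊕ (bit x i) z z′)
      (sym (trans (lookup-⊞ (column x z) (column x z′) i) (cong₂ _⊕_ (lookup-column x z i) (lookup-column x z′ i))))))

    column-⊖ : ∀ x z → column x (⊖ z) ≡ ⊟ column x z
    column-⊖ x z = vec-ext (λ i → trans (lookup-column x (⊖ z) i) (trans (act-⊖ (bit x i) z)
      (sym (trans (lookup-⊟ (column x z) i) (cong ⊖_ (lookup-column x z i))))))

    column-𝟘 : ∀ x → column x 𝟘 ≡ 𝟎
    column-𝟘 x = vec-ext (λ i → trans (lookup-column x 𝟘 i) (trans (act-𝟘 (bit x i)) (sym (lookup-𝟎 i))))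

    hash-⊕ : ∀ {n} (w : Vec Letter n) ℓ ℓ′ → hash w (ℓ ⊕ᵥ ℓ′) ≡ hash w ℓ ⊞ hash w ℓ′
    hash-⊕ [] [] [] = sym (G.identityˡ 𝟎)
    hash-⊕ (x ∷ w) (z ∷ ℓ) (z′ ∷ ℓ′) = trans (cong₂ _⊞_ (column-⊕ x z z′) (hash-⊕ w ℓ ℓ′))
      (interchange (column x z) (column x z′) (hash w ℓ) (hash w ℓ′))

    hash-⊖ : ∀ {n} (w : Vec Letter n) ℓ → hash w (Vec.map ⊖_ ℓ) ≡ ⊟ hash w ℓ
    hash-⊖ [] [] = sym GP.ε⁻¹≈ε
    hash-⊖ (x ∷ w) (z ∷ ℓ) = trans (cong₂ _⊞_ (column-⊖ x z) (hash-⊖ w ℓ)) (GP.⁻¹-∙-comm (column x z) (hash w ℓ))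

    hash-𝟘 : ∀ {n} (w : Vec Letter n) → hash w (Vec.replicate n 𝟘) ≡ 𝟎
    hash-𝟘 [] = refl
    hash-𝟘 (x ∷ w) = trans (cong₂ _⊞_ (column-𝟘 x) (hash-𝟘 w)) (G.identityˡ 𝟎)

    unit : ∀ {n} → Fin n → Z → Vec Z n
    unit {suc n} zero z = z ∷ Vec.replicate n 𝟘
    unit (suc j) z = 𝟘 ∷ unit j z

    hash-unit : ∀ {n} (w : Vec Letter n) j z → hash w (unit j z) ≡ column (lookup w j) z
    hash-unit (x ∷ w) zero z = trans (cong (column x z ⊞_) (hash-𝟘 w)) (G.identityʳ _)
    hash-unit (x ∷ w) (suc j) z = trans (cong₂ _⊞_ (column-𝟘 x) (hash-unit w j z)) (G.identityˡ _)

  row : ∀ {n} → Fin k → Vec Letter n → Vec (Fin 2) n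
  row i = Vec.map (λ x → bit x i)

  hash-row : ∀ {n} i (w w′ : Vec Letter n) ℓ → row i w ≡ row i w′ → lookup (hash w ℓ) i ≡ lookup (hash w′ ℓ) i
  hash-row i [] [] [] _ = refl
  hash-row i (x ∷ w) (y ∷ w′) (z ∷ ℓ) e = begin
    lookup (column x z ⊞ hash w ℓ) i ≡⟨ lookup-⊞ (column x z) (hash w ℓ) i ⟩
    lookup (column x z) i ⊕ lookup (hash w ℓ) i ≡⟨ cong₂ _⊕_ (trans (lookup-column x z i) (trans (cong (λ b → act b z) (Vec.∷-injectiveˡ e))
        (sym (lookup-column y z i)))) (hash-row i w w′ ℓ (Vec.∷-injectiveʳ e)) ⟩
    lookup (column y z) i ⊕ lookup (hash w′ ℓ) i ≡⟨ lookup-⊞ (column y z) (hash w′ ℓ) i ⟨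
    lookup (column y z ⊞ hash w′ ℓ) i ∎
    where open ≡-Reasoning

  module _ {n} (w w′ : Vec Letter n) where
    private
      φ : Vec Z n → G
      φ ℓ = hash w ℓ ⊞ (⊟ hash w′ ℓ)

      φ-⊕ : ∀ ℓ ℓ′ → φ (ℓ ⊕ᵥ ℓ′) ≡ φ ℓ ⊞ φ ℓ′
      φ-⊕ ℓ ℓ′ = trans (cong₂ (λ s t → s ⊞ (⊟ t)) (hash-⊕ w ℓ ℓ′) (hash-⊕ w′ ℓ ℓ′))
        (trans (cong ((hash w ℓ ⊞ hash w ℓ′) ⊞_) (sym (GP.⁻¹-∙-comm (hash w′ ℓ) (hash w′ ℓ′))))
          (interchange (hash w ℓ) (hash w ℓ′) _ _))

      φ-⊖ : ∀ ℓ → φ (Vec.map ⊖_ ℓ) ≡ ⊟ φ ℓ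
      φ-⊖ ℓ = trans (cong₂ (λ s t → s ⊞ (⊟ t)) (hash-⊖ w ℓ) (hash-⊖ w′ ℓ)) (GP.⁻¹-∙-comm (hash w ℓ) (⊟ hash w′ ℓ))

      φ-𝟘 : φ (Vec.replicate n 𝟘) ≡ 𝟎
      φ-𝟘 = trans (cong₂ (λ s t → s ⊞ (⊟ t)) (hash-𝟘 w) (hash-𝟘 w′)) (G.inverseʳ 𝟎)

      preimage? : ∀ g → Dec (∃ λ ℓ → φ ℓ ≡ g)
      preimage? g = search (functionals n) (λ ℓ → φ ℓ ≟G g)

    -- The subgroup W attached to the pair of words. As `φ` is a homomorphism, a uniformly random
    -- functional makes the difference of the hashes uniform on it.
    image : G → Bool
    image g = ⌊ preimage? g ⌋

    private
      image⁻ : ∀ g → T (image g) → ∃ λ ℓ → φ ℓ ≡ g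
      image⁻ g = toWitness {a? = preimage? g}

      image⁺ : ∀ ℓ {g} → φ ℓ ≡ g → T (image g)
      image⁺ ℓ {g} e = fromWitness {a? = preimage? g} (ℓ , e)

    image-isSubgroup : IsSubgroup image
    image-isSubgroup = image⁺ (Vec.replicate n 𝟘) φ-𝟘
      , (λ a b s t → let ℓ , e = image⁻ a s ; ℓ′ , e′ = image⁻ b t in image⁺ (ℓ ⊕ᵥ ℓ′) (trans (φ-⊕ ℓ ℓ′) (cong₂ _⊞_ e e′)))
      , λ a s → let ℓ , e = image⁻ a s in image⁺ (Vec.map ⊖_ ℓ) (trans (φ-⊖ ℓ) (cong ⊟_ e))

    image-diff : ∀ j z → T (image (diff (lookup w j) (lookup w′ j) z))
    image-diff j z = image⁺ (unit j z) (cong₂ (λ s t → s ⊞ (⊟ t)) (hash-unit w j z) (hash-unit w′ j z))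

    image-vanishing : ∀ i → row i w ≡ row i w′ → ∀ g → T (image g) → T (vanishing i g)
    image-vanishing i e g t = let ℓ , e′ = image⁻ g t in vanishing⁺ i g (trans (cong (λ s → lookup s i) (sym e′))
      (trans (lookup-⊞ (hash w ℓ) _ i) (trans (cong₂ _⊕_ (hash-row i w w′ ℓ e) (lookup-⊟ (hash w′ ℓ) i)) (Z.inverseʳ _))))

    kernel : ℕ
    kernel = # (functionals n) (λ ℓ → hash w ℓ ≟G hash w′ ℓ)

    -- Over each point of the image lies a translate of the kernel. So the hashes agree with
    -- probability at most 1 / `size image`.
    kernel*image : kernel * size image ≤ N ^ n
    kernel*image = begin
      kernel * size image ≡⟨ ∑-*ˡ (elems vectors) kernel _ ⟨
      ∑ᶠ vectors (λ g → kernel * 𝟙 (T? (image g))) ≤⟨ ∑-mono (elems vectors) (λ g → fibre g (T? (image g))) ⟩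
      ∑ᶠ vectors (λ g → # (functionals n) (λ ℓ → g ≟G φ ℓ))
          ≡⟨ ∑-cong (elems vectors) (λ g → ∑-cong (elems (functionals n)) (λ ℓ → sym (*-identityʳ _))) ⟩
      ∑ᶠ vectors (λ g → ∑ᶠ (functionals n) (λ ℓ → 𝟙 (g ≟G φ ℓ) * 1))
          ≡⟨ ∑-fibres vectors (elems (functionals n)) φ (λ _ → 1) ⟨
      ∑ᶠ (functionals n) (λ _ → 1) ≡⟨ card-∑ (functionals n) ⟨
      card (functionals n) ≡⟨ card-vec FZ n ⟩
      N ^ n ∎
      where
      open ≤-Reasoning
      module FP = AbelianGroupProperties (bundle (vec-isAbelianGroup isAbelianGroup n))
      fibre : ∀ g (d : Dec (T (image g))) → kernel * 𝟙 d ≤ # (functionals n) (λ ℓ → g ≟G φ ℓ)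
      fibre g (no _) = ≤-trans (≤-reflexive (*-zeroʳ kernel)) z≤n
      fibre g (yes t) = ≤-trans (≤-reflexive (*-identityʳ kernel))
        (#-injection (functionals n) (functionals n) (λ ℓ → hash w ℓ ≟G hash w′ ℓ) (λ ℓ → g ≟G φ ℓ) (ℓ₀ ⊕ᵥ_)
          (λ ℓ e → sym (trans (φ-⊕ ℓ₀ ℓ) (trans (cong₂ _⊞_ (proj₂ (image⁻ g t)) (trans (cong (_⊞ (⊟ hash w′ ℓ)) e) (G.inverseʳ _))) (G.identityʳ g))))
          (λ ℓ ℓ′ _ _ → FP.∙-cancelˡ ℓ₀ ℓ ℓ′))
        where
        ℓ₀ = proj₁ (image⁻ g t)

    -- Every additional functional therefore separates distinct words with probability at least 1/2,
    -- which is what pays for the union bounds.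
    image-large : w′ ≢ w → 2 ≤ size image
    image-large w′≢w with search (fins n) (λ j → ¬? (Finite._≟_ letters (lookup w j) (lookup w′ j)))
    ... | no none = contradiction (vec-ext agree) w′≢w
      where
      agree : ∀ j → lookup w′ j ≡ lookup w j
      agree j with Finite._≟_ letters (lookup w j) (lookup w′ j)
      ... | yes e = sym e
      ... | no ne = contradiction (j , ne) none
    ... | yes (j , ne) = #-two vectors (λ g → T? (image g)) distinct (proj₁ image-isSubgroup) (image-diff j one)
      where
      x = lookup w j
      y = lookup w′ j
      distinct : 𝟎 ≢ diff x y one
      distinct e with discrepancy (proj₁ x) (proj₁ y) (trans (proj₂ x) (sym (proj₂ y))) (ne ∘ letter-ext)
      ... | a , xa , ya = one≢𝟘 (begin
        one ≡⟨ Z.identityʳ one ⟨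
        one ⊕ 𝟘 ≡⟨ cong (one ⊕_) ⊖𝟘 ⟨
        one ⊕ (⊖ 𝟘) ≡⟨ cong₂ (λ s t → act s one ⊕ (⊖ act t one)) xa ya ⟨
        act (bit x a) one ⊕ (⊖ act (bit y a) one) ≡⟨ lookup-diff x y one a ⟨
        lookup (diff x y one) a ≡⟨ cong (λ g → lookup g a) e ⟨
        lookup 𝟎 a ≡⟨ lookup-𝟎 a ⟩
        𝟘 ∎)
        where open ≡-Reasoning

  Agree : ∀ {n r} → Vec (Vec Z n) r → Vec Letter n → Vec Letter n → Set
  Agree {r = r} L w w′ = ∀ (j : Fin r) → hash w (lookup L j) ≡ hash w′ (lookup L j)

  agree? : ∀ {n r} (L : Vec (Vec Z n) r) w w′ → Dec (Agree L w w′)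
  agree? {r = r} L w w′ = forAll (fins r) (λ j → hash w (lookup L j) ≟G hash w′ (lookup L j))

  #-agree : ∀ {n} r (w w′ : Vec Letter n) → # (vecs (functionals n) r) (λ L → agree? L w w′) ≡ kernel w w′ ^ r
  #-agree zero w w′ = cong (_+ 0) (𝟙-yes (agree? [] w w′) (λ ()))
  #-agree {n} (suc r) w w′ = begin
    # (vecs F (suc r)) (λ L → agree? L w w′)
      ≡⟨ ∑-vec F r _ ⟩
    ∑ᶠ F (λ ℓ → # (vecs F r) (λ L → agree? (ℓ ∷ L) w w′))
      ≡⟨ ∑-cong (elems F) (λ ℓ → trans (∑-cong (elems (vecs F r)) (λ L →
           𝟙-× (hash w ℓ ≟G hash w′ ℓ) (agree? L w w′) (agree? (ℓ ∷ L) w w′) (λ a → a zero , a ∘ suc)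
             (λ { e a zero → e ; e a (suc j) → a j })))
           (∑-*ˡ (elems (vecs F r)) (𝟙 (hash w ℓ ≟G hash w′ ℓ)) _)) ⟩
    ∑ᶠ F (λ ℓ → 𝟙 (hash w ℓ ≟G hash w′ ℓ) * # (vecs F r) (λ L → agree? L w w′))
      ≡⟨ ∑-*ʳ (elems F) _ _ ⟩
    kernel w w′ * # (vecs F r) (λ L → agree? L w w′)
      ≡⟨ cong (kernel w w′ *_) (#-agree r w w′) ⟩
    kernel w w′ ^ suc r ∎
    where
    open ≡-Reasoning
    F = functionals n

  Twin : ∀ {n} → Vec Letter n → Fin k → Vec Letter n → Set
  Twin w i w′ = w′ ≢ w × row i w ≡ row i w′

  twin? : ∀ {n} (w : Vec Letter n) i w′ → Dec (Twin w i w′)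
  twin? w i w′ = ¬? (Finite._≟_ (words _) w′ w) ×-dec Vec.≡-dec Fin._≟_ (row i w) (row i w′)

  -- An upper bound for the number of subgroups that depends on N and k but not on the word length.
  subgroupCount : ℕ
  subgroupCount = length (subsets vectors (elems vectors))

  -- The first `r₁` functionals offset the number δ(W)^m of competing words by semistability; the
  -- remaining `r₂` gain a factor 2^r₂ to spend on the choice of W and of the shared row.
  module _ (m r₁ r₂ C′ k′ : ℕ) (card≡ : card letters ≡ 2 * C′) (k≡ : k ≡ 2 + k′)
    (bound : (C′ ^ card letters) ^ m ≤ (N ^ k′) ^ r₁) where
    private
      n r : ℕ
      n = m * card letters
      r = r₁ + r₂
      WF = words n

    module _ (w : Vec Letter n) (w-uniform : Uniform m w) (i : Fin k) where
      private
        Same : (G → Bool) → Vec Letter n → Set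
        Same p w′ = Twin w i w′ × (∀ g → T (p g) → T (image w w′ g)) × (∀ g → T (image w w′ g) → T (p g))

        same? : ∀ p w′ → Dec (Same p w′)
        same? p w′ = twin? w i w′ ×-dec forAll vectors (λ g → T? (p g) →-dec T? (image w w′ g))
          ×-dec forAll vectors (λ g → T? (image w w′ g) →-dec T? (p g))

        -- Twins with image `p` differ from `w` by columns in `p`, so uniformity of `w` leaves at
        -- most δ(p)^m of them. Each is hashed like `w` with probability at most 1 / size^r, and
        -- δ(p)^m 2^r₂ ≤ size^r.
        perSubgroup : ∀ p → Dec (∃ (Same p)) → 2 ^ r₂ * ∑ᶠ WF (λ w′ → 𝟙 (same? p w′) * kernel w w′ ^ r) ≤ (N ^ n) ^ r
        perSubgroup p (no none) = begin
          2 ^ r₂ * ∑ᶠ WF (λ w′ → 𝟙 (same? p w′) * kernel w w′ ^ r)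
            ≡⟨ cong (2 ^ r₂ *_) (∑-zero (elems WF) (λ w′ → cong (_* kernel w w′ ^ r) (𝟙-no (same? p w′) (λ s → none (w′ , s))))) ⟩
          2 ^ r₂ * 0 ≡⟨ *-zeroʳ (2 ^ r₂) ⟩
          0 ≤⟨ z≤n ⟩
          (N ^ n) ^ r ∎
          where open ≤-Reasoning
        -- One twin `w₀` with this image shows that `p` is a subgroup, vanishes in row i and has at
        -- least two elements.
        perSubgroup p (yes (w₀ , (w₀≢w , rowEq) , p⇒im , im⇒p)) = *-cancelʳ-≤⁺ δ δ>0 (begin
          2 ^ r₂ * ∑ᶠ WF (λ w′ → 𝟙 (same? p w′) * kernel w w′ ^ r) * δ
            ≡⟨ e₁ (2 ^ r₂) (∑ᶠ WF (λ w′ → 𝟙 (same? p w′) * kernel w w′ ^ r)) δ ⟩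
          ∑ᶠ WF (λ w′ → 𝟙 (same? p w′) * kernel w w′ ^ r) * (δ * 2 ^ r₂)
            ≤⟨ *-monoʳ-≤ (∑ᶠ WF (λ w′ → 𝟙 (same? p w′) * kernel w w′ ^ r)) δ≤size ⟩
          ∑ᶠ WF (λ w′ → 𝟙 (same? p w′) * kernel w w′ ^ r) * size p ^ r
            ≡⟨ ∑-*ʳ (elems WF) (size p ^ r) _ ⟨
          ∑ᶠ WF (λ w′ → 𝟙 (same? p w′) * kernel w w′ ^ r * size p ^ r)
            ≤⟨ ∑-mono (elems WF) (λ w′ → term w′ (same? p w′)) ⟩
          ∑ᶠ WF (λ w′ → 𝟙 (related w w′) * (N ^ n) ^ r)
            ≡⟨ ∑-*ʳ (elems WF) ((N ^ n) ^ r) _ ⟩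
          # WF (related w) * (N ^ n) ^ r
            ≡⟨ cong (_* (N ^ n) ^ r) (trans (#-related _≈?_ w) (wordProduct-uniform (degree p) w w-uniform)) ⟩
          δ * (N ^ n) ^ r
            ≡⟨ *-comm δ _ ⟩
          (N ^ n) ^ r * δ ∎)
          where
          open ≤-Reasoning
          _≈?_ = λ x y → forAll FZ (λ z → T? (p (diff x y z)))
          related = related? _≈?_
          δ = degrees p ^ m
          sim = image-isSubgroup w w₀
          sp : IsSubgroup p
          sp = im⇒p _ (proj₁ sim) , (λ a b s t → im⇒p _ (proj₁ (proj₂ sim) a b (p⇒im a s) (p⇒im b t)))
            , λ a s → im⇒p _ (proj₂ (proj₂ sim) a (p⇒im a s))
          δ>0 : 1 ≤ δ
          δ>0 = 1≤^ m (degrees>0 {p} sp)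
          e₁ : ∀ a b c → a * b * c ≡ b * (c * a)
          e₁ = solve-∀
          δ≤size : δ * 2 ^ r₂ ≤ size p ^ r
          δ≤size = begin
            δ * 2 ^ r₂ ≤⟨ *-mono-≤ (row-semistable i m r₁ C′ k′ card≡ k≡ bound p sp (λ g → image-vanishing w w₀ i rowEq g ∘ p⇒im g))
                (^-monoˡ-≤ r₂ (≤-trans (image-large w w₀ w₀≢w) (size-mono im⇒p))) ⟩
            size p ^ r₁ * size p ^ r₂ ≡⟨ ^-distribˡ-+-* (size p) r₁ r₂ ⟨
            size p ^ r ∎
          term : ∀ w′ (d : Dec (Same p w′)) → 𝟙 d * kernel w w′ ^ r * size p ^ r ≤ 𝟙 (related w w′) * (N ^ n) ^ r
          term w′ (no _) = z≤n
          term w′ (yes (_ , p⇒im′ , im⇒p′)) = begin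
            1 * kernel w w′ ^ r * size p ^ r ≡⟨ cong (_* size p ^ r) (*-identityˡ (kernel w w′ ^ r)) ⟩
            kernel w w′ ^ r * size p ^ r ≡⟨ ^-distribʳ-* r (kernel w w′) (size p) ⟨
            (kernel w w′ * size p) ^ r ≤⟨ ^-monoˡ-≤ r (≤-trans (*-monoʳ-≤ (kernel w w′) (size-mono p⇒im′)) (kernel*image w w′)) ⟩
            (N ^ n) ^ r ≡⟨ *-identityˡ _ ⟨
            1 * (N ^ n) ^ r ≡⟨ cong (_* (N ^ n) ^ r) (𝟙-yes (related w w′) (λ j z → im⇒p′ _ (image-diff w w′ j z))) ⟨
            𝟙 (related w w′) * (N ^ n) ^ r ∎

      twins-hashed-together : 2 ^ r₂ * ∑ᶠ WF (λ w′ → 𝟙 (twin? w i w′) * kernel w w′ ^ r) ≤ subgroupCount * (N ^ n) ^ r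
      twins-hashed-together = begin
        2 ^ r₂ * ∑ᶠ WF (λ w′ → 𝟙 (twin? w i w′) * kernel w w′ ^ r)
          ≤⟨ *-monoʳ-≤ (2 ^ r₂) (∑-mono (elems WF) cover) ⟩
        2 ^ r₂ * ∑ᶠ WF (λ w′ → ∑ S (λ p → 𝟙 (same? p w′) * kernel w w′ ^ r))
          ≡⟨ cong (2 ^ r₂ *_) (∑-swap (elems WF) S _) ⟩
        2 ^ r₂ * ∑ S (λ p → ∑ᶠ WF (λ w′ → 𝟙 (same? p w′) * kernel w w′ ^ r))
          ≡⟨ ∑-*ˡ S (2 ^ r₂) _ ⟨
        ∑ S (λ p → 2 ^ r₂ * ∑ᶠ WF (λ w′ → 𝟙 (same? p w′) * kernel w w′ ^ r))
          ≤⟨ ∑-mono S (λ p → perSubgroup p (search WF (same? p))) ⟩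
        ∑ S (λ p → (N ^ n) ^ r)
          ≡⟨ ∑-const S _ ⟩
        subgroupCount * (N ^ n) ^ r ∎
        where
        open ≤-Reasoning
        S = subsets vectors (elems vectors)
        cover : ∀ w′ → 𝟙 (twin? w i w′) * kernel w w′ ^ r ≤ ∑ S (λ p → 𝟙 (same? p w′) * kernel w w′ ^ r)
        cover w′ = ≤-trans (*-monoˡ-≤ (kernel w w′ ^ r) (some (twin? w i w′))) (≤-reflexive (sym (∑-*ʳ S _ _)))
          where
          some : (d : Dec (Twin w i w′)) → 𝟙 d ≤ ∑ S (λ p → 𝟙 (same? p w′))
          some (no _) = z≤n
          some (yes t) = let p , p∈ , p⇒im , im⇒p = subsets-complete vectors (image w w′) (elems vectors) in
            #-union S (λ p → same? p w′) p∈ (t , p⇒im , λ g → im⇒p g (complete vectors g))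

    -- The competitor ranges over all words and not only the uniform ones, since an edge glued from
    -- rows of the matching need not have uniform type.
    Isolated : Vec (Vec Z n) r → Vec Letter n → Set
    Isolated L w = ∀ i w′ → row i w ≡ row i w′ → Agree L w w′ → w′ ≡ w

    isolated? : ∀ L w → Dec (Isolated L w)
    isolated? L w = forAll (fins k) (λ i → forAll WF (λ w′ →
      Vec.≡-dec Fin._≟_ (row i w) (row i w′) →-dec (agree? L w w′ →-dec Finite._≟_ WF w′ w)))

    private
      LF = vecs (functionals n) r

      Conflict : Vec (Vec Z n) r → Vec Letter n → Fin k → Vec Letter n → Set
      Conflict L w i w′ = Twin w i w′ × Agree L w w′

      conflict? : ∀ L w i w′ → Dec (Conflict L w i w′)
      conflict? L w i w′ = twin? w i w′ ×-dec agree? L w w′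

      conflictsAt : Vec (Vec Z n) r → Vec Letter n → ℕ
      conflictsAt L w = ∑ (finElems k) (λ i → # WF (conflict? L w i))

      conflicts : Vec (Vec Z n) r → ℕ
      conflicts L = ∑ᶠ WF (λ w → 𝟙 (uniform? m w) * conflictsAt L w)

      N>0 : 1 ≤ N
      N>0 = ≤-trans (∑-term (elems FZ) (λ _ → 1) (complete FZ one)) (≤-reflexive (sym (card-∑ FZ)))

      card-LF : card LF ≡ (N ^ n) ^ r
      card-LF = trans (card-vec (functionals n) r) (cong (_^ r) (card-vec FZ n))

      subgroupCount>0 : 1 ≤ subgroupCount
      subgroupCount>0 = subst (1 ≤_)
        (trans (∑-const (subsets vectors (elems vectors)) 1) (*-identityʳ _))
        (∑-term (subsets vectors (elems vectors)) (λ _ → 1)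
          (proj₁ (proj₂ (subsets-complete vectors (λ _ → true) (elems vectors)))))

      expected : 2 * (k * subgroupCount) ≤ 2 ^ r₂ → ∀ w → Uniform m w → 2 * ∑ᶠ LF (λ L → conflictsAt L w) ≤ (N ^ n) ^ r
      expected r₂-large w u = *-cancelˡ-≤⁺ (k * subgroupCount) positive (begin
        k * subgroupCount * (2 * X) ≡⟨ e₁ (k * subgroupCount) X ⟩
        2 * (k * subgroupCount) * X ≤⟨ *-monoˡ-≤ X r₂-large ⟩
        2 ^ r₂ * X ≡⟨ cong (2 ^ r₂ *_) X≡ ⟩
        2 ^ r₂ * ∑ (finElems k) (λ i → ∑ᶠ WF (λ w′ → 𝟙 (twin? w i w′) * kernel w w′ ^ r))
            ≡⟨ ∑-*ˡ (finElems k) (2 ^ r₂) _ ⟨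
        ∑ (finElems k) (λ i → 2 ^ r₂ * ∑ᶠ WF (λ w′ → 𝟙 (twin? w i w′) * kernel w w′ ^ r))
            ≤⟨ ∑-mono (finElems k) (twins-hashed-together w u) ⟩
        ∑ (finElems k) (λ i → subgroupCount * (N ^ n) ^ r)
            ≡⟨ ∑-const (finElems k) _ ⟩
        length (finElems k) * (subgroupCount * (N ^ n) ^ r)
            ≡⟨ cong (_* (subgroupCount * (N ^ n) ^ r)) (card-fin k) ⟩
        k * (subgroupCount * (N ^ n) ^ r) ≡⟨ *-assoc k subgroupCount _ ⟨
        k * subgroupCount * (N ^ n) ^ r ∎)
        where
        open ≤-Reasoning
        X = ∑ᶠ LF (λ L → conflictsAt L w)
        e₁ : ∀ a x → a * (2 * x) ≡ 2 * a * x
        e₁ = solve-∀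
        positive : 1 ≤ k * subgroupCount
        positive = *-mono-≤ (≤-trans (s≤s z≤n) (≤-reflexive (sym k≡))) subgroupCount>0
        X≡ : X ≡ ∑ (finElems k) (λ i → ∑ᶠ WF (λ w′ → 𝟙 (twin? w i w′) * kernel w w′ ^ r))
        X≡ = trans (∑-swap (elems LF) (finElems k) _) (∑-cong (finElems k) (λ i →
          trans (∑-swap (elems LF) (elems WF) _) (∑-cong (elems WF) (λ w′ →
            trans (∑-cong (elems LF) (λ L → 𝟙-× (twin? w i w′) (agree? L w w′) (conflict? L w i w′) id _,_))
              (trans (∑-*ˡ (elems LF) (𝟙 (twin? w i w′)) _) (cong (𝟙 (twin? w i w′) *_) (#-agree r w w′)))))))

      few : 2 * (k * subgroupCount) ≤ 2 ^ r₂ → ∀ L → card LF * conflicts L ≤ ∑ᶠ LF conflicts → 2 * conflicts L ≤ # WF (uniform? m)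
      few r₂-large L avg = *-cancelˡ-≤⁺ ((N ^ n) ^ r) (1≤^ r (1≤^ n N>0)) (begin
        (N ^ n) ^ r * (2 * conflicts L) ≡⟨ e₁ ((N ^ n) ^ r) (conflicts L) ⟩
        2 * ((N ^ n) ^ r * conflicts L) ≡⟨ cong (λ t → 2 * (t * conflicts L)) card-LF ⟨
        2 * (card LF * conflicts L) ≤⟨ *-monoʳ-≤ 2 avg ⟩
        2 * ∑ᶠ LF conflicts ≡⟨ cong (2 *_) (trans (∑-swap (elems LF) (elems WF) _)
            (∑-cong (elems WF) (λ w → ∑-*ˡ (elems LF) (𝟙 (uniform? m w)) _))) ⟩
        2 * ∑ᶠ WF (λ w → 𝟙 (uniform? m w) * ∑ᶠ LF (λ L → conflictsAt L w))
            ≡⟨ ∑-*ˡ (elems WF) 2 _ ⟨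
        ∑ᶠ WF (λ w → 2 * (𝟙 (uniform? m w) * ∑ᶠ LF (λ L → conflictsAt L w)))
            ≤⟨ ∑-mono (elems WF) (λ w → term w (uniform? m w)) ⟩
        ∑ᶠ WF (λ w → 𝟙 (uniform? m w) * (N ^ n) ^ r)
            ≡⟨ ∑-*ʳ (elems WF) _ _ ⟩
        U * (N ^ n) ^ r ≡⟨ *-comm U _ ⟩
        (N ^ n) ^ r * U ∎)
        where
        open ≤-Reasoning
        U = # WF (uniform? m)
        e₁ : ∀ a x → a * (2 * x) ≡ 2 * (a * x)
        e₁ = solve-∀
        term : ∀ w (d : Dec (Uniform m w)) → 2 * (𝟙 d * ∑ᶠ LF (λ L → conflictsAt L w)) ≤ 𝟙 d * (N ^ n) ^ r
        term w (no _) = z≤n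
        term w (yes u) = begin
          2 * (1 * ∑ᶠ LF (λ L → conflictsAt L w)) ≡⟨ cong (2 *_) (*-identityˡ (∑ᶠ LF (λ L → conflictsAt L w))) ⟩
          2 * ∑ᶠ LF (λ L → conflictsAt L w) ≤⟨ expected r₂-large w u ⟩
          (N ^ n) ^ r ≡⟨ *-identityˡ _ ⟨
          1 * (N ^ n) ^ r ∎

      covered : ∀ L → # WF (uniform? m) ≤ # WF (λ w → uniform? m w ×-dec isolated? L w) + conflicts L
      covered L = begin
        # WF (uniform? m) ≤⟨ ∑-mono (elems WF) (λ w → step w (search (fins k) (λ i → search WF (conflict? L w i)))) ⟩
        ∑ᶠ WF (λ w → 𝟙 (uniform? m w ×-dec isolated? L w) + 𝟙 (uniform? m w) * conflictsAt L w)
            ≡⟨ ∑-+ (elems WF) _ _ ⟩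
        # WF (λ w → uniform? m w ×-dec isolated? L w) + conflicts L ∎
        where
        open ≤-Reasoning
        step : ∀ w → Dec (∃ λ i → ∃ (Conflict L w i)) →
          𝟙 (uniform? m w) ≤ 𝟙 (uniform? m w ×-dec isolated? L w) + 𝟙 (uniform? m w) * conflictsAt L w
        step w (yes (i , w′ , c)) = ≤-trans (≤-trans (≤-reflexive (sym (*-identityʳ _))) (*-monoʳ-≤ (𝟙 (uniform? m w)) (begin
          1 ≡⟨ 𝟙-yes (conflict? L w i w′) c ⟨
          𝟙 (conflict? L w i w′) ≤⟨ ∑-term (elems WF) (λ w′ → 𝟙 (conflict? L w i w′)) (complete WF w′) ⟩
          # WF (conflict? L w i) ≤⟨ ∑-term (finElems k) (λ i → # WF (conflict? L w i)) (complete (fins k) i) ⟩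
          conflictsAt L w ∎))) (m≤n+m _ _)
        step w (no none) = ≤-trans (𝟙-mono (uniform? m w) (uniform? m w ×-dec isolated? L w) (λ u → u , isolated)) (m≤m+n _ _)
          where
          isolated : Isolated L w
          isolated i w′ e a with Finite._≟_ WF w′ w
          ... | yes w′≡w = w′≡w
          ... | no w′≢w = contradiction (i , w′ , (w′≢w , e) , a) none

      conclude : 2 * (k * subgroupCount) ≤ 2 ^ r₂ → ∀ L → card LF * conflicts L ≤ ∑ᶠ LF conflicts →
        # WF (uniform? m) ≤ 2 * # WF (λ w → uniform? m w ×-dec isolated? L w)
      conclude r₂-large L avg = half-of (# WF (uniform? m)) (# WF (λ w → uniform? m w ×-dec isolated? L w)) (conflicts L)
        (covered L) (few r₂-large L avg)
        where
        half-of : ∀ u i c → u ≤ i + c → 2 * c ≤ u → u ≤ 2 * i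
        half-of u i c u≤i+c 2c≤u = +-cancelˡ-≤ u _ _ (begin
          u + u ≡⟨ e₁ u ⟩
          2 * u ≤⟨ *-monoʳ-≤ 2 u≤i+c ⟩
          2 * (i + c) ≡⟨ e₂ i c ⟩
          2 * c + 2 * i ≤⟨ +-monoˡ-≤ (2 * i) 2c≤u ⟩
          u + 2 * i ∎)
          where
          open ≤-Reasoning
          e₁ : ∀ u → u + u ≡ 2 * u
          e₁ = solve-∀
          e₂ : ∀ i c → 2 * (i + c) ≡ 2 * c + 2 * i
          e₂ = solve-∀

    -- First moment method: some choice of functionals has no more conflicts than average, and the
    -- average is at most half the number of uniform words. The hypothesis on `r₂` provides for k
    -- shared rows, all subgroups, and the factor 2 that leaves half of the words isolated.
    isolating-functionals : 2 * (k * subgroupCount) ≤ 2 ^ r₂ →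
      ∃ λ L → # WF (uniform? m) ≤ 2 * # WF (λ w → uniform? m w ×-dec isolated? L w)
    isolating-functionals r₂-large =
      let L , avg = average-≤ (Vec.replicate r (Vec.replicate n 𝟘)) (elems LF) conflicts in L , conclude r₂-large L avg

-- Cyclic groups of odd order

module Cyclic (M : ℕ) where
  N : ℕ
  N = suc (2 * M)

  π : ℕ → Fin N
  π x = x mod N

  toℕ-π : ∀ x → toℕ (π x) ≡ x % N
  toℕ-π x = Fin.toℕ-fromℕ< (m%n<n x N)

  π-toℕ : ∀ a → π (toℕ a) ≡ a
  π-toℕ a = Fin.toℕ-injective (trans (toℕ-π (toℕ a)) (m<n⇒m%n≡m (Fin.toℕ<n a)))

  _⊕_ : Fin N → Fin N → Fin N
  a ⊕ b = π (toℕ a + toℕ b)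

  ⊖_ : Fin N → Fin N
  ⊖ a = π (N ∸ toℕ a)

  𝟘 : Fin N
  𝟘 = π 0

  π-+ : ∀ x y → π (x + y) ≡ π x ⊕ π y
  π-+ x y = Fin.toℕ-injective (begin
    toℕ (π (x + y)) ≡⟨ toℕ-π (x + y) ⟩
    (x + y) % N ≡⟨ %-distribˡ-+ x y N ⟩
    (x % N + y % N) % N ≡⟨ cong₂ (λ s t → (s + t) % N) (toℕ-π x) (toℕ-π y) ⟨
    (toℕ (π x) + toℕ (π y)) % N ≡⟨ toℕ-π (toℕ (π x) + toℕ (π y)) ⟨
    toℕ (π x ⊕ π y) ∎)
    where open ≡-Reasoning

  private
    ⊕-comm : ∀ a b → a ⊕ b ≡ b ⊕ a
    ⊕-comm a b = cong π (+-comm (toℕ a) (toℕ b))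

    ⊕-assoc : ∀ a b c → (a ⊕ b) ⊕ c ≡ a ⊕ (b ⊕ c)
    ⊕-assoc a b c = begin
      (a ⊕ b) ⊕ c ≡⟨ cong ((a ⊕ b) ⊕_) (π-toℕ c) ⟨
      π (toℕ a + toℕ b) ⊕ π (toℕ c) ≡⟨ π-+ (toℕ a + toℕ b) (toℕ c) ⟨
      π (toℕ a + toℕ b + toℕ c) ≡⟨ cong π (+-assoc (toℕ a) (toℕ b) (toℕ c)) ⟩
      π (toℕ a + (toℕ b + toℕ c)) ≡⟨ π-+ (toℕ a) (toℕ b + toℕ c) ⟩
      π (toℕ a) ⊕ (b ⊕ c) ≡⟨ cong (_⊕ (b ⊕ c)) (π-toℕ a) ⟩
      a ⊕ (b ⊕ c) ∎
      where open ≡-Reasoning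

    ⊕-identityˡ : ∀ a → 𝟘 ⊕ a ≡ a
    ⊕-identityˡ a = trans (cong (𝟘 ⊕_) (sym (π-toℕ a))) (trans (sym (π-+ 0 (toℕ a))) (π-toℕ a))

    ⊕-inverseˡ : ∀ a → (⊖ a) ⊕ a ≡ 𝟘
    ⊕-inverseˡ a = begin
      (⊖ a) ⊕ a ≡⟨ cong ((⊖ a) ⊕_) (π-toℕ a) ⟨
      π (N ∸ toℕ a) ⊕ π (toℕ a) ≡⟨ π-+ (N ∸ toℕ a) (toℕ a) ⟨
      π (N ∸ toℕ a + toℕ a) ≡⟨ cong π (m∸n+n≡m (<⇒≤ (Fin.toℕ<n a))) ⟩
      π N ≡⟨ Fin.toℕ-injective (trans (toℕ-π N) (trans (n%n≡0 N) (sym (toℕ-π 0)))) ⟩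
      𝟘 ∎
      where open ≡-Reasoning

  isAbelianGroup : IsAbelianGroup _≡_ _⊕_ 𝟘 ⊖_
  isAbelianGroup = record
    { isGroup = record
      { isMonoid = record
        { isSemigroup = record
          { isMagma = record { isEquivalence = isEquivalence ; ∙-cong = cong₂ _⊕_ }
          ; assoc = ⊕-assoc }
        ; identity = ⊕-identityˡ , λ a → trans (⊕-comm a 𝟘) (⊕-identityˡ a) }
      ; inverse = ⊕-inverseˡ , λ a → trans (⊕-comm a (⊖ a)) (⊕-inverseˡ a)
      ; ⁻¹-cong = cong ⊖_ }
    ; comm = ⊕-comm }

  -- M + 1 is the inverse of 2, as 2(M + 1) = N + 1.
  half : Fin N → Fin N
  half z = π (suc M * toℕ z)

  half-double : ∀ z → half z ⊕ half z ≡ z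
  half-double z = begin
    half z ⊕ half z ≡⟨ π-+ (suc M * toℕ z) (suc M * toℕ z) ⟨
    π (suc M * toℕ z + suc M * toℕ z) ≡⟨ cong π (e M (toℕ z)) ⟩
    π (toℕ z + toℕ z * N) ≡⟨ Fin.toℕ-injective (trans (toℕ-π (toℕ z + toℕ z * N)) (trans ([m+kn]%n≡m%n (toℕ z) (toℕ z) N) (sym (toℕ-π (toℕ z))))) ⟩
    π (toℕ z) ≡⟨ π-toℕ z ⟩
    z ∎
    where
    open ≡-Reasoning
    e : ∀ M z → suc M * z + suc M * z ≡ z + z * suc (2 * M)
    e = solve-∀

  one≢𝟘 : 1 ≤ M → π 1 ≢ 𝟘
  one≢𝟘 M≥1 e = contradiction (trans (sym (m<n⇒m%n≡m 1<N)) (trans (sym (toℕ-π 1)) (trans (cong toℕ e) (toℕ-π 0)))) λ ()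
    where
    1<N : 1 < N
    1<N = s≤s (≤-trans M≥1 (m≤n*m M 2))

-- Behrend's construction

2xy≤x²+y² : ∀ x y → 2 * (x * y) ≤ x * x + y * y
2xy≤x²+y² x y = begin
  2 * (x * y) ≡⟨ e x y ⟩
  x * y + x * y ≤⟨ step ⟩
  x * x + y * y ∎
  where
  open ≤-Reasoning
  e : ∀ x y → 2 * (x * y) ≡ x * y + x * y
  e = solve-∀
  step : x * y + x * y ≤ x * x + y * y
  step with ≤-total x y
  ... | inj₁ x≤y = rearrangement x≤y x≤y
  ... | inj₂ y≤x = begin
    x * y + x * y ≡⟨ cong₂ _+_ (*-comm x y) (*-comm x y) ⟩
    y * x + y * x ≤⟨ rearrangement y≤x y≤x ⟩
    y * y + x * x ≡⟨ +-comm (y * y) (x * x) ⟩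
    x * x + y * y ∎

x²+y²≤2xy⇒x≡y : ∀ x y → x * x + y * y ≤ 2 * (x * y) → x ≡ y
x²+y²≤2xy⇒x≡y x y le = case ≤-total x y of λ
  { (inj₁ x≤y) → ordered x y x≤y le
  ; (inj₂ y≤x) → sym (ordered y x y≤x (≤-trans (≤-reflexive (+-comm (y * y) (x * x)))
      (≤-trans le (≤-reflexive (cong (2 *_) (*-comm x y)))))) }
  where
  ordered : ∀ x y → x ≤ y → x * x + y * y ≤ 2 * (x * y) → x ≡ y
  ordered x y x≤y le with m≤n⇒∃[o]m+o≡n x≤y
  ... | zero , refl = sym (+-identityʳ x)
  ... | suc d , refl = contradiction (≤-trans (≤-reflexive (e x d)) le) (m+1+n≰m (2 * (x * (x + suc d))))
    where
    e : ∀ x d → 2 * (x * (x + suc d)) + suc (d * d + d + d) ≡ x * x + (x + suc d) * (x + suc d)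
    e = solve-∀

-- This is ∑ⱼ |a j - b|² = 0, expanded so that no subtraction occurs.
sphere-rigid : (js : List A) (cs : List B) (a : A → B → ℕ) (b : B → ℕ) →
  (∀ c → ∑ js (λ j → a j c) ≡ ∑ js (λ _ → b c)) →
  (∀ j → ∑ cs (λ c → a j c * a j c) ≡ ∑ cs (λ c → b c * b c)) →
  ∀ {j c} → j ∈ js → c ∈ cs → a j c ≡ b c
sphere-rigid js cs a b mean norm {j} {c} j∈ c∈ = x²+y²≤2xy⇒x≡y (a j c) (b c)
  (∑-tight cs (λ c → 2xy≤x²+y² (a j c) (b c))
    (∑-tight js (λ j → ∑-mono cs (λ c → 2xy≤x²+y² (a j c) (b c))) (≤-reflexive total) j∈) c∈)
  where
  open ≡-Reasoning
  double : ∀ x → x + x ≡ 2 * x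
  double = solve-∀
  rotate : ∀ x y → 2 * (x * y) ≡ 2 * y * x
  rotate = solve-∀
  total : ∑ js (λ j → ∑ cs (λ c → a j c * a j c + b c * b c)) ≡ ∑ js (λ j → ∑ cs (λ c → 2 * (a j c * b c)))
  total = begin
    ∑ js (λ j → ∑ cs (λ c → a j c * a j c + b c * b c))
      ≡⟨ ∑-cong js (λ j → trans (∑-+ cs _ _) (trans (cong (_+ ∑ cs (λ c → b c * b c)) (norm j))
           (trans (double (∑ cs (λ c → b c * b c))) (sym (∑-*ˡ cs 2 (λ c → b c * b c)))))) ⟩
    ∑ js (λ j → ∑ cs (λ c → 2 * (b c * b c)))
      ≡⟨ ∑-swap js cs _ ⟩
    ∑ cs (λ c → ∑ js (λ j → 2 * (b c * b c)))
      ≡⟨ ∑-cong cs (λ c → trans (∑-cong js (λ j → rotate (b c) (b c))) (∑-*ˡ js (2 * b c) (λ _ → b c))) ⟩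
    ∑ cs (λ c → 2 * b c * ∑ js (λ _ → b c))
      ≡⟨ ∑-cong cs (λ c → cong (2 * b c *_) (mean c)) ⟨
    ∑ cs (λ c → 2 * b c * ∑ js (λ j → a j c))
      ≡⟨ ∑-cong cs (λ c → trans (∑-cong js (λ j → rotate (a j c) (b c))) (∑-*ˡ js (2 * b c) _)) ⟨
    ∑ cs (λ c → ∑ js (λ j → 2 * (a j c * b c)))
      ≡⟨ ∑-swap js cs _ ⟨
    ∑ js (λ j → ∑ cs (λ c → 2 * (a j c * b c))) ∎

module Sphere (N q r : ℕ) (q≤N : q ≤ N) where
  Small : Vec (Fin N) r → Set
  Small t = ∀ c → toℕ (lookup t c) < q

  norm : Vec (Fin N) r → ℕ
  norm t = ∑ (finElems r) (λ c → toℕ (lookup t c) * toℕ (lookup t c))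

  OnSphere : ℕ → Vec (Fin N) r → Set
  OnSphere R t = Small t × norm t ≡ R

  small? : ∀ t → Dec (Small t)
  small? t = forAll (fins r) (λ c → toℕ (lookup t c) <? q)

  onSphere? : ∀ R t → Dec (OnSphere R t)
  onSphere? R t = small? t ×-dec (norm t ≟ℕ R)

  private
    F = vecs (fins N) r

    #-small : q ^ r ≤ # F small?
    #-small = begin
      q ^ r ≡⟨ cong (_^ r) (card-fin q) ⟨
      card (fins q) ^ r ≡⟨ card-vec (fins q) r ⟨
      card (vecs (fins q) r) ≡⟨ card-∑ (vecs (fins q) r) ⟩
      # (vecs (fins q) r) (λ _ → yes tt) ≤⟨ #-injection (vecs (fins q) r) F (λ _ → yes tt) small? (Vec.map (λ d → inject≤ d q≤N))
          (λ t _ c → subst (_< q) (sym (entry t c)) (Fin.toℕ<n (lookup t c)))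
          (λ t t′ _ _ e → vec-ext (λ c → Fin.toℕ-injective (trans (sym (entry t c))
          (trans (cong (λ v → toℕ (lookup v c)) e) (entry t′ c))))) ⟩
      # F small? ∎
      where
      open ≤-Reasoning
      entry : ∀ (t : Vec (Fin q) r) c → toℕ (lookup (Vec.map (λ d → inject≤ d q≤N) t) c) ≡ toℕ (lookup t c)
      entry t c = trans (cong toℕ (Vec.lookup-map c _ t)) (Fin.toℕ-inject≤ (lookup t c) q≤N)

    norm-bound : ∀ t → Small t → norm t < suc (r * (q * q))
    norm-bound t s = s≤s (begin
      norm t ≤⟨ ∑-mono (finElems r) (λ c → *-mono-≤ (<⇒≤ (s c)) (<⇒≤ (s c))) ⟩
      ∑ (finElems r) (λ _ → q * q) ≡⟨ ∑-const (finElems r) (q * q) ⟩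
      length (finElems r) * (q * q) ≡⟨ cong (_* (q * q)) (card-fin r) ⟩
      r * (q * q) ∎)
      where open ≤-Reasoning

  -- Pigeonhole: the squared norm takes at most r q² + 1 values on the cube of points with digits
  -- below q.
  large-sphere : ∃ λ R → q ^ r ≤ suc (r * (q * q)) * # F (onSphere? R)
  large-sphere = toℕ (proj₁ best) , (begin
    q ^ r ≤⟨ #-small ⟩
    # F small? ≡⟨ ∑-fibres KF (elems F) key (λ t → 𝟙 (small? t)) ⟩
    ∑ᶠ KF shell ≤⟨ proj₂ best ⟩
    card KF * shell (proj₁ best) ≡⟨ cong (_* shell (proj₁ best)) (card-fin (suc (r * (q * q)))) ⟩
    suc (r * (q * q)) * shell (proj₁ best) ≤⟨ *-monoʳ-≤ (suc (r * (q * q))) (∑-mono (elems F) (λ t → step (proj₁ best) t (small? t) (Finite._≟_ KF (proj₁ best) (key t)))) ⟩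
    suc (r * (q * q)) * # F (onSphere? (toℕ (proj₁ best))) ∎)
    where
    open ≤-Reasoning
    KF = fins (suc (r * (q * q)))
    key : Vec (Fin N) r → Fin (suc (r * (q * q)))
    -- The reduction only makes the key total; on small points the norm is below the modulus and is
    -- its own key.
    key t = norm t mod suc (r * (q * q))
    shell : Fin (suc (r * (q * q))) → ℕ
    shell κ = ∑ᶠ F (λ t → 𝟙 (Finite._≟_ KF κ (key t)) * 𝟙 (small? t))
    best = average-≥ zero (elems KF) shell
    step : ∀ κ t (d : Dec (Small t)) (e : Dec (κ ≡ key t)) → 𝟙 e * 𝟙 d ≤ 𝟙 (onSphere? (toℕ κ) t)
    step κ t (yes s) (yes refl) = ≤-reflexive (sym (𝟙-yes (onSphere? (toℕ (key t)) t)
      (s , sym (trans (Fin.toℕ-fromℕ< (m%n<n (norm t) (suc (r * (q * q))))) (m<n⇒m%n≡m (norm-bound t s))))))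
    step κ t (no _) e = ≤-trans (≤-reflexive (*-zeroʳ (𝟙 e))) z≤n
    step κ t (yes _) (no _) = z≤n

-- From isolated words to an induced matching

extract : (F : Finite A) {P : A → Set} (P? : ∀ x → Dec (P x)) →
  ∃ λ (Ψ : Fin (# F P?) → A) → (∀ p → P (Ψ p)) × (∀ p q → Ψ p ≡ Ψ q → p ≡ q)
extract {A} F {P} P? = let Ψ , valid , _ , inj = go (elems F) (λ z → ≤-reflexive (once F z)) in Ψ , valid , inj
  where
  open Finite F using (_≟_)
  go : ∀ xs → (∀ z → ∑ xs (λ y → 𝟙 (y ≟ z)) ≤ 1) → ∃ λ (Ψ : Fin (∑ xs (λ x → 𝟙 (P? x))) → A) →
    (∀ p → P (Ψ p)) × (∀ p → Ψ p ∈ xs) × (∀ p q → Ψ p ≡ Ψ q → p ≡ q)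
  go [] _ = (λ ()) , (λ ()) , (λ ()) , λ ()
  go (x ∷ xs) uniq with P? x | go xs (λ z → ≤-trans (m≤n+m _ (𝟙 (x ≟ z))) (uniq z))
  ... | no _ | Ψ , valid , mem , inj = Ψ , valid , there ∘ mem , inj
  ... | yes px | Ψ , valid , mem , inj =
      (λ { zero → x ; (suc p) → Ψ p }) , (λ { zero → px ; (suc p) → valid p })
    , (λ { zero → here refl ; (suc p) → there (mem p) })
    , λ { zero zero _ → refl ; (suc p) (suc q) e → cong suc (inj p q e)
        ; zero (suc q) e → contradiction (subst (_∈ xs) (sym e) (mem q)) x∉
        ; (suc p) zero e → contradiction (subst (_∈ xs) e (mem p)) x∉ }
    where
    x∉ : ¬ (x ∈ xs)
    x∉ x∈ = contradiction (≤-trans (+-mono-≤ (≤-reflexive (sym (𝟙-yes (x ≟ x) refl)))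
      (#-union xs (λ y → y ≟ x) x∈ refl)) (uniq x)) λ { (s≤s ()) }

∑-strict : (xs : List A) (f : A → ℕ) (q : ℕ) → (∀ x → f x < q) → length xs + ∑ xs f ≤ length xs * q
∑-strict xs f q f<q = begin
  length xs + ∑ xs f ≡⟨ cong (_+ ∑ xs f) (*-identityʳ (length xs)) ⟨
  length xs * 1 + ∑ xs f ≡⟨ cong (_+ ∑ xs f) (∑-const xs 1) ⟨
  ∑ xs (λ _ → 1) + ∑ xs f ≡⟨ ∑-+ xs (λ _ → 1) f ⟨
  ∑ xs (λ x → suc (f x)) ≤⟨ ∑-mono xs f<q ⟩
  ∑ xs (λ _ → q) ≡⟨ ∑-const xs q ⟩
  length xs * q ∎
  where open ≤-Reasoning

module CyclicSum (M : ℕ) where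
  open Cyclic M
  private
    module Z = IsAbelianGroup isAbelianGroup
    open CommutativeSemigroupProperties (AbelianGroup.commutativeSemigroup (bundle isAbelianGroup)) using (interchange)

  -- The sum is formed in ℕ and reduced once, so that equal totals of small entries can be read back
  -- as equal sums of natural numbers.
  total : ∀ {n} → (Fin n → Fin N) → Fin N
  total {n} f = π (∑ (finElems n) (toℕ ∘ f))

  total-suc : ∀ {n} (f : Fin (suc n) → Fin N) → total f ≡ f zero ⊕ total (f ∘ suc)
  total-suc {n} f = trans (cong π (∑-suc n (toℕ ∘ f))) (trans (π-+ (toℕ (f zero)) _) (cong (_⊕ total (f ∘ suc)) (π-toℕ (f zero))))

  total-cong : ∀ {n} {f g : Fin n → Fin N} → (∀ i → f i ≡ g i) → total f ≡ total g
  total-cong {n} eq = cong π (∑-cong (finElems n) (λ i → cong toℕ (eq i)))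

  total-⊕ : ∀ {n} (f g : Fin n → Fin N) → total (λ i → f i ⊕ g i) ≡ total f ⊕ total g
  total-⊕ {zero} f g = sym (Z.identityˡ 𝟘)
  total-⊕ {suc n} f g = begin
    total (λ i → f i ⊕ g i) ≡⟨ total-suc (λ i → f i ⊕ g i) ⟩
    (f zero ⊕ g zero) ⊕ total (λ i → f (suc i) ⊕ g (suc i)) ≡⟨ cong ((f zero ⊕ g zero) ⊕_) (total-⊕ (f ∘ suc) (g ∘ suc)) ⟩
    (f zero ⊕ g zero) ⊕ (total (f ∘ suc) ⊕ total (g ∘ suc)) ≡⟨ interchange (f zero) (g zero) _ _ ⟩
    (f zero ⊕ total (f ∘ suc)) ⊕ (g zero ⊕ total (g ∘ suc)) ≡⟨ cong₂ _⊕_ (sym (total-suc f)) (sym (total-suc g)) ⟩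
    total f ⊕ total g ∎
    where open ≡-Reasoning

module Selection (M h₂ : ℕ) (M≥1 : 1 ≤ M) where
  private
    h k′ : ℕ
    h = suc (suc h₂)
    k′ = h₂ + h

  open Cyclic M
  open CyclicSum M
  open Hashing (fins N) isAbelianGroup half half-double (π 1) (one≢𝟘 M≥1) h

  private
    module Z = IsAbelianGroup isAbelianGroup
    open AbelianGroupProperties (bundle isAbelianGroup) using (∙-cancelˡ; ∙-cancelʳ)

    total-act : ∀ {n} (v : Vec (Fin 2) n) z → total (λ i → act (lookup v i) z) ≡ π (countOnes v * toℕ z)
    total-act [] z = refl
    total-act (zero ∷ v) z = trans (total-suc (λ i → act (lookup (zero ∷ v) i) z)) (trans (cong (z ⊕_) (total-act v z))
      (trans (cong (_⊕ π (countOnes v * toℕ z)) (sym (π-toℕ z))) (sym (π-+ (toℕ z) (countOnes v * toℕ z)))))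
    total-act (suc b ∷ v) z = trans (total-suc (λ i → act (lookup (suc b ∷ v) i) z)) (trans (Z.identityˡ _) (total-act v z))

    total-column : ∀ x z → total (lookup (column x z)) ≡ π (h * toℕ z)
    total-column x z = trans (total-cong (lookup-column x z)) (trans (total-act (proj₁ x) z) (cong (λ c → π (c * toℕ z)) (proj₂ x)))

    -- Columns are balanced, so the sum of the row hashes does not depend on the word.
    total-hash : ∀ {n} (w w′ : Vec Letter n) ℓ → total (lookup (hash w ℓ)) ≡ total (lookup (hash w′ ℓ))
    total-hash [] [] [] = refl
    total-hash (x ∷ w) (y ∷ w′) (z ∷ ℓ) = begin
      total (lookup (column x z ⊞ hash w ℓ)) ≡⟨ total-cong (lookup-⊞ (column x z) (hash w ℓ)) ⟩
      total (λ i → lookup (column x z) i ⊕ lookup (hash w ℓ) i) ≡⟨ total-⊕ (lookup (column x z)) (lookup (hash w ℓ)) ⟩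
      total (lookup (column x z)) ⊕ total (lookup (hash w ℓ)) ≡⟨ cong₂ _⊕_ (trans (total-column x z) (sym (total-column y z))) (total-hash w w′ ℓ) ⟩
      total (lookup (column y z)) ⊕ total (lookup (hash w′ ℓ)) ≡⟨ total-⊕ (lookup (column y z)) (lookup (hash w′ ℓ)) ⟨
      total (λ i → lookup (column y z) i ⊕ lookup (hash w′ ℓ) i) ≡⟨ total-cong (lookup-⊞ (column y z) (hash w′ ℓ)) ⟨
      total (lookup (column y z ⊞ hash w′ ℓ)) ∎
      where open ≡-Reasoning

  module _ {n r : ℕ} (L : Vec (Vec (Fin N) n) r) where

    value : Vec Letter n → Fin (h + h) → Fin r → Fin N
    value w i c = lookup (hash w (lookup L c)) i

    reference : Vec Letter n → Vec (Fin N) r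
    reference w = tabulate (value w (suc zero))

    -- Row 1 serves as the reference and row 0 is omitted, being determined by the constant total.
    -- The remaining k-2 differences per functional make the pigeonhole cost N^(r(k-2)), the
    -- quantity that was balanced against (C/2)^n.
    key : Vec Letter n → Vec (Vec (Fin N) k′) r
    key w = tabulate (λ c → tabulate (λ i → value w (suc (suc i)) c ⊕ (⊖ value w (suc zero) c)))

    value-key : ∀ w i c → value w (suc (suc i)) c ≡ lookup (lookup (key w) c) i ⊕ value w (suc zero) c
    value-key w i c = begin
      a ≡⟨ Z.identityʳ a ⟨
      a ⊕ 𝟘 ≡⟨ cong (a ⊕_) (Z.inverseˡ u) ⟨
      a ⊕ ((⊖ u) ⊕ u) ≡⟨ Z.assoc a (⊖ u) u ⟨
      (a ⊕ (⊖ u)) ⊕ u ≡⟨ cong (_⊕ u) (Vec.lookup∘tabulate (λ i → value w (suc (suc i)) c ⊕ (⊖ u)) i) ⟨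
      lookup (tabulate (λ i → value w (suc (suc i)) c ⊕ (⊖ u))) i ⊕ u
          ≡⟨ cong (λ v → lookup v i ⊕ u) (Vec.lookup∘tabulate (λ c → tabulate (λ i → value w (suc (suc i)) c ⊕ (⊖ value w (suc zero) c))) c) ⟨
      lookup (lookup (key w) c) i ⊕ u ∎
      where
      open ≡-Reasoning
      a = value w (suc (suc i)) c
      u = value w (suc zero) c

    shifted : Vec (Fin N) r → Vec Letter n → Vec (Fin N) r
    shifted s w = Vec.zipWith _⊕_ s (reference w)

    lookup-shifted : ∀ s w c → lookup (shifted s w) c ≡ lookup s c ⊕ value w (suc zero) c
    lookup-shifted s w c = trans (Vec.lookup-zipWith _⊕_ c s (reference w)) (cong (lookup s c ⊕_) (Vec.lookup∘tabulate _ c))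

    -- The situation of an edge covered by the matching: `w′` takes its row i from the word `ws i`,
    -- and these words share their key and lie on the sphere after translation.
    module _ (q : ℕ) (q≤N : q ≤ N) (wrap : suc k′ * q ≤ N) (R : ℕ) (κ : Vec (Vec (Fin N) k′) r) (s : Vec (Fin N) r)
      (ws : Fin (h + h) → Vec Letter n) (w′ : Vec Letter n)
      (key≡ : ∀ i → key (ws i) ≡ κ) (onSphere : ∀ i → Sphere.OnSphere N q r q≤N R (shifted s (ws i)))
      (rows : ∀ i → row i w′ ≡ row i (ws i)) where
      private
        u : Fin (h + h) → Fin r → Fin N
        u i c = value (ws i) (suc zero) c

        κ⁺ : Fin r → Fin (suc k′) → Fin N
        κ⁺ c zero = 𝟘
        κ⁺ c (suc i) = lookup (lookup κ c) i

        value-κ : ∀ i c (j : Fin (suc k′)) → value (ws i) (suc j) c ≡ κ⁺ c j ⊕ u i c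
        value-κ i c zero = sym (Z.identityˡ _)
        value-κ i c (suc j) = trans (value-key (ws i) j c) (cong (λ v → lookup (lookup v c) j ⊕ u i c) (key≡ i))

        value-w′ : ∀ i c → value w′ i c ≡ value (ws i) i c
        value-w′ i c = hash-row i w′ (ws i) (lookup L c) (rows i)

        split-total : ∀ w c → total (λ i → value w i c) ≡ value w zero c ⊕ total (λ j → value w (suc j) c)
        split-total w c = total-suc (λ i → value w i c)

        -- `w′` and `ws zero` have equal totals and the same row 0, so their remaining rows have
        -- equal totals. In those rows each hash is an entry of the common key plus a reference
        -- value, and the key cancels.
        average : ∀ c → total (λ (j : Fin (suc k′)) → u (suc j) c) ≡ total (λ (j : Fin (suc k′)) → u zero c)
        average c = ∙-cancelˡ (total (κ⁺ c)) _ _ (begin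
          total (κ⁺ c) ⊕ total (λ j → u (suc j) c) ≡⟨ total-⊕ (κ⁺ c) (λ j → u (suc j) c) ⟨
          total (λ j → κ⁺ c j ⊕ u (suc j) c) ≡⟨ total-cong (λ j → trans (value-w′ (suc j) c) (value-κ (suc j) c j)) ⟨
          total (λ j → value w′ (suc j) c) ≡⟨ ∙-cancelˡ (value w′ zero c) _ _ (begin
              value w′ zero c ⊕ total (λ j → value w′ (suc j) c) ≡⟨ split-total w′ c ⟨
              total (λ i → value w′ i c) ≡⟨ total-hash w′ (ws zero) (lookup L c) ⟩
              total (λ i → value (ws zero) i c) ≡⟨ split-total (ws zero) c ⟩
              value (ws zero) zero c ⊕ total (λ j → value (ws zero) (suc j) c)
                  ≡⟨ cong (_⊕ total (λ j → value (ws zero) (suc j) c)) (value-w′ zero c) ⟨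
              value w′ zero c ⊕ total (λ j → value (ws zero) (suc j) c) ∎) ⟩
          total (λ j → value (ws zero) (suc j) c) ≡⟨ total-cong (λ j → value-κ zero c j) ⟩
          total (λ j → κ⁺ c j ⊕ u zero c) ≡⟨ total-⊕ (κ⁺ c) (λ j → u zero c) ⟩
          total (κ⁺ c) ⊕ total (λ (j : Fin (suc k′)) → u zero c) ∎)
          where open ≡-Reasoning

        τ : Fin (h + h) → Fin r → Fin N
        τ i c = lookup (shifted s (ws i)) c

        average-τ : ∀ c → total (λ (j : Fin (suc k′)) → τ (suc j) c) ≡ total (λ (j : Fin (suc k′)) → τ zero c)
        average-τ c = begin
          total (λ (j : Fin (suc k′)) → τ (suc j) c) ≡⟨ total-cong {f = λ (j : Fin (suc k′)) → τ (suc j) c} (λ j → lookup-shifted s (ws (suc j)) c) ⟩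
          total (λ (j : Fin (suc k′)) → lookup s c ⊕ u (suc j) c) ≡⟨ total-⊕ (λ (j : Fin (suc k′)) → lookup s c) (λ j → u (suc j) c) ⟩
          total (λ (j : Fin (suc k′)) → lookup s c) ⊕ total (λ (j : Fin (suc k′)) → u (suc j) c)
              ≡⟨ cong (total (λ (j : Fin (suc k′)) → lookup s c) ⊕_) (average c) ⟩
          total (λ (j : Fin (suc k′)) → lookup s c) ⊕ total (λ (j : Fin (suc k′)) → u zero c)
              ≡⟨ total-⊕ (λ (j : Fin (suc k′)) → lookup s c) (λ j → u zero c) ⟨
          total (λ (j : Fin (suc k′)) → lookup s c ⊕ u zero c) ≡⟨ total-cong {f = λ (j : Fin (suc k′)) → τ zero c} (λ j → lookup-shifted s (ws zero) c) ⟨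
          total (λ (j : Fin (suc k′)) → τ zero c) ∎
          where open ≡-Reasoning

        no-wrap : (f : Fin (suc k′) → ℕ) → (∀ j → f j < q) → ∑ (finElems (suc k′)) f < N
        no-wrap f f<q = begin
          suc (∑ js f) ≤⟨ s≤s (m≤n+m _ k′) ⟩
          suc k′ + ∑ js f ≡⟨ cong (_+ ∑ js f) (card-fin (suc k′)) ⟨
          length js + ∑ js f ≤⟨ ∑-strict js f q f<q ⟩
          length js * q ≡⟨ cong (_* q) (card-fin (suc k′)) ⟩
          suc k′ * q ≤⟨ wrap ⟩
          N ∎
          where
          open ≤-Reasoning
          js : List (Fin (suc k′))
          js = finElems (suc k′)

        -- Both sides have k-1 summands below q, so by `wrap` they stay below N and the congruence
        -- is an equality.
        mean : ∀ c → ∑ (finElems (suc k′)) (λ j → toℕ (τ (suc j) c)) ≡ ∑ (finElems (suc k′)) (λ j → toℕ (τ zero c))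
        mean c = begin
          X ≡⟨ m<n⇒m%n≡m (no-wrap _ (λ j → proj₁ (onSphere (suc j)) c)) ⟨
          X % N ≡⟨ toℕ-π X ⟨
          toℕ (π X) ≡⟨ cong toℕ (average-τ c) ⟩
          toℕ (π Y) ≡⟨ toℕ-π Y ⟩
          Y % N ≡⟨ m<n⇒m%n≡m (no-wrap _ (λ j → proj₁ (onSphere zero) c)) ⟩
          Y ∎
          where
          open ≡-Reasoning
          X = ∑ (finElems (suc k′)) (λ j → toℕ (τ (suc j) c))
          Y = ∑ (finElems (suc k′)) (λ j → toℕ (τ zero c))

        -- The point of `ws zero` is the mean of the k-1 other points, all on one sphere; strict
        -- convexity makes them coincide.
        τ≡ : ∀ j c → τ (suc j) c ≡ τ zero c
        τ≡ j c = Fin.toℕ-injective (sphere-rigid (finElems (suc k′)) (finElems r) (λ j c → toℕ (τ (suc j) c)) (λ c → toℕ (τ zero c))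
          mean (λ j → trans (proj₂ (onSphere (suc j))) (sym (proj₂ (onSphere zero))))
          (complete (fins (suc k′)) j) (complete (fins r) c))

        u≡ : ∀ i c → u i c ≡ u zero c
        u≡ zero c = refl
        u≡ (suc j) c = ∙-cancelˡ (lookup s c) _ _ (trans (sym (lookup-shifted s (ws (suc j)) c)) (trans (τ≡ j c) (lookup-shifted s (ws zero) c)))

        tail≡ : ∀ i c (j : Fin (suc k′)) → value (ws i) (suc j) c ≡ value (ws zero) (suc j) c
        tail≡ i c j = trans (value-κ i c j) (trans (cong (κ⁺ c j ⊕_) (u≡ i c)) (sym (value-κ zero c j)))

        -- The rows after row 0 agree by the common key and reference; row 0 follows from the
        -- constant total.
        value≡ : ∀ i c e → value (ws i) e c ≡ value (ws zero) e c
        value≡ i c (suc j) = tail≡ i c j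
        value≡ i c zero = ∙-cancelʳ (total (λ (j : Fin (suc k′)) → value (ws zero) (suc j) c)) _ _ (begin
          value (ws i) zero c ⊕ total (λ j → value (ws zero) (suc j) c) ≡⟨ cong (value (ws i) zero c ⊕_) (total-cong (tail≡ i c)) ⟨
          value (ws i) zero c ⊕ total (λ j → value (ws i) (suc j) c) ≡⟨ split-total (ws i) c ⟨
          total (λ e → value (ws i) e c) ≡⟨ total-hash (ws i) (ws zero) (lookup L c) ⟩
          total (λ e → value (ws zero) e c) ≡⟨ split-total (ws zero) c ⟩
          value (ws zero) zero c ⊕ total (λ j → value (ws zero) (suc j) c) ∎)
          where open ≡-Reasoning

      agree-with-all : ∀ i → Agree L (ws i) w′
      agree-with-all i c = vec-ext (λ e → trans (value≡ i c e) (trans (sym (value≡ e c e)) (sym (value-w′ e c))))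

  module _ (m r₁ r₂ C′ q : ℕ) (card≡ : card letters ≡ 2 * C′)
    (bound : (C′ ^ card letters) ^ m ≤ (card (fins N) ^ k′) ^ r₁)
    (r₂-large : 2 * ((h + h) * subgroupCount) ≤ 2 ^ r₂) (q≤N : q ≤ N) (wrap : suc k′ * q ≤ N) where
    private
      n r : ℕ
      n = m * card letters
      r = r₁ + r₂
      WF = words n
      ZF = vecs (fins N) r
      KF = vecs (vecs (fins N) k′) r
      open Sphere N q r q≤N

      Iso : Vec (Vec (Fin N) n) r → Vec Letter n → Set
      Iso = Isolated m r₁ r₂ C′ k′ card≡ refl bound

      iso? : ∀ L w → Dec (Iso L w)
      iso? = isolated? m r₁ r₂ C′ k′ card≡ refl bound

    Good : Vec (Vec (Fin N) n) r → Vec (Vec (Fin N) k′) r → Vec Letter n → Set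
    Good L κ w = (Uniform m w × Iso L w) × key L w ≡ κ

    Selected : Vec (Vec (Fin N) n) r → Vec (Vec (Fin N) k′) r → ℕ → Vec (Fin N) r → Vec Letter n → Set
    Selected L κ R s w = Good L κ w × OnSphere R (shifted L s w)

    good? : ∀ L κ w → Dec (Good L κ w)
    good? L κ w = (uniform? m w ×-dec iso? L w) ×-dec Finite._≟_ KF (key L w) κ

    selected? : ∀ L κ R s w → Dec (Selected L κ R s w)
    selected? L κ R s w = good? L κ w ×-dec onSphere? R (shifted L s w)

    module _ (L : Vec (Vec (Fin N) n) r) (κ : Vec (Vec (Fin N) k′) r) (R : ℕ) (s : Vec (Fin N) r) where

      -- `w′` shares row i and all hashes with `ws i`, which is isolated.
      glued : (ws : Fin (h + h) → Vec Letter n) → (∀ i → Selected L κ R s (ws i)) → ∀ w′ → (∀ i → row i w′ ≡ row i (ws i)) →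
        ∀ i → w′ ≡ ws i
      glued ws sel w′ rows i = proj₂ (proj₁ (proj₁ (sel i))) i w′ (sym (rows i))
        (agree-with-all L q q≤N wrap R κ s ws w′ (λ i → proj₂ (proj₁ (sel i))) (λ i → proj₂ (sel i)) rows i)

      -- `w` is itself glued from selected words, namely row i from `v` and every other row from
      -- `w`; so `glued` identifies it with `v`.
      row-injective : ∀ w v → Selected L κ R s w → Selected L κ R s v → ∀ i → row i w ≡ row i v → w ≡ v
      row-injective w v sw sv i e = trans (glued ws sel w rows i) (ws-i (i Fin.≟ i))
        where
        choose : ∀ {j} → Dec (j ≡ i) → Vec Letter n
        choose (yes _) = v
        choose (no _) = w
        ws : Fin (h + h) → Vec Letter n
        ws j = choose (j Fin.≟ i)
        sel′ : ∀ {j} (d : Dec (j ≡ i)) → Selected L κ R s (choose d)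
        sel′ (yes _) = sv
        sel′ (no _) = sw
        sel : ∀ j → Selected L κ R s (ws j)
        sel j = sel′ (j Fin.≟ i)
        rows′ : ∀ {j} (d : Dec (j ≡ i)) → row j w ≡ row j (choose d)
        rows′ (yes refl) = e
        rows′ (no _) = refl
        rows : ∀ j → row j w ≡ row j (ws j)
        rows j = rows′ (j Fin.≟ i)
        ws-i : (d : Dec (i ≡ i)) → choose d ≡ v
        ws-i (yes _) = refl
        ws-i (no i≢i) = contradiction refl i≢i

      private
        edge : Vec Letter n → Vec (Vec (Fin 2) n) (h + h)
        edge w = tabulate (λ i → row i w)

        lookup-edge : ∀ w i → lookup (edge w) i ≡ row i w
        lookup-edge w i = Vec.lookup∘tabulate (λ i → row i w) i

        edge-column : ∀ w j → Vec.map (λ v → lookup v j) (edge w) ≡ proj₁ (lookup w j)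
        edge-column w j = vec-ext (λ i → trans (Vec.lookup-map i _ (edge w)) (trans (cong (λ v → lookup v j) (lookup-edge w i))
          (Vec.lookup-map j (λ x → bit x i) w)))

        toWord : ∀ a → KronPow (PhiBal h) n a → Vec Letter n
        toWord a φ = tabulate (λ j → Vec.map (λ v → lookup v j) a , φ j)

        row-toWord : ∀ a φ i → row i (toWord a φ) ≡ lookup a i
        row-toWord a φ i = vec-ext (λ j → trans (Vec.lookup-map j (λ x → bit x i) (toWord a φ))
          (trans (cong (λ x → bit x i) (Vec.lookup∘tabulate (λ j → Vec.map (λ v → lookup v j) a , φ j) j)) (Vec.lookup-map i (λ v → lookup v j) a)))

      matching-of-selected : SubrankAtLeast (KronPow (PhiBal h) n) (# WF (selected? L κ R s))
      matching-of-selected = edge ∘ Ψ , record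
        { subset = λ p j → trans (cong countOnes (edge-column (Ψ p) j)) (proj₂ (lookup (Ψ p) j))
        ; distinct = λ p q p≢q e → differ p q p≢q zero (cong (λ a → lookup a zero) e)
        ; matching = differ
        ; induced = λ a φ cover → let
            ps = λ i → proj₁ (cover i)
            rows = λ i → trans (row-toWord a φ i) (trans (sym (proj₂ (cover i))) (lookup-edge (Ψ (ps i)) i))
            w≡ = glued (Ψ ∘ ps) (valid ∘ ps) (toWord a φ) rows zero
          in ps zero , vec-ext (λ i → trans (lookup-edge (Ψ (ps zero)) i) (trans (cong (row i) (sym w≡)) (row-toWord a φ i))) }
        where
        extracted = extract WF (selected? L κ R s)
        Ψ = proj₁ extracted
        valid = proj₁ (proj₂ extracted)
        differ : ∀ p q → p ≢ q → ∀ i → lookup (edge (Ψ p)) i ≢ lookup (edge (Ψ q)) i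
        differ p q p≢q i e = p≢q (proj₂ (proj₂ extracted) p q (row-injective (Ψ p) (Ψ q) (valid p) (valid q) i
          (trans (sym (lookup-edge (Ψ p) i)) (trans e (lookup-edge (Ψ q) i)))))

    private
      popular-key : ∀ L → ∃ λ κ → # WF (λ w → uniform? m w ×-dec iso? L w) ≤ (N ^ k′) ^ r * # WF (good? L κ)
      popular-key L = let κ , le = average-≥ (Vec.replicate r (Vec.replicate k′ 𝟘)) (elems KF) (λ κ → # WF (good? L κ)) in
        κ , (begin
          # WF (λ w → uniform? m w ×-dec iso? L w)
            ≡⟨ ∑-fibres KF (elems WF) (key L) _ ⟩
          ∑ᶠ KF (λ κ → ∑ᶠ WF (λ w → 𝟙 (Finite._≟_ KF κ (key L w)) * 𝟙 (uniform? m w ×-dec iso? L w)))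
            ≡⟨ ∑-cong (elems KF) (λ κ → ∑-cong (elems WF) (λ w → sym (𝟙-× (Finite._≟_ KF κ (key L w)) (uniform? m w ×-dec iso? L w) (good? L κ w)
                 (λ (g , e) → sym e , g) (λ e g → g , sym e)))) ⟩
          ∑ᶠ KF (λ κ → # WF (good? L κ))
            ≤⟨ le ⟩
          card KF * # WF (good? L κ)
            ≡⟨ cong (_* # WF (good? L κ)) (trans (card-vec (vecs (fins N) k′) r) (cong (_^ r)
                 (trans (card-vec (fins N) k′) (cong (_^ k′) (card-fin N))))) ⟩
          (N ^ k′) ^ r * # WF (good? L κ) ∎)
        where open ≤-Reasoning

      -- For each good word, at least as many translations `s` bring its reference onto the sphere
      -- as the sphere has points. Averaging over `s` retains the density of the sphere.
      popular-shift : ∀ L κ R → ∃ λ s → # WF (good? L κ) * # ZF (onSphere? R) ≤ N ^ r * # WF (selected? L κ R s)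
      popular-shift L κ R = let s , le = average-≥ (Vec.replicate r 𝟘) (elems ZF) (λ s → # WF (selected? L κ R s)) in
        s , (begin
          # WF (good? L κ) * # ZF (onSphere? R)
            ≡⟨ ∑-*ʳ (elems WF) (# ZF (onSphere? R)) _ ⟨
          ∑ᶠ WF (λ w → 𝟙 (good? L κ w) * # ZF (onSphere? R))
            ≤⟨ ∑-mono (elems WF) (λ w → *-monoʳ-≤ (𝟙 (good? L κ w)) (translate w)) ⟩
          ∑ᶠ WF (λ w → 𝟙 (good? L κ w) * # ZF (λ s → onSphere? R (shifted L s w)))
            ≡⟨ ∑-cong (elems WF) (λ w → trans (sym (∑-*ˡ (elems ZF) (𝟙 (good? L κ w)) _)) (∑-cong (elems ZF) (λ s →
                 sym (𝟙-× (good? L κ w) (onSphere? R (shifted L s w)) (selected? L κ R s w) id _,_)))) ⟩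
          ∑ᶠ WF (λ w → # ZF (λ s → selected? L κ R s w))
            ≡⟨ ∑-swap (elems WF) (elems ZF) _ ⟩
          ∑ᶠ ZF (λ s → # WF (selected? L κ R s))
            ≤⟨ le ⟩
          card ZF * # WF (selected? L κ R s)
            ≡⟨ cong (_* # WF (selected? L κ R s)) (trans (card-vec (fins N) r) (cong (_^ r) (card-fin N))) ⟩
          N ^ r * # WF (selected? L κ R s) ∎)
        where
        open ≤-Reasoning
        module V = IsAbelianGroup (vec-isAbelianGroup isAbelianGroup r)
        module VP = AbelianGroupProperties (bundle (vec-isAbelianGroup isAbelianGroup r))
        translate : ∀ w → # ZF (onSphere? R) ≤ # ZF (λ s → onSphere? R (shifted L s w))
        translate w = #-injection ZF ZF (onSphere? R) (λ s → onSphere? R (shifted L s w)) (λ t → Vec.zipWith _⊕_ t (Vec.map ⊖_ (reference L w)))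
          (λ t on → subst (OnSphere R) (sym (trans (V.assoc t _ _) (trans (cong (Vec.zipWith _⊕_ t) (V.inverseˡ (reference L w))) (V.identityʳ t)))) on)
          (λ t t′ _ _ → VP.∙-cancelʳ (Vec.map ⊖_ (reference L w)) t t′)

    -- The losses relative to the number of uniform words are 2 for isolation, N^(k′r) for the key,
    -- and (r q² + 1)(N/q)^r for the sphere.
    large-matching : ∃ λ s → SubrankAtLeast (KronPow (PhiBal h) n) s ×
      # WF (uniform? m) * q ^ r ≤ 2 * (N ^ k′) ^ r * (suc (r * (q * q)) * (N ^ r * s))
    large-matching =
      let L , U≤ = isolating-functionals m r₁ r₂ C′ k′ card≡ refl bound r₂-large
          κ , I≤ = popular-key L
          R , q≤ = large-sphere
          s , J≤ = popular-shift L κ R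
      in # WF (selected? L κ R s) , matching-of-selected L κ R s ,
         combine _ _ _ _ _ (# WF (selected? L κ R s)) ((N ^ k′) ^ r) (suc (r * (q * q))) (N ^ r) U≤ I≤ q≤ J≤
      where
      combine : ∀ U I J Q B S P E M′ → U ≤ 2 * I → I ≤ P * J → Q ≤ E * B → J * B ≤ M′ * S →
        U * Q ≤ 2 * P * (E * (M′ * S))
      combine U I J Q B S P E M′ U≤ I≤ Q≤ J≤ = begin
        U * Q ≤⟨ *-mono-≤ (≤-trans U≤ (*-monoʳ-≤ 2 I≤)) Q≤ ⟩
        2 * (P * J) * (E * B) ≡⟨ e P J E B ⟩
        2 * P * (E * (J * B)) ≤⟨ *-monoʳ-≤ (2 * P) (*-monoʳ-≤ E J≤) ⟩
        2 * P * (E * (M′ * S)) ∎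
        where
        open ≤-Reasoning
        e : ∀ P J E B → 2 * (P * J) * (E * B) ≡ 2 * P * (E * (J * B))
        e = solve-∀

-- Padding and the trivial upper bound

module _ {k n s : ℕ} {Φ : KGraph k (Fin 2)} (v₀ : Vec (Fin 2) k) (φ₀ : Φ v₀) where

  -- All edges receive the same first column `v₀`, and any edge covered by them must have that
  -- column too. Repetition reaches the exponents that are not multiples of C.
  pad : SubrankAtLeast (KronPow Φ n) s → SubrankAtLeast (KronPow Φ (suc n)) s
  pad (Ψ , M) = extend ∘ Ψ , record
    { subset = λ { p zero → subst Φ (sym (head-extend (Ψ p))) φ₀ ; p (suc j) → subst Φ (sym (tail-extend (Ψ p) j)) (subset p j) }
    ; distinct = λ p q p≢q e → distinct p q p≢q (vec-ext (λ i → tails (Ψ p) (Ψ q) i (cong (λ a → lookup a i) e)))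
    ; matching = λ p q p≢q i e → matching p q p≢q i (tails (Ψ p) (Ψ q) i e)
    ; induced = λ a φ cover → let
        a⁻ = Vec.map Vec.tail a
        p , Ψp≡ = induced a⁻ (λ j → subst Φ (sym (column-tail a j)) (φ (suc j)))
          (λ i → proj₁ (cover i) , trans (cong Vec.tail (trans (sym (lookup-extend (Ψ (proj₁ (cover i))) i)) (proj₂ (cover i)))) (sym (Vec.lookup-map i Vec.tail a)))
      in p , vec-ext (λ i → trans (lookup-extend (Ψ p) i) (trans (cong (lookup v₀ i ∷_) (trans (cong (λ b → lookup b i) Ψp≡) (Vec.lookup-map i Vec.tail a)))
           (glue (lookup a i) (trans (sym (lookup-extend (Ψ (proj₁ (cover i))) i)) (proj₂ (cover i)))))) }
    where
    open IsInducedMatching M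
    extend : Vec (Vec (Fin 2) n) k → Vec (Vec (Fin 2) (suc n)) k
    extend = Vec.zipWith _∷_ v₀
    lookup-extend : ∀ a i → lookup (extend a) i ≡ lookup v₀ i ∷ lookup a i
    lookup-extend a i = Vec.lookup-zipWith _∷_ i v₀ a
    head-extend : ∀ a → Vec.map (λ v → lookup v zero) (extend a) ≡ v₀
    head-extend a = vec-ext (λ i → trans (Vec.lookup-map i (λ v → lookup v zero) (extend a)) (cong (λ v → lookup v zero) (lookup-extend a i)))
    tail-extend : ∀ a j → Vec.map (λ v → lookup v (suc j)) (extend a) ≡ Vec.map (λ v → lookup v j) a
    tail-extend a j = vec-ext (λ i → trans (Vec.lookup-map i (λ v → lookup v (suc j)) (extend a))
      (trans (cong (λ v → lookup v (suc j)) (lookup-extend a i)) (sym (Vec.lookup-map i (λ v → lookup v j) a))))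
    tails : ∀ a b i → lookup (extend a) i ≡ lookup (extend b) i → lookup a i ≡ lookup b i
    tails a b i e = Vec.∷-injectiveʳ (trans (sym (lookup-extend a i)) (trans e (lookup-extend b i)))
    column-tail : ∀ a j → Vec.map (λ v → lookup v j) (Vec.map Vec.tail a) ≡ Vec.map (λ v → lookup v (suc j)) a
    column-tail a j = vec-ext (λ i → trans (Vec.lookup-map i (λ v → lookup v j) (Vec.map Vec.tail a))
      (trans (cong (λ v → lookup v j) (Vec.lookup-map i Vec.tail a)) (trans (tail-lookup (lookup a i)) (sym (Vec.lookup-map i (λ v → lookup v (suc j)) a)))))
      where
      tail-lookup : ∀ v → lookup (Vec.tail v) j ≡ lookup v (suc j)
      tail-lookup (x ∷ v) = refl
    glue : ∀ {x : Fin 2} {u} (v : Vec (Fin 2) (suc n)) → x ∷ u ≡ v → x ∷ Vec.tail v ≡ v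
    glue v refl = refl

padding : ∀ {k n s} {Φ : KGraph k (Fin 2)} (v₀ : Vec (Fin 2) k) → Φ v₀ → ∀ j →
  SubrankAtLeast (KronPow Φ n) s → SubrankAtLeast (KronPow Φ (j + n)) s
padding v₀ φ₀ zero = id
padding {Φ = Φ} v₀ φ₀ (suc j) = pad {Φ = Φ} v₀ φ₀ ∘ padding {Φ = Φ} v₀ φ₀ j

subrank≤2^n : ∀ {k} n (Φ : KGraph (suc k) (Fin 2)) → SubrankAtMost (KronPow Φ n) (2 ^ n)
subrank≤2^n n Φ t Ψ M = begin
  t ≡⟨ card-fin t ⟨
  card (fins t) ≡⟨ card-∑ (fins t) ⟩
  # (fins t) (λ _ → yes tt) ≤⟨ #-injection (fins t) (vecs (fins 2) n) (λ _ → yes tt) (λ _ → yes tt)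
      (λ p → lookup (Ψ p) zero) (λ _ _ → tt) (λ p q _ _ → injective p q) ⟩
  # (vecs (fins 2) n) (λ _ → yes tt) ≡⟨ card-∑ (vecs (fins 2) n) ⟨
  card (vecs (fins 2) n) ≡⟨ card-vec (fins 2) n ⟩
  2 ^ n ∎
  where
  open ≤-Reasoning
  injective : ∀ p q → lookup (Ψ p) zero ≡ lookup (Ψ q) zero → p ≡ q
  injective p q e with p Fin.≟ q
  ... | yes p≡q = p≡q
  ... | no p≢q = contradiction e (IsInducedMatching.matching M p q p≢q zero)

balancedWord : ∀ a b → Vec (Fin 2) (a + b)
balancedWord zero b = Vec.replicate b (suc zero)
balancedWord (suc a) b = zero ∷ balancedWord a b

countOnes-balancedWord : ∀ a b → countOnes (balancedWord a b) ≡ a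
countOnes-balancedWord zero zero = refl
countOnes-balancedWord zero (suc b) = countOnes-balancedWord zero b
countOnes-balancedWord (suc a) b = cong suc (countOnes-balancedWord a b)

-- Growth estimates

n<2^n : ∀ n → n < 2 ^ n
n<2^n zero = s≤s z≤n
n<2^n (suc n) = begin-strict
  suc n ≤⟨ n<2^n n ⟩
  2 ^ n <⟨ m<m+n (2 ^ n) (1≤^ n (s≤s z≤n)) ⟩
  2 ^ n + 2 ^ n ≡⟨ cong (2 ^ n +_) (+-identityʳ (2 ^ n)) ⟨
  2 ^ suc n ∎
  where open ≤-Reasoning

^-cancelˡ-≤ : ∀ e {x y} → 1 ≤ e → x ^ e ≤ y ^ e → x ≤ y
^-cancelˡ-≤ (suc e) {x} {y} _ le with x ≤? y
... | yes x≤y = x≤y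
... | no x≰y = contradiction le (<⇒≱ (^-monoˡ-< (suc e) (≰⇒> x≰y)))

-- Rounding X up to a power of P costs at most a factor P. It determines the least convenient number
-- of functionals for which the semistability bound holds.
logarithm : ∀ P X → 2 ≤ P → 1 ≤ X → ∃ λ r → X ≤ P ^ r × P ^ r ≤ P * X
logarithm P (suc zero) P≥2 _ = 0 , ≤-refl , ≤-trans (<⇒≤ P≥2) (≤-reflexive (sym (*-identityʳ P)))
logarithm P (suc X@(suc _)) P≥2 _ with logarithm P X P≥2 (s≤s z≤n)
... | r , X≤ , ≤PX with suc X ≤? P ^ r
... | yes le = r , le , ≤-trans ≤PX (*-monoʳ-≤ P (n≤1+n X))
... | no nle = suc r , (begin
        suc X ≤⟨ s≤s (m≤n+m X _) ⟩
        X + X ≡⟨ cong (X +_) (+-identityʳ X) ⟨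
        2 * X ≤⟨ *-mono-≤ P≥2 X≤ ⟩
        P * P ^ r ∎) , *-monoʳ-≤ P (<⇒≤ (≰⇒> nle))
  where open ≤-Reasoning

bernoulli : ∀ B t → (B + t) * B ^ t ≤ B * suc B ^ t
bernoulli B zero = ≤-reflexive (cong (_* 1) (+-identityʳ B))
bernoulli B (suc t) = begin
  (B + suc t) * (B * B ^ t) ≤⟨ m≤m+n _ (t * B ^ t) ⟩
  (B + suc t) * (B * B ^ t) + t * B ^ t ≡⟨ e B t (B ^ t) ⟩
  suc B * ((B + t) * B ^ t) ≤⟨ *-monoʳ-≤ (suc B) (bernoulli B t) ⟩
  suc B * (B * suc B ^ t) ≡⟨ e′ B (suc B ^ t) ⟩
  B * (suc B * suc B ^ t) ∎
  where
  open ≤-Reasoning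
  e : ∀ B t x → (B + suc t) * (B * x) + t * x ≡ suc B * ((B + t) * x)
  e = solve-∀
  e′ : ∀ B x → suc B * (B * x) ≡ B * (suc B * x)
  e′ = solve-∀

-- Bernoulli's inequality gives (1 + 1/B)^t ≥ 1 + t/B ≥ 32 for t = 31B + 1. The constant is 2·4·4: a
-- factor 2^n will cover the polynomial terms, and a factor 4^n each of two occurrences of `β`.
32B^t≤A^t : ∀ B → 1 ≤ B → 32 * B ^ suc (31 * B) ≤ suc B ^ suc (31 * B)
32B^t≤A^t B B≥1 = *-cancelˡ-≤⁺ B B≥1 (begin
  B * (32 * B ^ t) ≡⟨ e B (B ^ t) ⟩
  (B + 31 * B) * B ^ t ≤⟨ *-monoˡ-≤ (B ^ t) (+-monoʳ-≤ B (n≤1+n (31 * B))) ⟩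
  (B + t) * B ^ t ≤⟨ bernoulli B t ⟩
  B * suc B ^ t ∎)
  where
  open ≤-Reasoning
  t = suc (31 * B)
  e : ∀ B x → B * (32 * x) ≡ (B + 31 * B) * x
  e = solve-∀

exponential-dominates : ∀ c d → ∃ λ n₀ → ∀ n → n₀ ≤ n → c * suc n ^ d ≤ 2 ^ n
-- With u the quotient of n by e, this threshold makes c e^d ≤ u < 2^u, while suc n ≤ e 2^u; the
-- product of the resulting powers is 2^(u(d+1)), and u(d+1) ≤ n by the choice of e.
exponential-dominates c d = e * (c * e ^ d) , bound
  where
  e = suc (suc (2 * d))
  bound : ∀ n → e * (c * e ^ d) ≤ n → c * suc n ^ d ≤ 2 ^ n
  bound n n₀≤n = begin
    c * suc n ^ d ≤⟨ *-monoʳ-≤ c (^-monoˡ-≤ d n<) ⟩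
    c * (e * 2 ^ u) ^ d ≡⟨ cong (c *_) (^-distribʳ-* d e (2 ^ u)) ⟩
    c * (e ^ d * (2 ^ u) ^ d) ≡⟨ *-assoc c (e ^ d) _ ⟨
    c * e ^ d * (2 ^ u) ^ d ≤⟨ *-monoˡ-≤ ((2 ^ u) ^ d) (≤-trans u-large (<⇒≤ (n<2^n u))) ⟩
    2 ^ u * (2 ^ u) ^ d ≡⟨ ^-*-assoc 2 u (suc d) ⟩
    2 ^ (u * suc d) ≤⟨ ^-monoʳ-≤ 2 exponent ⟩
    2 ^ n ∎
    where
    open ≤-Reasoning
    u = n / e
    u-large : c * e ^ d ≤ u
    u-large = ≤-trans (≤-reflexive (sym (m*n/m≡n e (c * e ^ d)))) (/-monoˡ-≤ e n₀≤n)
      where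
      m*n/m≡n : ∀ m n .{{_ : NonZero m}} → (m * n) / m ≡ n
      m*n/m≡n m n = trans (cong (_/ m) (*-comm m n)) (m*n/n≡m n m)
    n< : suc n ≤ e * 2 ^ u
    n< = begin
      suc n ≡⟨ cong suc (m≡m%n+[m/n]*n n e) ⟩
      suc (n % e) + u * e ≤⟨ +-monoˡ-≤ (u * e) (m%n<n n e) ⟩
      e + u * e ≡⟨ *-comm (suc u) e ⟩
      e * suc u ≤⟨ *-monoʳ-≤ e (n<2^n u) ⟩
      e * 2 ^ u ∎
    exponent : u * suc d ≤ n
    exponent = begin
      u * suc d ≤⟨ *-monoʳ-≤ u (s≤s (≤-trans (m≤n*m d 2) (n≤1+n (2 * d)))) ⟩
      u * e ≤⟨ m/n*n≤m n e ⟩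
      n ∎

odd-power : ∀ a e → ∃ λ M → suc (2 * a) ^ e ≡ suc (2 * M)
odd-power a zero = 0 , refl
odd-power a (suc e) with odd-power a e
... | M , eq = a + M + 2 * (a * M) , trans (cong (suc (2 * a) *_) eq) (lemma a M)
  where
  lemma : ∀ a M → suc (2 * a) * suc (2 * M) ≡ suc (2 * (a + M + 2 * (a * M)))
  lemma = solve-∀

-- Choice of parameters and the lower bound

module MatchingBound (M h₂ : ℕ) (M≥1 : 1 ≤ M) where
  open Cyclic M
  open Hashing (fins N) isAbelianGroup half half-double (π 1) (one≢𝟘 M≥1) (suc (suc h₂)) using (subgroupCount)
  open Words (Letters.letters (suc (suc h₂)))
  private
    h k′ C : ℕ
    h = suc (suc h₂)
    k′ = h₂ + h
    C = card (Letters.letters h)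

  matching-bound : ∃ λ r₂ → ∀ m r₁ C′ q → C ≡ 2 * C′ → (C′ ^ C) ^ m ≤ (N ^ k′) ^ r₁ → q ≤ N → suc k′ * q ≤ N →
    ∃ λ s → SubrankAtLeast (KronPow (PhiBal h) (m * C)) s ×
      C ^ (m * C) * q ^ (r₁ + r₂) ≤
        suc (m * C) ^ C * (2 * (N ^ k′) ^ (r₁ + r₂) * (suc ((r₁ + r₂) * (q * q)) * (N ^ (r₁ + r₂) * s)))
  matching-bound = r₂ , λ m r₁ C′ q card≡ bound q≤N wrap →
    let s , matching , le = Selection.large-matching M h₂ M≥1 m r₁ r₂ C′ q card≡
          (subst (λ N → (C′ ^ C) ^ m ≤ (N ^ k′) ^ r₁) (sym (card-fin N)) bound) (<⇒≤ (n<2^n r₂)) q≤N wrap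
    in s , matching , collect (C ^ (m * C)) (# (words (m * C)) (uniform? m)) (suc (m * C) ^ C) (q ^ (r₁ + r₂)) _ (#-uniform m) le
    where
    r₂ : ℕ
    -- The required power of 2 is available because x ≤ 2^x; what matters is that this number does
    -- not depend on n.
    r₂ = 2 * ((h + h) * subgroupCount)
    collect : ∀ a U W Q S → a ≤ U * W → U * Q ≤ S → a * Q ≤ W * S
    collect a U W Q S a≤ le = begin
      a * Q ≤⟨ *-monoˡ-≤ Q a≤ ⟩
      U * W * Q ≡⟨ e U W Q ⟩
      W * (U * Q) ≤⟨ *-monoʳ-≤ W le ⟩
      W * S ∎
      where
      open ≤-Reasoning
      e : ∀ U W Q → U * W * Q ≡ W * (U * Q)
      e = solve-∀

module LowerBound (h₂ μ : ℕ) where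
  private
    h k′ ν t₀ t b q : ℕ
    h = suc (suc h₂)
    k′ = h₂ + h
    -- The target is (ν/(μ+1))^n. Since ν + 1 = 2(μ+1), it equals 2^n (ν/(ν+1))^n, which leaves room
    -- for losses up to ((ν+1)/ν)^n.
    ν = 2 * μ + 1
    t₀ = 31 * ν
    t = suc t₀
    -- The odd number k + 1 makes N = b^t odd and exceeds k - 1, as `wrap` requires. The ratio N/q =
    -- b is independent of t, while the number of functionals decreases like 1/t.
    b = suc (2 * h)
    q = b ^ t₀

    M : ℕ
    M = proj₁ (odd-power h t)

    open Letters h using (letters; #bit; card-letters)

    N C C′ : ℕ
    N = Cyclic.N M
    C = card letters
    C′ = #bit zero zero

    N≡ : N ≡ b * q
    N≡ = sym (proj₂ (odd-power h t))

    C≡ : C ≡ 2 * C′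
    C≡ = card-letters zero zero

    q>0 : 1 ≤ q
    q>0 = 1≤^ t₀ (s≤s z≤n)

    2<b : 2 < b
    2<b = s≤s (≤-trans (s≤s (s≤s z≤n)) (m≤n*m h 2))

    2<N : 2 < N
    2<N = begin
      3 ≤⟨ 2<b ⟩
      b ≡⟨ *-identityʳ b ⟨
      b * 1 ≤⟨ *-monoʳ-≤ b q>0 ⟩
      b * q ≡⟨ N≡ ⟨
      N ∎
      where open ≤-Reasoning

    M≥1 : 1 ≤ M
    M≥1 = positive M 2<N
      where
      positive : ∀ M → 2 < suc (2 * M) → 1 ≤ M
      positive zero (s≤s ())
      positive (suc M) _ = s≤s z≤n

    q≤N : q ≤ N
    q≤N = ≤-trans (m≤n*m q b) (≤-reflexive (sym N≡))

    wrap : suc k′ * q ≤ N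
    wrap = ≤-trans (*-monoˡ-≤ q small) (≤-reflexive (sym N≡))
      where
      small : suc k′ ≤ b
      small = s≤s (≤-trans (≤-trans (n≤1+n k′) (n≤1+n (suc k′))) (≤-reflexive (cong (h +_) (sym (+-identityʳ h)))))

    C>0 : 1 ≤ C
    C>0 = ≤-trans (∑-term (elems letters) (λ _ → 1)
      (complete letters (balancedWord h h , countOnes-balancedWord h h))) (≤-reflexive (sym (card-∑ letters)))

    C′>0 : 1 ≤ C′
    C′>0 = positive C′ (subst (1 ≤_) C≡ C>0)
      where
      positive : ∀ c → 1 ≤ 2 * c → 1 ≤ c
      positive (suc c) _ = s≤s z≤n

    k′≥2 : 2 ≤ k′
    k′≥2 = ≤-trans (s≤s (s≤s z≤n)) (m≤n+m h h₂)

    -- From 2^(2 + k′) with k′ ≥ 2. The bound is a k′-th power so that a k′-th root can be taken in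
    -- `β-small`.
    C′≤ : C′ ≤ 4 ^ k′
    C′≤ = begin
      C′ ≤⟨ m≤n*m C′ 2 ⟩
      2 * C′ ≡⟨ C≡ ⟨
      C ≡⟨ card-∑ letters ⟩
      # letters (λ _ → yes tt) ≤⟨ #-injection letters (vecs (fins 2) (h + h)) (λ _ → yes tt) (λ _ → yes tt)
          proj₁ (λ _ _ → tt) (λ _ _ _ _ → Letters.letter-ext h) ⟩
      # (vecs (fins 2) (h + h)) (λ _ → yes tt) ≡⟨ card-∑ (vecs (fins 2) (h + h)) ⟨
      card (vecs (fins 2) (h + h)) ≡⟨ card-vec (fins 2) (h + h) ⟩
      2 ^ (2 + k′) ≤⟨ ^-monoʳ-≤ 2 (+-monoˡ-≤ k′ k′≥2) ⟩
      2 ^ (k′ + k′) ≡⟨ cong (λ e → 2 ^ (k′ + e)) (+-identityʳ k′) ⟨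
      2 ^ (2 * k′) ≡⟨ ^-*-assoc 2 2 k′ ⟨
      4 ^ k′ ∎
      where open ≤-Reasoning

    𝒫 : ℕ
    𝒫 = N ^ k′

    𝒫≥2 : 2 ≤ 𝒫
    𝒫≥2 = begin
      2 ≤⟨ <⇒≤ 2<N ⟩
      N ≡⟨ ^-identityʳ N ⟨
      N ^ 1 ≤⟨ ^-monoʳ-≤ N (<⇒≤ k′≥2) ⟩
      N ^ k′ ∎
      where open ≤-Reasoning

    r₂ : ℕ
    r₂ = proj₁ (MatchingBound.matching-bound M h₂ M≥1)

    -- `c₁` gathers the factors independent of n: 2^C for the remainder of n modulo C, one 𝒫 for
    -- rounding `r₁`, and the contributions of the `r₂` additional functionals. `c₂` is its t-th
    -- power with one b^t from each use of `β-small`.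
    E₀ c₁ c₂ : ℕ
    E₀ = suc (suc r₂ * (q * q))
    c₁ = 2 ^ C * (2 * (𝒫 * 𝒫 ^ r₂) * (E₀ * b ^ r₂))
    c₂ = c₁ ^ t * (b ^ t * b ^ t)

    module _ (n : ℕ) where
      instance
        C-nonZero : NonZero C
        C-nonZero = >-nonZero C>0

      m n₀ X : ℕ
      m = n / C
      n₀ = m * C
      X = (C′ ^ C) ^ m

      n₀≤n : n₀ ≤ n
      n₀≤n = m/n*n≤m n C

      n≡ : n ≡ n % C + n₀
      n≡ = m≡m%n+[m/n]*n n C

      X>0 : 1 ≤ X
      X>0 = 1≤^ m (1≤^ C C′>0)

      X≡ : X ≡ C′ ^ n₀
      X≡ = trans (^-*-assoc C′ C m) (cong (C′ ^_) (*-comm C m))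

      r₁ β : ℕ
      r₁ = proj₁ (logarithm 𝒫 X 𝒫≥2 X>0)
      β = b ^ r₁

      X≤ : X ≤ 𝒫 ^ r₁
      X≤ = proj₁ (proj₂ (logarithm 𝒫 X 𝒫≥2 X>0))

      ≤𝒫X : 𝒫 ^ r₁ ≤ 𝒫 * X
      ≤𝒫X = proj₂ (proj₂ (logarithm 𝒫 X 𝒫≥2 X>0))

      -- The number of functionals is at most 2n / log N, so that β = b ^ r₁ is a small exponential for large t.
      β-small : β ^ t ≤ b ^ t * 4 ^ n
      β-small = ^-cancelˡ-≤ k′ (<⇒≤ k′≥2) (begin
        (β ^ t) ^ k′ ≡⟨ cong (_^ k′) (trans (^-*-assoc b r₁ t) (trans (cong (b ^_) (*-comm r₁ t)) (sym (^-*-assoc b t r₁)))) ⟩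
        ((b ^ t) ^ r₁) ^ k′ ≡⟨ trans (^-*-assoc (b ^ t) r₁ k′) (trans (cong ((b ^ t) ^_) (*-comm r₁ k′)) (sym (^-*-assoc (b ^ t) k′ r₁))) ⟩
        ((b ^ t) ^ k′) ^ r₁ ≡⟨ cong (λ N → (N ^ k′) ^ r₁) N≡ ⟨
        𝒫 ^ r₁ ≤⟨ ≤𝒫X ⟩
        𝒫 * X ≡⟨ cong₂ (λ N X → N ^ k′ * X) N≡ X≡ ⟩
        (b ^ t) ^ k′ * C′ ^ n₀ ≤⟨ *-monoʳ-≤ ((b ^ t) ^ k′) (≤-trans (^-monoˡ-≤ n₀ C′≤) (^-monoʳ-≤ (4 ^ k′) {{>-nonZero (1≤^ k′ (s≤s z≤n))}} n₀≤n)) ⟩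
        (b ^ t) ^ k′ * (4 ^ k′) ^ n ≡⟨ cong ((b ^ t) ^ k′ *_) (trans (^-*-assoc 4 k′ n) (trans (cong (4 ^_) (*-comm k′ n)) (sym (^-*-assoc 4 n k′)))) ⟩
        (b ^ t) ^ k′ * (4 ^ n) ^ k′ ≡⟨ ^-distribʳ-* k′ (b ^ t) (4 ^ n) ⟨
        (b ^ t * 4 ^ n) ^ k′ ∎)
        where open ≤-Reasoning

      -- Since C = 2C′, the left side contains 2^n₀ X. The key costs X up to the factor 𝒫 from
      -- rounding, and N^r / q^r = b^r, so X and q^r cancel and only 2^n₀ survives.
      cancelled : ∀ s W E → C ^ n₀ * q ^ (r₁ + r₂) ≤ W * (2 * 𝒫 ^ (r₁ + r₂) * (E * (N ^ (r₁ + r₂) * s))) →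
        2 ^ n₀ ≤ W * (2 * (𝒫 * 𝒫 ^ r₂) * (E * (β * b ^ r₂ * s)))
      cancelled s W E le = *-cancelʳ-≤⁺ (X * q ^ r) (*-mono-≤ X>0 (1≤^ r q>0)) (begin
        2 ^ n₀ * (X * q ^ r) ≡⟨ *-assoc (2 ^ n₀) X _ ⟨
        2 ^ n₀ * X * q ^ r ≡⟨ cong (λ x → 2 ^ n₀ * x * q ^ r) X≡ ⟩
        2 ^ n₀ * C′ ^ n₀ * q ^ r ≡⟨ cong (_* q ^ r) (^-distribʳ-* n₀ 2 C′) ⟨
        (2 * C′) ^ n₀ * q ^ r ≡⟨ cong (λ c → c ^ n₀ * q ^ r) C≡ ⟨
        C ^ n₀ * q ^ r ≤⟨ le ⟩
        W * (2 * 𝒫 ^ r * (E * (N ^ r * s)))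
            ≡⟨ cong₂ (λ x y → W * (2 * x * (E * (y * s)))) (^-distribˡ-+-* 𝒫 r₁ r₂)
            (trans (cong (_^ r) N≡) (trans (^-distribʳ-* r b q) (cong (_* q ^ r) (^-distribˡ-+-* b r₁ r₂)))) ⟩
        W * (2 * (𝒫 ^ r₁ * 𝒫 ^ r₂) * (E * (β * b ^ r₂ * q ^ r * s)))
            ≤⟨ *-monoʳ-≤ W (*-monoˡ-≤ (E * (β * b ^ r₂ * q ^ r * s)) (*-monoʳ-≤ 2 (*-monoˡ-≤ (𝒫 ^ r₂) ≤𝒫X))) ⟩
        W * (2 * (𝒫 * X * 𝒫 ^ r₂) * (E * (β * b ^ r₂ * q ^ r * s)))
            ≡⟨ e W 𝒫 X (𝒫 ^ r₂) E (β * b ^ r₂) (q ^ r) s ⟩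
        W * (2 * (𝒫 * 𝒫 ^ r₂) * (E * (β * b ^ r₂ * s))) * (X * q ^ r) ∎)
        where
        open ≤-Reasoning
        r = r₁ + r₂
        e : ∀ W 𝒫 X P₂ E β Q s → W * (2 * (𝒫 * X * P₂) * (E * (β * Q * s))) ≡ W * (2 * (𝒫 * P₂) * (E * (β * s))) * (X * Q)
        e = solve-∀

      -- The number of spheres is linear in `r₁`, and r₁ ≤ b^r₁ = β. This is the second of the two
      -- factors `β` in `Y`.
      E-small : suc ((r₁ + r₂) * (q * q)) ≤ β * E₀
      E-small = begin
        suc ((r₁ + r₂) * (q * q)) ≡⟨ cong suc (*-distribʳ-+ (q * q) r₁ r₂) ⟩
        1 + (r₁ * (q * q) + r₂ * (q * q)) ≤⟨ +-mono-≤ β>0 (+-mono-≤ (*-monoˡ-≤ (q * q) r₁≤β) (≤-trans (≤-reflexive (sym (*-identityˡ _))) (*-monoˡ-≤ (r₂ * (q * q)) β>0))) ⟩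
        β + (β * (q * q) + β * (r₂ * (q * q))) ≡⟨ e β r₂ (q * q) ⟩
        β * E₀ ∎
        where
        open ≤-Reasoning
        β>0 : 1 ≤ β
        β>0 = 1≤^ r₁ (s≤s z≤n)
        r₁≤β : r₁ ≤ β
        r₁≤β = ≤-trans (<⇒≤ (n<2^n r₁)) (^-monoˡ-≤ r₁ (<⇒≤ 2<b))
        e : ∀ β r Q → β + (β * Q + β * (r * Q)) ≡ β * suc (suc r * Q)
        e = solve-∀

      Y : ℕ
      Y = c₁ * suc n ^ C * (β * β)

      many : ∀ s → C ^ n₀ * q ^ (r₁ + r₂) ≤ suc n₀ ^ C * (2 * 𝒫 ^ (r₁ + r₂) * (suc ((r₁ + r₂) * (q * q)) * (N ^ (r₁ + r₂) * s))) →
        2 ^ n ≤ Y * s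
      many s le = begin
        2 ^ n ≡⟨ cong (2 ^_) n≡ ⟩
        2 ^ (n % C + n₀) ≡⟨ ^-distribˡ-+-* 2 (n % C) n₀ ⟩
        2 ^ (n % C) * 2 ^ n₀ ≤⟨ *-mono-≤ (^-monoʳ-≤ 2 (<⇒≤ (m%n<n n C))) (cancelled s (suc n₀ ^ C) (suc ((r₁ + r₂) * (q * q))) le) ⟩
        2 ^ C * (suc n₀ ^ C * (2 * (𝒫 * 𝒫 ^ r₂) * (suc ((r₁ + r₂) * (q * q)) * (β * b ^ r₂ * s))))
            ≤⟨ *-monoʳ-≤ (2 ^ C) (*-mono-≤ (^-monoˡ-≤ C (s≤s n₀≤n)) (*-monoʳ-≤ (2 * (𝒫 * 𝒫 ^ r₂)) (*-monoˡ-≤ (β * b ^ r₂ * s) E-small))) ⟩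
        2 ^ C * (suc n ^ C * (2 * (𝒫 * 𝒫 ^ r₂) * (β * E₀ * (β * b ^ r₂ * s))))
            ≡⟨ e (2 ^ C) (suc n ^ C) (2 * (𝒫 * 𝒫 ^ r₂)) β E₀ (b ^ r₂) s ⟩
        Y * s ∎
        where
        open ≤-Reasoning
        e : ∀ D W 𝒫 β E b s → D * (W * (𝒫 * (β * E * (β * b * s)))) ≡ D * (𝒫 * (E * b)) * W * (β * β) * s
        e = solve-∀

      Y>0 : ∀ s → 2 ^ n ≤ Y * s → 1 ≤ Y
      Y>0 s le = positive Y (≤-trans (1≤^ n (s≤s z≤n)) le)
        where
        positive : ∀ y → 1 ≤ y * s → 1 ≤ y
        positive (suc y) _ = s≤s z≤n

      -- The comparison is made between t-th powers: the polynomial part is at most 2^n, each β^t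
      -- contributes 4^n, and the growth of (ν+1)^t over 32 ν^t covers all of them.
      Y-small : c₂ * suc n ^ (C * t) ≤ 2 ^ n → Y * ν ^ n ≤ suc ν ^ n
      Y-small n-large = ^-cancelˡ-≤ t (s≤s z≤n) (begin
        (c₁ * suc n ^ C * (β * β) * ν ^ n) ^ t
          ≡⟨ powers ⟩
        c₁ ^ t * suc n ^ (C * t) * (β ^ t * β ^ t) * (ν ^ t) ^ n
          ≤⟨ *-monoˡ-≤ ((ν ^ t) ^ n) (*-monoʳ-≤ (c₁ ^ t * suc n ^ (C * t)) (*-mono-≤ β-small β-small)) ⟩
        c₁ ^ t * suc n ^ (C * t) * (b ^ t * 4 ^ n * (b ^ t * 4 ^ n)) * (ν ^ t) ^ n
          ≡⟨ e (c₁ ^ t) (suc n ^ (C * t)) (b ^ t) (4 ^ n) ((ν ^ t) ^ n) ⟩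
        c₂ * suc n ^ (C * t) * (4 ^ n * 4 ^ n * (ν ^ t) ^ n)
          ≤⟨ *-monoˡ-≤ (4 ^ n * 4 ^ n * (ν ^ t) ^ n) n-large ⟩
        2 ^ n * (4 ^ n * 4 ^ n * (ν ^ t) ^ n)
          ≡⟨ collect ⟩
        (32 * ν ^ t) ^ n
          ≤⟨ ^-monoˡ-≤ n (32B^t≤A^t ν (m≤n+m 1 (2 * μ))) ⟩
        (suc ν ^ t) ^ n
          ≡⟨ trans (^-*-assoc (suc ν) t n) (trans (cong (suc ν ^_) (*-comm t n)) (sym (^-*-assoc (suc ν) n t))) ⟩
        (suc ν ^ n) ^ t ∎)
        where
        open ≤-Reasoning
        e : ∀ c S b f ν → c * S * (b * f * (b * f)) * ν ≡ c * (b * b) * S * (f * f * ν)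
        e = solve-∀
        powers : (c₁ * suc n ^ C * (β * β) * ν ^ n) ^ t ≡ c₁ ^ t * suc n ^ (C * t) * (β ^ t * β ^ t) * (ν ^ t) ^ n
        powers = trans (^-distribʳ-* t (c₁ * suc n ^ C * (β * β)) (ν ^ n)) (cong₂ _*_
          (trans (^-distribʳ-* t (c₁ * suc n ^ C) (β * β)) (cong₂ _*_
            (trans (^-distribʳ-* t c₁ (suc n ^ C)) (cong (c₁ ^ t *_) (^-*-assoc (suc n) C t)))
            (^-distribʳ-* t β β)))
          (trans (^-*-assoc ν n t) (trans (cong (ν ^_) (*-comm n t)) (sym (^-*-assoc ν t n)))))
        collect : 2 ^ n * (4 ^ n * 4 ^ n * (ν ^ t) ^ n) ≡ (32 * ν ^ t) ^ n
        collect = sym (trans (^-distribʳ-* n 32 (ν ^ t)) (trans (cong (_* (ν ^ t) ^ n)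
          (trans (^-distribʳ-* n 2 16) (cong (2 ^ n *_) (^-distribʳ-* n 4 4)))) (*-assoc (2 ^ n) (4 ^ n * 4 ^ n) _)))

      -- From Y ≤ ((ν+1)/ν)^n and 2^n ≤ Y s follows s ≥ (2ν/(ν+1))^n, and ν + 1 = 2(μ+1).
      finish : ∀ s → 2 ^ n ≤ Y * s → Y * ν ^ n ≤ suc ν ^ n → ν ^ n ≤ s * suc μ ^ n
      finish s 2^n≤ YB≤ = *-cancelˡ-≤⁺ Y (Y>0 s 2^n≤) (begin
        Y * ν ^ n ≤⟨ YB≤ ⟩
        suc ν ^ n ≡⟨ cong (_^ n) (e μ) ⟩
        (2 * suc μ) ^ n ≡⟨ ^-distribʳ-* n 2 (suc μ) ⟩
        2 ^ n * suc μ ^ n ≤⟨ *-monoˡ-≤ (suc μ ^ n) 2^n≤ ⟩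
        Y * s * suc μ ^ n ≡⟨ *-assoc Y s _ ⟩
        Y * (s * suc μ ^ n) ∎)
        where
        open ≤-Reasoning
        e : ∀ μ → suc (2 * μ + 1) ≡ 2 * suc μ
        e = solve-∀

      matching : c₂ * suc n ^ (C * t) ≤ 2 ^ n →
        ∃ λ s → SubrankAtLeast (KronPow (PhiBal h) n) s × ν ^ n ≤ s * suc μ ^ n
      matching n-large =
        let s , Ψ , le = proj₂ (MatchingBound.matching-bound M h₂ M≥1) m r₁ C′ q C≡ X≤ q≤N wrap
            2^n≤ = many s le
        in s , subst (λ n → SubrankAtLeast (KronPow (PhiBal h) n) s) (sym n≡)
                 (padding {Φ = PhiBal h} (balancedWord h h) (countOnes-balancedWord h h) (n % C) Ψ)
             , finish s 2^n≤ (Y-small n-large)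

  lower-bound : ∃ λ n₁ → ∀ n → n₁ ≤ n →
    ∃ λ s → SubrankAtLeast (KronPow (PhiBal (suc (suc h₂))) n) s × (2 * μ + 1) ^ n ≤ s * suc μ ^ n
  lower-bound = let n₁ , dominates = exponential-dominates c₂ (C * t) in n₁ , λ n n₁≤n → matching n (dominates n n₁≤n)

-- Convergence stated without real numbers: after division by (m+1)^n the inequalities enclose the
-- n-th root of the subrank between 2 - 1/(m+1) and 2 + 1/(m+1) for all large n, and m is arbitrary.
theorem1p2 : ∃ λ (k₀ : ℕ) → ∀ (h : ℕ) → k₀ ≤ h + h →
    ∀ (m : ℕ) → ∃ λ (N : ℕ) → ∀ (n : ℕ) → N ≤ n →
    (∃ λ (s : ℕ) → SubrankAtLeast (KronPow (PhiBal h) n) s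
    × (2 * m + 1) ^ n ≤ s * suc m ^ n)
    × (∃ λ (s : ℕ) → SubrankAtMost (KronPow (PhiBal h) n) s
    × s * suc m ^ n ≤ (2 * m + 3) ^ n)
-- The threshold gives h ≥ 2 and hence k - 2 ≥ 2, which the parameter estimates use.
theorem1p2 = 4 , bounds
  where
  upper : ∀ m n → 2 ^ n * suc m ^ n ≤ (2 * m + 3) ^ n
  upper m n = begin
    2 ^ n * suc m ^ n ≡⟨ ^-distribʳ-* n 2 (suc m) ⟨
    (2 * suc m) ^ n ≤⟨ ^-monoˡ-≤ n (≤-trans (n≤1+n _) (≤-reflexive (e m))) ⟩
    (2 * m + 3) ^ n ∎
    where
    open ≤-Reasoning
    e : ∀ m → suc (2 * suc m) ≡ 2 * m + 3
    e = solve-∀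
  bounds : ∀ h → 4 ≤ h + h → ∀ m → ∃ λ N → ∀ n → N ≤ n →
    (∃ λ s → SubrankAtLeast (KronPow (PhiBal h) n) s × (2 * m + 1) ^ n ≤ s * suc m ^ n)
    × (∃ λ s → SubrankAtMost (KronPow (PhiBal h) n) s × s * suc m ^ n ≤ (2 * m + 3) ^ n)
  bounds (suc zero) (s≤s (s≤s ()))
  bounds (suc (suc h₂)) _ m = let N , lower = LowerBound.lower-bound h₂ m in
    N , λ n N≤n → lower n N≤n , 2 ^ n , subrank≤2^n n (PhiBal (suc (suc h₂))) , upper m n
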